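{- For every $k$, there are numbers $c,d\in\mathbb{N}$ such that for graphs of treewidth $k$ a tree decomposition of width $ck$ and depth $d\log n$ can be maintained in $\mathrm{DynFOLL}$ under changes of $\mathrm{polylog}(n)$ edges, where $n$ is the number of vertices of the graph.
   Context: A tree decomposition $(T,B)$ of a graph $G=(V,E)$ is a rooted tree $T$ with a map $B$ assigning to each tree node $t$ a bag $B(t)\subseteq V$, such that every vertex lies in some bag, every edge has both endpoints in some common bag, and for each vertex $v$ the tree nodes whose bags contain $v$ form a connected subgraph of $T$. Its width is the maximum bag size minus $1$, its depth the maximum root-to-leaf distance; the treewidth of $G$ is the minimum width of a tree decomposition. Dynamic complexity setting: structures have domain $\{0,\dots,n-1\}$ with linear order; changes insert or delete sets of at most $(\log n)^{c'}$ edges at once (arbitrary fixed constant $c'$); a dynamic program stores auxiliary relations (here encoding the tree decomposition, over tuples of domain elements) updated after each change by update programs evaluated on the changed input and old auxiliary relations, starting from an empty input with first-order definable initial auxiliary data. $\mathrm{DynFOLL}$: update programs are DLOGTIME-uniform polynomial-size circuits of depth $O(\log\log n)$ with NOT gates and unbounded fan-in AND/OR gates, equivalently a first-order formula with $\leq,+,\times$ iterated $O(\log\log n)$ times. -}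

module Defs where

open import Data.Nat using (ℕ; zero; suc; _+_; _*_; _^_; _≤_)
open import Data.Nat.Logarithm using (⌈log₂_⌉)
open import Data.Fin using (Fin; toℕ)
open import Data.Vec using (Vec; []; _∷_; lookup; _++_)
import Data.Vec as V
open import Data.List using (List; length; take)
import Data.List as List
open import Data.List.Membership.Propositional using (_∈_)
open import Data.List.Relation.Unary.All using (All)
open import Data.Product using (Σ; ∃; _×_; _,_; proj₁; proj₂)
open import Data.Sum using (_⊎_)
open import Data.Empty using (⊥)
open import Data.Unit using (⊤)
open import Relation.Binary.PropositionalEquality using (_≡_)
open import Relation.Nullary using (¬_)

data Form (Sym : Set) (ar : Sym → ℕ) : ℕ → Set where
  rel   : ∀ {v} (s : Sym) → Vec (Fin v) (ar s) → Form Sym ar v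
  eq    : ∀ {v} → Fin v → Fin v → Form Sym ar v
  le    : ∀ {v} → Fin v → Fin v → Form Sym ar v
  plus  : ∀ {v} → Fin v → Fin v → Fin v → Form Sym ar v
  times : ∀ {v} → Fin v → Fin v → Fin v → Form Sym ar v
  neg   : ∀ {v} → Form Sym ar v → Form Sym ar v
  and   : ∀ {v} → Form Sym ar v → Form Sym ar v → Form Sym ar v
  or    : ∀ {v} → Form Sym ar v → Form Sym ar v → Form Sym ar v
  ex    : ∀ {v} → Form Sym ar (suc v) → Form Sym ar v
  all   : ∀ {v} → Form Sym ar (suc v) → Form Sym ar v

Structure : (n : ℕ) (Sym : Set) (ar : Sym → ℕ) → Set₁
Structure n Sym ar = (s : Sym) → Vec (Fin n) (ar s) → Set

⟦_⟧ : ∀ {Sym ar n v} → Form Sym ar v → Structure n Sym ar → Vec (Fin n) v → Set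
⟦ rel s xs ⟧ A ρ = A s (V.map (lookup ρ) xs)
⟦ eq i j ⟧ A ρ = lookup ρ i ≡ lookup ρ j
⟦ le i j ⟧ A ρ = toℕ (lookup ρ i) ≤ toℕ (lookup ρ j)
⟦ plus i j l ⟧ A ρ = toℕ (lookup ρ i) + toℕ (lookup ρ j) ≡ toℕ (lookup ρ l)
⟦ times i j l ⟧ A ρ = toℕ (lookup ρ i) * toℕ (lookup ρ j) ≡ toℕ (lookup ρ l)
⟦ neg φ ⟧ A ρ = ¬ ⟦ φ ⟧ A ρ
⟦ and φ ψ ⟧ A ρ = ⟦ φ ⟧ A ρ × ⟦ ψ ⟧ A ρ
⟦ or φ ψ ⟧ A ρ = ⟦ φ ⟧ A ρ ⊎ ⟦ ψ ⟧ A ρ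
⟦ ex {v} φ ⟧ A ρ = Σ _ λ x → ⟦ φ ⟧ A (x ∷ ρ)
⟦ all φ ⟧ A ρ = ∀ x → ⟦ φ ⟧ A (x ∷ ρ)

noAr : ⊥ → ℕ
noAr ()

noStr : ∀ {n} → Structure n ⊥ noAr
noStr ()

-- Graphs (undirected, loop-free; edge relation kept symmetric) and
-- tree decompositions.

Graph : ℕ → Set₁
Graph n = Fin n → Fin n → Set

module _ {X : Set} (Par : X → X → Set) where
  -- Par x y : y is the parent of x in the rooted tree
  data ReachIn : ℕ → X → X → Set where
    here : ∀ {x} → ReachIn 0 x x
    up   : ∀ {j x y z} → Par x y → ReachIn j y z → ReachIn (suc j) x z

  data Walk (P : X → Set) : X → X → Set where
    stop : ∀ {t} → P t → Walk P t t
    down : ∀ {s s' t} → P s → Par s' s → Walk P s' t → Walk P s t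
    upw  : ∀ {s s' t} → P s → Par s s' → Walk P s' t → Walk P s t

record IsTreeDecomposition {n : ℕ} (E : Graph n) {X : Set}
         (Node : X → Set) (Par : X → X → Set) (Bag : X → Fin n → Set)
         (root : X) : Set where
  field
    par-node      : ∀ {x y} → Par x y → Node x × Node y
    par-fun       : ∀ {x y y'} → Par x y → Par x y' → y ≡ y'
    root-node     : Node root
    root-noParent : ∀ {y} → ¬ Par root y
    reach-root    : ∀ {x} → Node x → ∃ λ j → ReachIn Par j x root
    bag-node      : ∀ {t v} → Bag t v → Node t
    cover-vertex  : ∀ v → ∃ λ t → Bag t v
    cover-edge    : ∀ {u v} → E u v → ∃ λ t → Bag t u × Bag t v
    connected     : ∀ {v s t} → Bag s v → Bag t v → Walk Par (λ x → Bag x v) s t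

WidthAtMost : ∀ {n} {X : Set} (Node : X → Set) (Bag : X → Fin n → Set) → ℕ → Set
WidthAtMost Node Bag w =
  ∀ t → Node t → ∃ λ (L : List _) → length L ≤ suc w × (∀ v → Bag t v → v ∈ L)

DepthAtMost : {X : Set} (Node : X → Set) (Par : X → X → Set) → X → ℕ → Set
DepthAtMost Node Par root D =
  ∀ x → Node x → ∃ λ j → j ≤ D × ReachIn Par j x root

TreewidthAtMost : ∀ {n} → ℕ → Graph n → Set₁
TreewidthAtMost {n} k E =
  Σ ℕ λ N → Σ (Fin N → Fin N → Set) λ Par → Σ (Fin N → Fin n → Set) λ Bag →
  Σ (Fin N) λ root →
    IsTreeDecomposition E (λ _ → ⊤) Par Bag root × WidthAtMost (λ _ → ⊤) Bag k

-- Dynamic programs with update formulas in FO[O(log log n)]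
-- (FO formula with ≤,+,× iterated O(log log n) times).

-- auxiliary schema: designated relations node (arity r), par (arity 2r),
-- bag (arity 1+r) encoding the tree decomposition, plus m further relations.
data AuxSym (m : ℕ) : Set where
  node par bag : AuxSym m
  extra        : Fin m → AuxSym m

auxAr : ∀ (r : ℕ) {m} → Vec ℕ m → AuxSym m → ℕ
auxAr r ars node      = r
auxAr r ars par       = r + r
auxAr r ars bag       = suc r
auxAr r ars (extra i) = lookup ars i

-- vocabulary of update formulas: the (changed) input graph, the changed
-- edges, the old auxiliary relations, and a working relation that is iterated
data USym (m : ℕ) : Set where
  edge chg wrk : USym m
  old          : AuxSym m → USym m

uAr : ∀ (r : ℕ) {m} → Vec ℕ m → ℕ → USym m → ℕ
uAr r ars w edge    = 2
uAr r ars w chg     = 2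
uAr r ars w wrk     = w
uAr r ars w (old s) = auxAr r ars s

record DynProg : Set where
  field
    r m w  : ℕ
    ars    : Vec ℕ m
    a b    : ℕ
    init   : (s : AuxSym m) → Form ⊥ noAr (auxAr r ars s)
    stepIns stepDel : Form (USym m) (uAr r ars w) w
    outIns  outDel  : (s : AuxSym m) → Form (USym m) (uAr r ars w) (auxAr r ars s)

data Change (n : ℕ) : Set where
  ins del : List (Fin n × Fin n) → Change n

InΔ : ∀ {n} → List (Fin n × Fin n) → Graph n
InΔ L u v = ((u , v) ∈ L) ⊎ ((v , u) ∈ L)

ValidChange : ∀ {n} → ℕ → Change n → Set
ValidChange B (ins L) = length L ≤ B × All (λ e → ¬ proj₁ e ≡ proj₂ e) L
ValidChange B (del L) = length L ≤ B × All (λ e → ¬ proj₁ e ≡ proj₂ e) L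

module Run (P : DynProg) where
  open DynProg P

  AuxState : ℕ → Set₁
  AuxState n = Structure n (AuxSym m) (auxAr r ars)

  ustr : ∀ {n} → Graph n → Graph n → AuxState n → (Vec (Fin n) w → Set)
       → Structure n (USym m) (uAr r ars w)
  ustr E D A W edge    (x ∷ y ∷ []) = E x y
  ustr E D A W chg     (x ∷ y ∷ []) = D x y
  ustr E D A W wrk     xs = W xs
  ustr E D A W (old s) xs = A s xs

  iterW : ∀ {n} → ℕ → Form (USym m) (uAr r ars w) w → Graph n → Graph n
        → AuxState n → (Vec (Fin n) w → Set)
  iterW zero    φ E D A = λ _ → ⊥
  iterW (suc i) φ E D A = ⟦ φ ⟧ (ustr E D A (iterW i φ E D A))

  iterations : ℕ → ℕ
  iterations n = a * ⌈log₂ ⌈log₂ n ⌉ ⌉ + b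

  State : ℕ → Set₁
  State n = Graph n × AuxState n

  initState : ∀ {n} → State n
  initState = (λ _ _ → ⊥) , (λ s → ⟦ init s ⟧ noStr)

  step : ∀ {n} → Change n → State n → State n
  step {n} (ins L) (E , A) =
    E' , λ s → ⟦ outIns s ⟧ (ustr E' D A (iterW (iterations n) stepIns E' D A))
    where D = InΔ L
          E' : Graph n
          E' u v = E u v ⊎ D u v
  step {n} (del L) (E , A) =
    E' , λ s → ⟦ outDel s ⟧ (ustr E' D A (iterW (iterations n) stepDel E' D A))
    where D = InΔ L
          E' : Graph n
          E' u v = E u v × ¬ D u v

  runFrom : ∀ {n} → State n → List (Change n) → State n
  runFrom S List.[] = S
  runFrom S (c List.∷ cs) = runFrom (step c S) cs

  run : ∀ {n} → List (Change n) → State n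
  run = runFrom initState

  EncodesTD : ∀ {n} → State n → ℕ → ℕ → Set
  EncodesTD {n} (E , A) wd dp =
    Σ (Vec (Fin n) r) λ root →
      IsTreeDecomposition E Node Par Bag root
      × WidthAtMost Node Bag wd × DepthAtMost Node Par root dp
    where
      Node : Vec (Fin n) r → Set
      Node t = A node t
      Par : Vec (Fin n) r → Vec (Fin n) r → Set
      Par x y = A par (x ++ y)
      Bag : Vec (Fin n) r → Fin n → Set
      Bag t v = A bag (v ∷ t)

Maintains : DynProg → ℕ → (ℕ → ℕ) → (ℕ → ℕ) → (ℕ → ℕ) → Set₁
Maintains P k B wd dp =
  ∀ (n : ℕ) → 1 ≤ n → ∀ (cs : List (Change n)) →
    All (ValidChange (B n)) cs →
    (∀ i → i ≤ length cs → TreewidthAtMost k (proj₁ (Run.run P (take i cs)))) →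
    Run.EncodesTD P (Run.run P cs) (wd n) (dp n)

{-# OPTIONS --safe #-}
-- Vertex 0 is removed from the graph and put into every bag. For every tuple A of O(k) vertices the
-- program stores the connectivity of G - A, the sizes of its components and the number of vertices in
-- components adjacent to all of A, and it stores a closure operator: a vertex has O(log n) vertices in its
-- closure, and a component of the complement of a closed set is separated from it by a single tuple.
-- After a change of polylog(n) edges, let X be the closure of the touched vertices and of the vertices of
-- a query. X has polylogarithmic size, and the components outside X did not change, so that the old data
-- describe how they are attached to X. Hence the new connectivity is reachability along a path in X, and
-- each new size is a sum of polylog(n) old sizes. A new decomposition is definable from these data: a node
-- (v , Z) stands for the component of v in G - Z, its bag is the lexicographically least tuple that contains
-- the boundary of the component, splits it into components of at most half the size and keeps their
-- boundaries small. Such a bag exists because bags of an arbitrary decomposition of width k are balanced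
-- separators. As sizes are halved, the nodes are those reachable from the root in O(log n) steps.
-- Reachability, sums and nodes are all transitive closures along paths of length polylog(n), which
-- O(log log n) rounds of squaring a single relation compute.
module Submission where

open import Defs
open import Data.Nat using (ℕ; zero; suc; _+_; _*_; _^_; _∸_; _⊓_; _≤_; _<_; z≤n; s≤s; s≤s⁻¹; _≤?_; _<?_; ⌊_/2⌋; ⌈_/2⌉)
open import Data.Nat.Properties
open import Algebra.Properties.CommutativeSemigroup +-commutativeSemigroup using (interchange)
open import Data.Nat.Logarithm using (⌈log₂_⌉; ⌈log₂⌉-mono-≤; ⌈log₂2^n⌉≡n; ⌈log₂⌈n/2⌉⌉≡⌈log₂n⌉∸1)
open import Data.Nat.Induction using (<-rec)
open import Data.Nat.Solver using (module +-*-Solver)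
open import Data.Fin using (Fin; zero; suc; toℕ; fromℕ; fromℕ<; _↑ˡ_; _↑ʳ_)
import Data.Fin.Properties as FP
open import Data.Vec using (Vec; []; _∷_; lookup; _++_; tabulate; toList)
import Data.Vec as V
import Data.Vec.Properties as VP
open import Data.List using (List; []; _∷_; length; filter; take)
import Data.List as L
import Data.List.Properties as LP
open import Data.List.Membership.Propositional using (_∈_; lose)
open import Data.List.Membership.Propositional.Properties
  using (∈-filter⁺; ∈-allFin; ∈-++⁺ˡ; ∈-++⁺ʳ; ∈-map⁺; ∈-cartesianProductWith⁺)
open import Data.List.Relation.Unary.All using (All)
import Data.List.Relation.Unary.All as All
open import Data.List.Relation.Unary.Any using (here; there)
import Data.List.Relation.Unary.Any as Any
open import Data.Product using (Σ; ∃; _×_; _,_; proj₁; proj₂)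
import Data.Product.Properties as PP
open import Data.Sum using (_⊎_; inj₁; inj₂; [_,_]′)
import Data.Sum.Properties as SP
open import Data.Empty using (⊥; ⊥-elim)
open import Data.Unit using (⊤; tt)
open import Function using (_∘_; id)
open import Relation.Binary.Construct.Closure.ReflexiveTransitive
  using (Star; ε; _◅_; _◅◅_; gmap) renaming (map to Star-map)
open import Relation.Binary.Definitions using (tri<; tri≈; tri>)
open import Relation.Binary.PropositionalEquality
open import Relation.Nullary using (¬_; Dec; yes; no)
open import Relation.Nullary.Decidable using (map′; _×-dec_; _⊎-dec_; _→-dec_; ¬?; decidable-stable)

-- Typed first-order formulas

-- The obstacle is to update sizes: one change can merge arbitrarily many components of `G - X`, too
-- many to be added one by one. Those with the same neighbourhood in `X` are added as one class. A
-- neighbourhood fits into a tuple, so there are polylogarithmically many classes, and the number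
-- stored for that tuple, minus what belongs to components that meet `X`, is the size of the class.
-- Leaving out vertex 0 keeps every size below `n`, so that domain elements can name sizes, and
-- frees 0 as padding. The constants solve an equation: a boundary of `m` vertices is halved by one
-- separator and receives both separators, of `k + 1` vertices each, so `m / 2 + 2 (k + 1) = m`.
-- Hence `m = 4 (k + 1)`, and a bag has `m + 2 (k + 1)` entries. Only one relation may be iterated,
-- while the closures build on each other. They run side by side in it, and each starts afresh when
-- the relation that it closes changes. The graph is decidable, the given decomposition of width `k`
-- need not be. Its separators exist under double negation only, which suffices for a search among
-- finitely many tuples for a decidable property.

infix 2 _⟺_
_⟺_ : Set → Set → Set
P ⟺ Q = (P → Q) × (Q → P)

⟺-refl : {P : Set} → P ⟺ P
⟺-refl = id , id

⟺-sym : {P Q : Set} → P ⟺ Q → Q ⟺ P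
⟺-sym (f , g) = g , f

⟺-trans : {P Q R : Set} → P ⟺ Q → Q ⟺ R → P ⟺ R
⟺-trans (f , g) (h , k) = h ∘ f , g ∘ k

dec-⟺ : {P Q : Set} → P ⟺ Q → Dec P → Dec Q
dec-⟺ (f , g) = map′ f g

×-cong : {P P' Q Q' : Set} → P ⟺ P' → Q ⟺ Q' → (P × Q) ⟺ (P' × Q')
×-cong (f , g) (h , k) = (λ (p , q) → f p , h q) , (λ (p , q) → g p , k q)

⊎-cong : {P P' Q Q' : Set} → P ⟺ P' → Q ⟺ Q' → (P ⊎ Q) ⟺ (P' ⊎ Q')
⊎-cong (f , g) (h , k) = (λ { (inj₁ p) → inj₁ (f p) ; (inj₂ q) → inj₂ (h q) })
                       , (λ { (inj₁ p) → inj₁ (g p) ; (inj₂ q) → inj₂ (k q) })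

¬-cong : {P P' : Set} → P ⟺ P' → (¬ P) ⟺ (¬ P')
¬-cong (f , g) = (λ h → h ∘ g) , (λ h → h ∘ f)

Σ-cong : {X : Set} {P Q : X → Set} → (∀ x → P x ⟺ Q x) → Σ X P ⟺ Σ X Q
Σ-cong h = (λ (x , p) → x , proj₁ (h x) p) , (λ (x , p) → x , proj₂ (h x) p)

Π-cong : {X : Set} {P Q : X → Set} → (∀ x → P x ⟺ Q x) → (∀ x → P x) ⟺ (∀ x → Q x)
Π-cong h = (λ f x → proj₁ (h x) (f x)) , (λ f x → proj₂ (h x) (f x))

≡⟺ : {A : Set} {x y x' y' : A} → x ≡ x' → y ≡ y' → (x ≡ y) ⟺ (x' ≡ y')
≡⟺ refl refl = ⟺-refl

opaque

  any?ᵛ : ∀ {n} q {P : Vec (Fin n) q → Set} → (∀ v → Dec (P v)) → Dec (∃ P)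
  any?ᵛ zero P? = map′ (λ p → [] , p) (λ { ([] , p) → p }) (P? [])
  any?ᵛ (suc q) P? = map′ (λ (x , v , p) → (x ∷ v) , p) (λ { ((x ∷ v) , p) → x , v , p })
    (FP.any? (λ x → any?ᵛ q (λ v → P? (x ∷ v))))

  all?ᵛ : ∀ {n} q {P : Vec (Fin n) q → Set} → (∀ v → Dec (P v)) → Dec (∀ v → P v)
  all?ᵛ zero P? = map′ (λ { p [] → p }) (λ f → f []) (P? [])
  all?ᵛ (suc q) P? = map′ (λ { f (x ∷ v) → f x v }) (λ f x v → f (x ∷ v))
    (FP.all? (λ x → all?ᵛ q (λ v → P? (x ∷ v))))

-- Tuples code sets of vertices. The vertex 0 belongs to every coded set, so tuples can be padded with it.
In : ∀ {n q} → Fin n → Vec (Fin n) q → Set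
In x []      = toℕ x ≡ 0
In x (a ∷ A) = x ≡ a ⊎ In x A

In? : ∀ {n q} (x : Fin n) (A : Vec (Fin n) q) → Dec (In x A)
In? x []      = toℕ x Data.Nat.≟ 0
In? x (a ∷ A) = (x FP.≟ a) ⊎-dec In? x A

Lex : ∀ {n q} → Vec (Fin n) q → Vec (Fin n) q → Set
Lex []      []      = ⊥
Lex (a ∷ A) (b ∷ B) = toℕ a < toℕ b ⊎ (a ≡ b × Lex A B)

Lex? : ∀ {n q} (A B : Vec (Fin n) q) → Dec (Lex A B)
Lex? []      []      = no λ ()
Lex? (a ∷ A) (b ∷ B) = (toℕ a <? toℕ b) ⊎-dec ((a FP.≟ b) ×-dec Lex? A B)

data Sort : Set where
  elt : Sort
  tup : ℕ → Sort

Ctx : Set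
Ctx = List Sort

El : ℕ → Sort → Set
El n elt     = Fin n
El n (tup q) = Vec (Fin n) q

Env : ℕ → Ctx → Set
Env n []      = ⊤
Env n (σ ∷ Γ) = El n σ × Env n Γ

infix 3 _∋_
data _∋_ : Ctx → Sort → Set where
  vz : ∀ {Γ σ} → (σ ∷ Γ) ∋ σ
  vs : ∀ {Γ σ τ} → Γ ∋ σ → (τ ∷ Γ) ∋ σ

get : ∀ {n Γ σ} → Γ ∋ σ → Env n Γ → El n σ
get vz     (x , ρ) = x
get (vs i) (x , ρ) = get i ρ

Args : Ctx → Ctx → Set
Args Γ []      = ⊤
Args Γ (σ ∷ Δ) = (Γ ∋ σ) × Args Γ Δ

gets : ∀ {n Γ} Δ → Args Γ Δ → Env n Γ → Env n Δ
gets []      _        ρ = tt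
gets (σ ∷ Δ) (i , is) ρ = get i ρ , gets Δ is ρ

infix  9 _≐_ _≺_ _≼_ _∊_
infixr 7 _∧_
infixr 6 _∨_
infixr 5 _⇒_
data Fm (Voc : Set) (sig : Voc → Ctx) : Ctx → Set where
  atom    : ∀ {Γ} (R : Voc) → Args Γ (sig R) → Fm Voc sig Γ
  _≐_     : ∀ {Γ σ} → Γ ∋ σ → Γ ∋ σ → Fm Voc sig Γ
  _≺_ _≼_ : ∀ {Γ} → Γ ∋ elt → Γ ∋ elt → Fm Voc sig Γ
  add     : ∀ {Γ} → Γ ∋ elt → Γ ∋ elt → Γ ∋ elt → Fm Voc sig Γ
  isZ     : ∀ {Γ} → Γ ∋ elt → Fm Voc sig Γ
  _∊_     : ∀ {Γ q} → Γ ∋ elt → Γ ∋ tup q → Fm Voc sig Γ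
  lex     : ∀ {Γ q} → Γ ∋ tup q → Γ ∋ tup q → Fm Voc sig Γ
  ~_      : ∀ {Γ} → Fm Voc sig Γ → Fm Voc sig Γ
  _∧_ _∨_ _⇒_ : ∀ {Γ} → Fm Voc sig Γ → Fm Voc sig Γ → Fm Voc sig Γ
  ∃'_ ∀'_     : ∀ {Γ σ} → Fm Voc sig (σ ∷ Γ) → Fm Voc sig Γ
infix 8 ~_
infix 4 ∃'_ ∀'_

TStr : (n : ℕ) (Voc : Set) (sig : Voc → Ctx) → Set₁
TStr n Voc sig = (R : Voc) → Env n (sig R) → Set

⟪_⟫ : ∀ {Voc sig n Γ} → Fm Voc sig Γ → TStr n Voc sig → Env n Γ → Set
⟪_⟫ {sig = sig} (atom R is) S ρ = S R (gets (sig R) is ρ)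
⟪_⟫ {n = n} (_≐_ {σ = σ} i j) S ρ = _≡_ {A = El n σ} (get i ρ) (get j ρ)
⟪ i ≺ j ⟫     S ρ = toℕ (get i ρ) < toℕ (get j ρ)
⟪ i ≼ j ⟫     S ρ = toℕ (get i ρ) ≤ toℕ (get j ρ)
⟪ add i j l ⟫ S ρ = toℕ (get i ρ) + toℕ (get j ρ) ≡ toℕ (get l ρ)
⟪ isZ i ⟫     S ρ = toℕ (get i ρ) ≡ 0
⟪ i ∊ a ⟫     S ρ = In (get i ρ) (get a ρ)
⟪ lex a b ⟫   S ρ = Lex (get a ρ) (get b ρ)
⟪ ~ φ ⟫       S ρ = ¬ ⟪ φ ⟫ S ρ
⟪ φ ∧ ψ ⟫     S ρ = ⟪ φ ⟫ S ρ × ⟪ ψ ⟫ S ρ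
⟪ φ ∨ ψ ⟫     S ρ = ⟪ φ ⟫ S ρ ⊎ ⟪ ψ ⟫ S ρ
⟪ φ ⇒ ψ ⟫     S ρ = ⟪ φ ⟫ S ρ → ⟪ ψ ⟫ S ρ
⟪_⟫ {n = n} (∃'_ {σ = σ} φ) S ρ = Σ (El n σ) λ x → ⟪ φ ⟫ S (x , ρ)
⟪_⟫ {n = n} (∀'_ {σ = σ} φ) S ρ = (x : El n σ) → ⟪ φ ⟫ S (x , ρ)

_≟ᴱ_ : ∀ {n σ} (x y : El n σ) → Dec (x ≡ y)
_≟ᴱ_ {σ = elt}   = FP._≟_
_≟ᴱ_ {σ = tup q} = VP.≡-dec FP._≟_

anyᴱ : ∀ {n} σ {P : El n σ → Set} → (∀ v → Dec (P v)) → Dec (∃ P)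
anyᴱ elt     = FP.any?
anyᴱ (tup q) = any?ᵛ q

allᴱ : ∀ {n} σ {P : El n σ → Set} → (∀ v → Dec (P v)) → Dec (∀ v → P v)
allᴱ elt     = FP.all?
allᴱ (tup q) = all?ᵛ q

opaque

  decFm : ∀ {Voc sig n Γ} {S : TStr n Voc sig} → (∀ R ρ → Dec (S R ρ)) →
          (φ : Fm Voc sig Γ) (ρ : Env n Γ) → Dec (⟪ φ ⟫ S ρ)
  decFm S? (atom R is) ρ = S? R _
  decFm {n = n} S? (_≐_ {σ = σ} i j) ρ = _≟ᴱ_ {n} {σ} (get i ρ) (get j ρ)
  decFm S? (i ≺ j)     ρ = toℕ (get i ρ) <? toℕ (get j ρ)
  decFm S? (i ≼ j)     ρ = toℕ (get i ρ) ≤? toℕ (get j ρ)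
  decFm S? (add i j l) ρ = _ Data.Nat.≟ _
  decFm S? (isZ i)     ρ = _ Data.Nat.≟ _
  decFm S? (i ∊ a)     ρ = In? _ _
  decFm S? (lex a b)   ρ = Lex? _ _
  decFm S? (~ φ)       ρ = ¬? (decFm S? φ ρ)
  decFm S? (φ ∧ ψ)     ρ = decFm S? φ ρ ×-dec decFm S? ψ ρ
  decFm S? (φ ∨ ψ)     ρ = decFm S? φ ρ ⊎-dec decFm S? ψ ρ
  decFm S? (φ ⇒ ψ)     ρ = decFm S? φ ρ →-dec decFm S? ψ ρ
  decFm S? (∃'_ {σ = σ} φ) ρ = anyᴱ σ (λ x → decFm S? φ (x , ρ))
  decFm S? (∀'_ {σ = σ} φ) ρ = allᴱ σ (λ x → decFm S? φ (x , ρ))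

-- A tuple of variables of a first-order formula with v free variables is an environment over Fin v.
mapEl : ∀ {n v} σ → (Fin v → Fin n) → El v σ → El n σ
mapEl elt     f x = f x
mapEl (tup q) f x = V.map f x

mapE : ∀ {n v} Γ → (Fin v → Fin n) → Env v Γ → Env n Γ
mapE []      f ρ       = tt
mapE (σ ∷ Γ) f (x , ρ) = mapEl σ f x , mapE Γ f ρ

mapEl-∘ : ∀ {n u v} σ (f : Fin v → Fin n) (g : Fin u → Fin v) {h : Fin u → Fin n} →
          (∀ x → f (g x) ≡ h x) → ∀ x → mapEl σ f (mapEl σ g x) ≡ mapEl σ h x
mapEl-∘ elt     f g e x = e x
mapEl-∘ (tup q) f g e x = trans (sym (VP.map-∘ f g x)) (VP.map-cong e x)

mapE-∘ : ∀ {n u v} Γ (f : Fin v → Fin n) (g : Fin u → Fin v) {h : Fin u → Fin n} →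
         (∀ x → f (g x) ≡ h x) → ∀ ρ → mapE Γ f (mapE Γ g ρ) ≡ mapE Γ h ρ
mapE-∘ []      f g e ρ       = refl
mapE-∘ (σ ∷ Γ) f g e (x , ρ) = cong₂ _,_ (mapEl-∘ σ f g e x) (mapE-∘ Γ f g e ρ)

get-mapE : ∀ {n v Γ σ} (f : Fin v → Fin n) (i : Γ ∋ σ) (ρ : Env v Γ) →
           get i (mapE Γ f ρ) ≡ mapEl σ f (get i ρ)
get-mapE f vz     (x , ρ) = refl
get-mapE f (vs i) (x , ρ) = get-mapE f i ρ

gets-mapE : ∀ {n v Γ} Δ (f : Fin v → Fin n) (is : Args Γ Δ) (ρ : Env v Γ) →
            gets Δ is (mapE Γ f ρ) ≡ mapE Δ f (gets Δ is ρ)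
gets-mapE []      f is       ρ = refl
gets-mapE (σ ∷ Δ) f (i , is) ρ = cong₂ _,_ (get-mapE f i ρ) (gets-mapE Δ f is ρ)

-- Compilation into plain first-order formulas

module _ {Sym : Set} {ar : Sym → ℕ} where

  falseF : ∀ {v} → Form Sym ar v
  falseF = ex (neg (eq zero zero))

  zeroF : ∀ {v} → Fin v → Form Sym ar v
  zeroF x = all (le (suc x) zero)

  memF : ∀ {v q} → Fin v → Vec (Fin v) q → Form Sym ar v
  memF x []      = zeroF x
  memF x (a ∷ A) = or (eq x a) (memF x A)

  lexF : ∀ {v q} → Vec (Fin v) q → Vec (Fin v) q → Form Sym ar v
  lexF []      []      = falseF
  lexF (a ∷ A) (b ∷ B) = or (neg (le b a)) (and (eq a b) (lexF A B))

  eqF : ∀ {v} σ → El v σ → El v σ → Form Sym ar v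
  eqF elt     x y = eq x y
  eqF (tup q) x y = go x y
    where
    go : ∀ {v q} → Vec (Fin v) q → Vec (Fin v) q → Form Sym ar v
    go []      []      = neg falseF
    go (a ∷ A) (b ∷ B) = and (eq a b) (go A B)

  exN : ∀ q {v} → Form Sym ar (q + v) → Form Sym ar v
  exN zero    φ = φ
  exN (suc q) φ = exN q (ex φ)

  allN : ∀ q {v} → Form Sym ar (q + v) → Form Sym ar v
  allN zero    φ = φ
  allN (suc q) φ = allN q (all φ)

  -- Symbols are interpreted by formulas, not by symbols: a relation that is itself defined by a
  -- formula can then be used as an atom, and compilation substitutes its definition.
  Int : (Voc : Set) (sig : Voc → Ctx) → Set
  Int Voc sig = (R : Voc) → ∀ {v} → Env v (sig R) → Form Sym ar v

  opaque

    cmp : ∀ {Voc sig Γ v} → Int Voc sig → Env v Γ → Fm Voc sig Γ → Form Sym ar v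
    cmp {sig = sig} I p (atom R is) = I R (gets (sig R) is p)
    cmp I p (_≐_ {σ = σ} i j) = eqF σ (get i p) (get j p)
    cmp I p (i ≺ j)     = neg (le (get j p) (get i p))
    cmp I p (i ≼ j)     = le (get i p) (get j p)
    cmp I p (add i j l) = plus (get i p) (get j p) (get l p)
    cmp I p (isZ i)     = zeroF (get i p)
    cmp I p (i ∊ a)     = memF (get i p) (get a p)
    cmp I p (lex a b)   = lexF (get a p) (get b p)
    cmp I p (~ φ)       = neg (cmp I p φ)
    cmp I p (φ ∧ ψ)     = and (cmp I p φ) (cmp I p ψ)
    cmp I p (φ ∨ ψ)     = or (cmp I p φ) (cmp I p ψ)
    cmp I p (φ ⇒ ψ)     = or (neg (cmp I p φ)) (cmp I p ψ)
    cmp {Γ = Γ} I p (∃'_ {σ = elt} φ)   = ex (cmp I (zero , mapE Γ suc p) φ)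
    cmp {Γ = Γ} I p (∃'_ {σ = tup q} φ) =
      exN q (cmp I (tabulate (λ i → i ↑ˡ _) , mapE Γ (q ↑ʳ_) p) φ)
    cmp {Γ = Γ} I p (∀'_ {σ = elt} φ)   = all (cmp I (zero , mapE Γ suc p) φ)
    cmp {Γ = Γ} I p (∀'_ {σ = tup q} φ) =
      allN q (cmp I (tabulate (λ i → i ↑ˡ _) , mapE Γ (q ↑ʳ_) p) φ)

  module _ {n : ℕ} {A : Structure n Sym ar} where

    exN-correct : ∀ q {v} (φ : Form Sym ar (q + v)) (ρ : Vec (Fin n) v) →
                  ⟦ exN q φ ⟧ A ρ ⟺ (∃ λ (ys : Vec (Fin n) q) → ⟦ φ ⟧ A (ys ++ ρ))
    exN-correct zero    φ ρ = (λ p → [] , p) , (λ { ([] , p) → p })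
    exN-correct (suc q) φ ρ with exN-correct q (ex φ) ρ
    ... | f , g = (λ p → let ys , x , h = f p in (x ∷ ys) , h)
                , (λ { ((x ∷ ys) , h) → g (ys , x , h) })

    allN-correct : ∀ q {v} (φ : Form Sym ar (q + v)) (ρ : Vec (Fin n) v) →
                   ⟦ allN q φ ⟧ A ρ ⟺ ((ys : Vec (Fin n) q) → ⟦ φ ⟧ A (ys ++ ρ))
    allN-correct zero    φ ρ = (λ { p [] → p }) , (λ f → f [])
    allN-correct (suc q) φ ρ with allN-correct q (all φ) ρ
    ... | f , g = (λ { p (x ∷ ys) → f p ys x }) , (λ h → g (λ ys x → h (x ∷ ys)))

    falseF-correct : ∀ {v} (ρ : Vec (Fin n) v) → ¬ ⟦ falseF ⟧ A ρ
    falseF-correct ρ (x , p) = p refl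

    zeroF-correct : ∀ {v} (ρ : Vec (Fin n) v) x → ⟦ zeroF x ⟧ A ρ ⟺ (toℕ (lookup ρ x) ≡ 0)
    zeroF-correct ρ x with lookup ρ x
    ... | zero  = (λ _ → refl) , (λ _ _ → z≤n)
    ... | suc y = (λ h → ⊥-elim (n≮0 (h zero))) , (λ ())

    memF-correct : ∀ {v q} (ρ : Vec (Fin n) v) x (B : Vec (Fin v) q) →
                   ⟦ memF x B ⟧ A ρ ⟺ In (lookup ρ x) (V.map (lookup ρ) B)
    memF-correct ρ x []      = zeroF-correct ρ x
    memF-correct ρ x (b ∷ B) = ⊎-cong ⟺-refl (memF-correct ρ x B)

    lexF-correct : ∀ {v q} (ρ : Vec (Fin n) v) (B C : Vec (Fin v) q) →
                   ⟦ lexF B C ⟧ A ρ ⟺ Lex (V.map (lookup ρ) B) (V.map (lookup ρ) C)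
    lexF-correct ρ []      []      = (λ p → falseF-correct ρ p) , ⊥-elim
    lexF-correct ρ (b ∷ B) (c ∷ C) =
      ⊎-cong (≰⇒> , <⇒≱) (×-cong ⟺-refl (lexF-correct ρ B C))

    eqF-correct : ∀ {v} σ (ρ : Vec (Fin n) v) (x y : El v σ) →
                  ⟦ eqF σ x y ⟧ A ρ ⟺ (mapEl σ (lookup ρ) x ≡ mapEl σ (lookup ρ) y)
    eqF-correct elt     ρ x y = ⟺-refl
    eqF-correct (tup zero)     ρ [] [] = (λ _ → refl) , (λ _ → falseF-correct ρ)
    eqF-correct (tup (suc q)) ρ (x ∷ X) (y ∷ Y) with eqF-correct (tup q) ρ X Y
    ... | f , g = (λ (a , b) → cong₂ _∷_ a (f b)) , (λ e → VP.∷-injectiveˡ e , g (VP.∷-injectiveʳ e))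

    fst-tuple : ∀ {q v} (ys : Vec (Fin n) q) (ρ : Vec (Fin n) v) →
                V.map (lookup (ys ++ ρ)) (tabulate (λ i → i ↑ˡ v)) ≡ ys
    fst-tuple ys ρ = trans (sym (VP.tabulate-∘ _ _))
      (trans (VP.tabulate-cong (VP.lookup-++ˡ ys ρ)) (VP.tabulate∘lookup ys))

    Interprets : ∀ {Voc sig} → Int Voc sig → TStr n Voc sig → Set
    Interprets {sig = sig} I S = ∀ R {v} (p : Env v (sig R)) (ρ : Vec (Fin n) v) →
      ⟦ I R p ⟧ A ρ ⟺ S R (mapE (sig R) (lookup ρ) p)

    opaque
      unfolding cmp

      -- Decidability is needed because implication is compiled classically.
      cmp-correct : ∀ {Voc sig} (I : Int Voc sig) (S : TStr n Voc sig) → Interprets I S →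
                    (∀ {v} (φ : Form Sym ar v) (ρ : Vec (Fin n) v) → Dec (⟦ φ ⟧ A ρ)) →
                    ∀ {Γ v} (p : Env v Γ) (φ : Fm Voc sig Γ) (ρ : Vec (Fin n) v) →
                    ⟦ cmp I p φ ⟧ A ρ ⟺ ⟪ φ ⟫ S (mapE Γ (lookup ρ) p)
      cmp-correct {Voc} {sig} I S ok dec = go
        where
        go : ∀ {Γ v} (p : Env v Γ) (φ : Fm Voc sig Γ) (ρ : Vec (Fin n) v) →
             ⟦ cmp I p φ ⟧ A ρ ⟺ ⟪ φ ⟫ S (mapE Γ (lookup ρ) p)
        go p (atom R is) ρ rewrite gets-mapE (sig R) (lookup ρ) is p = ok R _ ρ
        go p (_≐_ {σ = σ} i j) ρ
          rewrite get-mapE (lookup ρ) i p | get-mapE (lookup ρ) j p = eqF-correct σ ρ _ _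
        go p (i ≺ j) ρ rewrite get-mapE (lookup ρ) i p | get-mapE (lookup ρ) j p = ≰⇒> , <⇒≱
        go p (i ≼ j) ρ rewrite get-mapE (lookup ρ) i p | get-mapE (lookup ρ) j p = ⟺-refl
        go p (add i j l) ρ
          rewrite get-mapE (lookup ρ) i p | get-mapE (lookup ρ) j p | get-mapE (lookup ρ) l p = ⟺-refl
        go p (isZ i) ρ rewrite get-mapE (lookup ρ) i p = zeroF-correct ρ _
        go p (i ∊ a) ρ rewrite get-mapE (lookup ρ) i p | get-mapE (lookup ρ) a p = memF-correct ρ _ _
        go p (lex a b) ρ rewrite get-mapE (lookup ρ) a p | get-mapE (lookup ρ) b p = lexF-correct ρ _ _
        go p (~ φ) ρ = ¬-cong (go p φ ρ)
        go p (φ ∧ ψ) ρ = ×-cong (go p φ ρ) (go p ψ ρ)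
        go p (φ ∨ ψ) ρ = ⊎-cong (go p φ ρ) (go p ψ ρ)
        go p (φ ⇒ ψ) ρ with dec (cmp I p φ) ρ | go p φ ρ | go p ψ ρ
        ... | yes a | f , g | f' , g' =
          (λ { (inj₁ na) _ → ⊥-elim (na a) ; (inj₂ b) _ → f' b }) , (λ h → inj₂ (g' (h (f a))))
        ... | no na | f , g | f' , g' =
          (λ { (inj₁ _) a → ⊥-elim (na (g a)) ; (inj₂ b) _ → f' b }) , (λ h → inj₁ na)
        go {Γ} p (∃'_ {σ = elt} φ) ρ = Σ-cong λ x →
          subst (λ r → ⟦ cmp I (zero , mapE Γ suc p) φ ⟧ A (x ∷ ρ) ⟺ ⟪ φ ⟫ S (x , r))
            (mapE-∘ Γ (lookup (x ∷ ρ)) suc (λ _ → refl) p) (go _ φ (x ∷ ρ))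
        go {Γ} p (∃'_ {σ = tup q} φ) ρ = ⟺-trans (exN-correct q _ ρ) (Σ-cong λ ys →
          subst₂ (λ t r → ⟦ cmp I _ φ ⟧ A (ys ++ ρ) ⟺ ⟪ φ ⟫ S (t , r))
            (fst-tuple ys ρ) (mapE-∘ Γ (lookup (ys ++ ρ)) (q ↑ʳ_) (VP.lookup-++ʳ ys ρ) p)
            (go _ φ (ys ++ ρ)))
        go {Γ} p (∀'_ {σ = elt} φ) ρ = Π-cong λ x →
          subst (λ r → ⟦ cmp I (zero , mapE Γ suc p) φ ⟧ A (x ∷ ρ) ⟺ ⟪ φ ⟫ S (x , r))
            (mapE-∘ Γ (lookup (x ∷ ρ)) suc (λ _ → refl) p) (go _ φ (x ∷ ρ))
        go {Γ} p (∀'_ {σ = tup q} φ) ρ = ⟺-trans (allN-correct q _ ρ) (Π-cong λ ys →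
          subst₂ (λ t r → ⟦ cmp I _ φ ⟧ A (ys ++ ρ) ⟺ ⟪ φ ⟫ S (t , r))
            (fst-tuple ys ρ) (mapE-∘ Γ (lookup (ys ++ ρ)) (q ↑ʳ_) (VP.lookup-++ʳ ys ρ) p)
            (go _ φ (ys ++ ρ)))

opaque

  dec⟦⟧ : ∀ {Sym ar n v} {A : Structure n Sym ar} → (∀ R t → Dec (A R t)) →
          (φ : Form Sym ar v) (ρ : Vec (Fin n) v) → Dec (⟦ φ ⟧ A ρ)
  dec⟦⟧ A? (rel R xs)    ρ = A? R _
  dec⟦⟧ A? (eq i j)      ρ = _ FP.≟ _
  dec⟦⟧ A? (le i j)      ρ = _ ≤? _
  dec⟦⟧ A? (plus i j l)  ρ = _ Data.Nat.≟ _
  dec⟦⟧ A? (times i j l) ρ = _ Data.Nat.≟ _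
  dec⟦⟧ A? (neg φ)       ρ = ¬? (dec⟦⟧ A? φ ρ)
  dec⟦⟧ A? (and φ ψ)     ρ = dec⟦⟧ A? φ ρ ×-dec dec⟦⟧ A? ψ ρ
  dec⟦⟧ A? (or φ ψ)      ρ = dec⟦⟧ A? φ ρ ⊎-dec dec⟦⟧ A? ψ ρ
  dec⟦⟧ A? (ex φ)        ρ = FP.any? (λ x → dec⟦⟧ A? φ (x ∷ ρ))
  dec⟦⟧ A? (all φ)       ρ = FP.all? (λ x → dec⟦⟧ A? φ (x ∷ ρ))

-- Environments as tuples of domain elements

width : Sort → ℕ
width elt     = 1
width (tup q) = q

-- The last sort adds no trailing "+ 0", so that sizes match the arities fixed by the program format.
size : Ctx → ℕ
size []            = 0
size (σ ∷ [])      = width σ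
size (σ ∷ τ ∷ Γ)   = width σ + size (τ ∷ Γ)

flatEl : ∀ {n} σ → El n σ → Vec (Fin n) (width σ)
flatEl elt     x = x ∷ []
flatEl (tup q) x = x

flat : ∀ {n} Γ → Env n Γ → Vec (Fin n) (size Γ)
flat []          _       = []
flat (σ ∷ [])    (x , _) = flatEl σ x
flat (σ ∷ τ ∷ Γ) (x , ρ) = flatEl σ x ++ flat (τ ∷ Γ) ρ

posEl : ∀ σ → El (width σ) σ
posEl elt     = zero
posEl (tup q) = tabulate id

-- The generic environment, which consists of the variables in the order in which `flat` lays out
-- values. A formula compiled in it has the columns of the defined relation as its free variables.
pos : ∀ Γ → Env (size Γ) Γ
pos []          = tt
pos (σ ∷ [])    = posEl σ , tt
pos (σ ∷ τ ∷ Γ) = mapEl σ (_↑ˡ size (τ ∷ Γ)) (posEl σ) , mapE (τ ∷ Γ) (width σ ↑ʳ_) (pos (τ ∷ Γ))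

mapEl-posEl : ∀ {n} σ (x : El n σ) → mapEl σ (lookup (flatEl σ x)) (posEl σ) ≡ x
mapEl-posEl elt     x = refl
mapEl-posEl (tup q) x = trans (sym (VP.tabulate-∘ _ _)) (VP.tabulate∘lookup x)

flat-pos : ∀ {n} Γ (ρ : Env n Γ) → mapE Γ (lookup (flat Γ ρ)) (pos Γ) ≡ ρ
flat-pos []          ρ       = refl
flat-pos (σ ∷ [])    (x , _) = cong (_, tt) (mapEl-posEl σ x)
flat-pos (σ ∷ τ ∷ Γ) (x , ρ) = cong₂ _,_
  (trans (mapEl-∘ σ _ _ (VP.lookup-++ˡ (flatEl σ x) _) (posEl σ)) (mapEl-posEl σ x))
  (trans (mapE-∘ (τ ∷ Γ) _ _ (VP.lookup-++ʳ (flatEl σ x) _) (pos (τ ∷ Γ))) (flat-pos (τ ∷ Γ) ρ))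

map-flatEl : ∀ {n v} σ (f : Fin v → Fin n) (x : El v σ) → V.map f (flatEl σ x) ≡ flatEl σ (mapEl σ f x)
map-flatEl elt     f x = refl
map-flatEl (tup q) f x = refl

map-flat : ∀ {n v} Γ (f : Fin v → Fin n) (ρ : Env v Γ) → V.map f (flat Γ ρ) ≡ flat Γ (mapE Γ f ρ)
map-flat []          f ρ       = refl
map-flat (σ ∷ [])    f (x , _) = map-flatEl σ f x
map-flat (σ ∷ τ ∷ Γ) f (x , ρ) =
  trans (VP.map-++ f (flatEl σ x) _) (cong₂ _++_ (map-flatEl σ f x) (map-flat (τ ∷ Γ) f ρ))

-- Transitive closure by iterated squaring

reach→star : ∀ {S : Set} {R : S → S → Set} {j x y} → ReachIn R j x y → Star R x y
reach→star here     = ε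
reach→star (up r p) = r ◅ reach→star p

reach-split : ∀ {S : Set} {R : S → S → Set} a {b x y} → ReachIn R (a + b) x y →
              ∃ λ m → ReachIn R a x m × ReachIn R b m y
reach-split zero    p        = _ , here , p
reach-split (suc a) (up r p) with reach-split a p
... | m , q , q' = m , up r q , q'

reach-++ : ∀ {S : Set} {R : S → S → Set} {a b x y z} → ReachIn R a x y → ReachIn R b y z → ReachIn R (a + b) x z
reach-++ here     q = q
reach-++ (up r p) q = up r (reach-++ p q)

-- Loop erasure: if two visits of the same code can only be visits of the same state, a path need not visit a code twice.
module Shorten {S C : Set} (_≟_ : (c c' : C) → Dec (c ≡ c')) (R : S → S → Set) (K : S → C → Set)
  (same : ∀ {s t c} → Star R s t → K s c → K t c → s ≡ t) where

  private
    data Coded (L : List C) : S → S → Set where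
      nil  : ∀ {s} → Coded L s s
      cons : ∀ {s s' t c} → R s s' → K s' c → c ∈ L → Coded L s' t → Coded L s t

    minus : C → List C → List C
    minus c = filter (λ c' → ¬? (c' ≟ c))

    -- Cuts at the last visit of `c`, so that the remaining path can do without this code.
    cut : ∀ {L s t} c → Coded L s t →
          Coded (minus c L) s t ⊎ ∃ λ s' → Star R s s' × K s' c × Coded (minus c L) s' t
    cut c nil = inj₁ nil
    cut c (cons {c = c'} r k i p) with cut c p
    ... | inj₂ (s' , q , k' , p') = inj₂ (s' , r ◅ q , k' , p')
    ... | inj₁ p' with c' ≟ c
    ...   | yes refl = inj₂ (_ , r ◅ ε , k , p')
    ...   | no  c≢   = inj₁ (cons r k (∈-filter⁺ _ i c≢) p')

    erase : ∀ m L {s t} → length L ≤ m → Coded L s t → ∃ λ j → j ≤ m × ReachIn R j s t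
    erase m L l nil = 0 , z≤n , here
    erase zero [] l (cons r k () p)
    erase (suc m) L l (cons {s' = s'} {t} {c} r k i p) =
      let j , j≤m , q = erase m (minus c L) shorter rest in suc j , s≤s j≤m , up r q
      where
      shorter : length (minus c L) ≤ m
      shorter = s≤s⁻¹ (<-≤-trans (LP.filter-notAll (λ c' → ¬? (c' ≟ c)) L (lose i (λ f → f refl))) l)
      rest : Coded (minus c L) s' t
      rest with cut c p
      ... | inj₁ p' = p'
      -- `s'` and the last visit `u` carry the same code and are therefore equal: the loop between
      -- them is dropped.
      ... | inj₂ (u , q , k' , p') = subst (λ w → Coded (minus c L) w t) (sym (same q k k')) p'

  shorten : ∀ L → (∀ {s t} → R s t → ∃ λ c → K t c × c ∈ L) →
            ∀ {s t} → Star R s t → ∃ λ j → j ≤ length L × ReachIn R j s t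
  shorten L code p = erase (length L) L ≤-refl (coded p)
    where
    coded : ∀ {s t} → Star R s t → Coded L s t
    coded ε       = nil
    coded (r ◅ p) with code r
    ... | c , k , i = cons r k i (coded p)

-- B holds a copy of the base relation of which R is the closure so far; R is emptied whenever the
-- base relation differs from the copy, so that R forgets everything derived from outdated values.
module Iterate {G S : Set} (B R Φ : ℕ → G → S → S → Set)
  (B-zero : ∀ {γ x y} → ¬ B 0 γ x y) (R-zero : ∀ {γ x y} → ¬ R 0 γ x y)
  (B-suc : ∀ i γ x y → B (suc i) γ x y ⟺ Φ i γ x y)
  (R-suc : ∀ i γ x y → R (suc i) γ x y ⟺
     ((∀ x' y' → Φ i γ x' y' ⟺ B i γ x' y') × (Φ i γ x y ⊎ x ≡ y ⊎ ∃ λ m → R i γ x m × R i γ m y)))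
  (base : G → S → S → Set) (rank : G → ℕ)
  (Φ-base : ∀ i γ → (∀ γ' → rank γ' < rank γ → ∀ x y → R i γ' x y ⟺ Star (base γ') x y) →
            ∀ x y → Φ i γ x y ⟺ base γ x y)
  (m : ℕ) (bounded : ∀ γ x y → Star (base γ) x y → ∃ λ j → j ≤ 2 ^ m × ReachIn (base γ) j x y)
  where

  private
    -- True in every round, even while lower ranks are still wrong: the gate lets pairs into `R`
    -- only if the new copy equals the old one, and then old paths are still paths.
    sound : ∀ i γ x y → R i γ x y → Star (B i γ) x y
    sound zero    γ x y r = ⊥-elim (R-zero r)
    sound (suc i) γ x y r with proj₁ (R-suc i γ x y) r
    ... | same , inj₁ φ = proj₂ (B-suc i γ x y) φ ◅ ε
    ... | same , inj₂ (inj₁ refl) = ε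
    ... | same , inj₂ (inj₂ (z , p , q)) = lift (sound i γ x z p) ◅◅ lift (sound i γ z y q)
      where
      lift : ∀ {u v} → Star (B i γ) u v → Star (B (suc i) γ) u v
      lift = Star-map λ {u} {v} b → proj₂ (B-suc i γ u v) (proj₂ (same u v) b)

    module _ (γ : G) (T : ℕ) (Φ-ok : ∀ i → T ≤ i → ∀ x y → Φ i γ x y ⟺ base γ x y) where

      B-ok : ∀ i → T < i → ∀ x y → B i γ x y ⟺ base γ x y
      B-ok (suc i) (s≤s t) x y = ⟺-trans (B-suc i γ x y) (Φ-ok i t x y)

      -- `Φ` is right from round `T` on and its copy one round later; so the gate is open when round
      -- `T + 2` is computed, which yields the paths of length at most 1. Each further round doubles
      -- the length.
      complete : ∀ e i → T + suc (suc e) ≤ i → ∀ {j x y} → j ≤ 2 ^ e → ReachIn (base γ) j x y → R i γ x y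
      complete e zero l = ⊥-elim (n≮0 (≤-trans (m≤n+m _ T) l))
      complete e (suc i) l {j} {x} {y} b p = proj₂ (R-suc i γ x y) (gate , step e l' b p)
        where
        l' : T + suc e ≤ i
        l' = s≤s⁻¹ (subst (_≤ suc i) (+-suc T (suc e)) l)
        T<i : T < i
        T<i = <-≤-trans (subst (T <_) (sym (+-suc T e)) (s≤s (m≤m+n T e))) l'
        Φ-now : ∀ x y → Φ i γ x y ⟺ base γ x y
        Φ-now = Φ-ok i (<⇒≤ T<i)
        gate : ∀ x' y' → Φ i γ x' y' ⟺ B i γ x' y'
        gate x' y' = ⟺-trans (Φ-now x' y') (⟺-sym (B-ok i T<i x' y'))
        step : ∀ e → T + suc e ≤ i → ∀ {j x y} → j ≤ 2 ^ e → ReachIn (base γ) j x y →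
               Φ i γ x y ⊎ x ≡ y ⊎ ∃ λ m → R i γ x m × R i γ m y
        step zero l b here = inj₂ (inj₁ refl)
        step zero l b (up r here) = inj₁ (proj₂ (Φ-now _ _) r)
        step zero l (s≤s ()) (up r (up _ _))
        step (suc e) l {j} b p with reach-split (j ⊓ 2 ^ e) (subst (λ a → ReachIn (base γ) a _ _) (sym (m⊓n+n∸m≡n' j)) p)
          where
          m⊓n+n∸m≡n' : ∀ j → j ⊓ 2 ^ e + (j ∸ 2 ^ e) ≡ j
          m⊓n+n∸m≡n' j = trans (cong (_+ (j ∸ 2 ^ e)) (⊓-comm j _)) (m⊓n+n∸m≡n (2 ^ e) j)
        ... | z , p₁ , p₂ = inj₂ (inj₂ (z , complete e i l (m⊓n≤n j _) p₁ , complete e i l small p₂))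
          where
          small : j ∸ 2 ^ e ≤ 2 ^ e
          small = ≤-trans (∸-monoˡ-≤ (2 ^ e) b)
            (≤-reflexive (trans (m+n∸m≡n (2 ^ e) _) (+-identityʳ _)))

      closed : ∀ i → T + (m + 3) ≤ i → ∀ x y → R i γ x y ⟺ Star (base γ) x y
      closed i l x y = (λ r → Star-map (λ {u} {v} → proj₁ (B-ok i (<-≤-trans (m<m+n T (≤-trans (s≤s z≤n) (m≤n+m 3 m))) l) u v)) (sound i γ x y r))
                     , (λ s → let j , b , p = bounded γ x y s in
                              complete m i (≤-trans (+-monoʳ-≤ T (≤-trans (≤-reflexive (+-comm 2 m)) (+-monoʳ-≤ m (s≤s (s≤s z≤n))))) l) b p)

  -- Ranks settle one after the other: when all lower ranks are right, `Φ-base` makes the relation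
  -- of this rank right, and `m + 3` more rounds close it.
  converges : ∀ r γ → rank γ ≤ r → ∀ i → suc r * (m + 3) ≤ i → ∀ x y → R i γ x y ⟺ Star (base γ) x y
  converges zero γ k i l = closed γ 0 (λ i _ → Φ-base i γ (λ γ' b → ⊥-elim (n≮0 (<-≤-trans b k)))) i
    (subst (_≤ i) (+-identityʳ (m + 3)) l)
  converges (suc r) γ k i l = closed γ (suc r * (m + 3))
    (λ i' l' → Φ-base i' γ (λ γ' b → converges r γ' (s≤s⁻¹ (<-≤-trans b k)) i' l')) i
    (subst (_≤ i) (+-comm (m + 3) _) l)

-- Sets of vertices and components

DecP : {X : Set} → (X → Set) → Set
DecP P = ∀ x → Dec (P x)

ind : {P : Set} → Dec P → ℕ
ind (yes _) = 1
ind (no  _) = 0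

opaque

  count : ∀ {n} {P : Fin n → Set} → DecP P → ℕ
  count {zero}  P? = 0
  count {suc n} P? = ind (P? zero) + count (P? ∘ suc)

  count-mono : ∀ {n} {P Q : Fin n → Set} (P? : DecP P) (Q? : DecP Q) → (∀ x → P x → Q x) → count P? ≤ count Q?
  count-mono {zero}  P? Q? h = z≤n
  count-mono {suc n} P? Q? h = +-mono-≤ (ind-mono (P? zero) (Q? zero) (h zero)) (count-mono _ _ (h ∘ suc))
    where
    ind-mono : {A B : Set} (a : Dec A) (b : Dec B) → (A → B) → ind a ≤ ind b
    ind-mono (no _)  b       f = z≤n
    ind-mono (yes a) (yes _) f = ≤-refl
    ind-mono (yes a) (no nb) f = ⊥-elim (nb (f a))

  count-cong : ∀ {n} {P Q : Fin n → Set} (P? : DecP P) (Q? : DecP Q) → (∀ x → P x ⟺ Q x) → count P? ≡ count Q?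
  count-cong P? Q? h = ≤-antisym (count-mono P? Q? (proj₁ ∘ h)) (count-mono Q? P? (proj₂ ∘ h))

  count-⊎ : ∀ {n} {P Q R : Fin n → Set} (P? : DecP P) (Q? : DecP Q) (R? : DecP R) →
            (∀ x → P x → ¬ Q x) → (∀ x → R x ⟺ (P x ⊎ Q x)) → count R? ≡ count P? + count Q?
  count-⊎ {zero}  P? Q? R? d h = refl
  count-⊎ {suc n} P? Q? R? d h = trans
    (cong₂ _+_ (ind-⊎ (P? zero) (Q? zero) (R? zero) (d zero) (h zero)) (count-⊎ _ _ _ (d ∘ suc) (h ∘ suc)))
    (interchange (ind (P? zero)) (ind (Q? zero)) _ _)
    where
    ind-⊎ : {A B C : Set} (a : Dec A) (b : Dec B) (c : Dec C) → (A → ¬ B) → C ⟺ (A ⊎ B) → ind c ≡ ind a + ind b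
    ind-⊎ (yes a) (yes b) c       d h = ⊥-elim (d a b)
    ind-⊎ (yes a) (no _)  (yes _) d h = refl
    ind-⊎ (yes a) (no _)  (no nc) d h = ⊥-elim (nc (proj₂ h (inj₁ a)))
    ind-⊎ (no _)  (yes b) (yes _) d h = refl
    ind-⊎ (no _)  (yes b) (no nc) d h = ⊥-elim (nc (proj₂ h (inj₂ b)))
    ind-⊎ (no na) (no nb) (yes c) d h = ⊥-elim ([ na , nb ]′ (proj₁ h c))
    ind-⊎ (no _)  (no _)  (no _)  d h = refl

  count-disjoint : ∀ {n} {P Q R : Fin n → Set} (P? : DecP P) (Q? : DecP Q) (R? : DecP R) →
                   (∀ x → P x → ¬ Q x) → (∀ x → P x → R x) → (∀ x → Q x → R x) → count P? + count Q? ≤ count R?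
  count-disjoint P? Q? R? d f g = ≤-trans
    (≤-reflexive (sym (count-⊎ P? Q? (λ x → P? x ⊎-dec Q? x) d (λ _ → ⟺-refl))))
    (count-mono _ R? λ x → [ f x , g x ]′)

  count-none : ∀ {n} {P : Fin n → Set} (P? : DecP P) → (∀ x → ¬ P x) → count P? ≡ 0
  count-none {zero}  P? h = refl
  count-none {suc n} P? h with P? zero
  ... | yes p = ⊥-elim (h zero p)
  ... | no _  = count-none (P? ∘ suc) (h ∘ suc)

  count-all : ∀ {n} {P : Fin n → Set} (P? : DecP P) → (∀ x → P x) → count P? ≡ n
  count-all {zero}  P? h = refl
  count-all {suc n} P? h with P? zero
  ... | yes _ = cong suc (count-all (P? ∘ suc) (h ∘ suc))
  ... | no np = ⊥-elim (np (h zero))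

  count-one : ∀ {n} {P : Fin n → Set} (P? : DecP P) a → (∀ x → P x ⟺ (x ≡ a)) → count P? ≡ 1
  count-one P? zero h with P? zero
  ... | yes _ = cong suc (count-none (P? ∘ suc) (λ x p → FP.0≢1+n (sym (proj₁ (h (suc x)) p))))
  ... | no np = ⊥-elim (np (proj₂ (h zero) refl))
  count-one P? (suc a) h with P? zero
  ... | yes p = ⊥-elim (FP.0≢1+n (proj₁ (h zero) p))
  ... | no _  = count-one (P? ∘ suc) a (λ x → (λ p → FP.suc-injective (proj₁ (h (suc x)) p)) , (λ e → proj₂ (h (suc x)) (cong suc e)))

  count-pos : ∀ {n} {P : Fin n → Set} (P? : DecP P) a → P a → 1 ≤ count P?
  count-pos P? a p = ≤-trans (≤-reflexive (sym (count-one (λ x → x FP.≟ a) a (λ x → ⟺-refl))))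
    (count-mono _ P? (λ { x refl → p }))

  count-≤ : ∀ {n} {P : Fin n → Set} (P? : DecP P) → count P? ≤ n
  count-≤ {zero}  P? = z≤n
  count-≤ {suc n} P? with P? zero
  ... | yes _ = s≤s (count-≤ (P? ∘ suc))
  ... | no _  = m≤n⇒m≤1+n (count-≤ (P? ∘ suc))

  count-nonzero : ∀ {n} {P : Fin n → Set} (P? : DecP P) → (∀ x → P x → ¬ toℕ x ≡ 0) → 1 ≤ n → count P? < n
  count-nonzero {suc n} P? h _ with P? zero
  ... | yes p = ⊥-elim (h zero p refl)
  ... | no _  = s≤s (count-≤ (P? ∘ suc))

least : ∀ {n} {P : Fin n → Set} → DecP P → ∃ P → ∃ λ x → P x × (∀ y → toℕ y < toℕ x → ¬ P y)
least {suc n} P? (a , p) with P? zero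
... | yes p₀ = zero , p₀ , λ y ()
least {suc n} P? (zero , p) | no np = ⊥-elim (np p)
least {suc n} {P} P? (suc a , p) | no np with least (P? ∘ suc) (a , p)
... | x , px , h = suc x , px , λ { zero _ → np ; (suc y) (s≤s l) → h y l }

least-unique : ∀ {n} {P : Fin n → Set} {x y} → P x → (∀ z → toℕ z < toℕ x → ¬ P z) →
               P y → (∀ z → toℕ z < toℕ y → ¬ P z) → x ≡ y
least-unique {x = x} {y} px hx py hy = FP.toℕ-injective
  (≤-antisym (≮⇒≥ (λ l → hx y l py)) (≮⇒≥ (λ l → hy x l px)))

lexLeast : ∀ {n} q {P : Vec (Fin n) q → Set} → DecP P → ∃ P → ∃ λ A → P A × (∀ B → Lex B A → ¬ P B)
lexLeast zero    P? ([] , p) = [] , p , λ { [] () }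
lexLeast (suc q) {P} P? ((a ∷ A) , p)
  with least (λ x → any?ᵛ q (λ B → P? (x ∷ B))) (a , A , p)
... | x , t , h with lexLeast q (λ B → P? (x ∷ B)) t
...   | B , pB , k = (x ∷ B) , pB , λ { (y ∷ C) (inj₁ l) pc → h y l (C , pc) ; (y ∷ C) (inj₂ (refl , l)) pc → k C l pc }

Lex-tri : ∀ {n q} (A B : Vec (Fin n) q) → Lex A B ⊎ A ≡ B ⊎ Lex B A
Lex-tri []      []      = inj₂ (inj₁ refl)
Lex-tri (a ∷ A) (b ∷ B) with <-cmp (toℕ a) (toℕ b)
... | tri< l _ _ = inj₁ (inj₁ l)
... | tri> _ _ l = inj₂ (inj₂ (inj₁ l))
... | tri≈ _ e _ with FP.toℕ-injective e | Lex-tri A B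
...   | refl | inj₁ l = inj₁ (inj₂ (refl , l))
...   | refl | inj₂ (inj₁ refl) = inj₂ (inj₁ refl)
...   | refl | inj₂ (inj₂ l) = inj₂ (inj₂ (inj₂ (refl , l)))

¬¬Dec : ∀ {n} (P : Fin n → Set) → ¬ ¬ (∀ x → Dec (P x))
¬¬Dec {zero}  P k = k λ ()
¬¬Dec {suc n} P k = ¬¬Dec (P ∘ suc) λ h →
  k (λ { zero → no (λ p → k λ { zero → yes p ; (suc x) → h x }) ; (suc x) → h x })

zeros : ∀ {n q} → Vec (Fin (suc n)) q
zeros {q = q} = V.replicate q zero

In-0 : ∀ {n q} {x : Fin n} (A : Vec (Fin n) q) → toℕ x ≡ 0 → In x A
In-0 []      e = e
In-0 (a ∷ A) e = inj₂ (In-0 A e)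

In-zeros : ∀ {n} q {x : Fin (suc n)} → In x (zeros {q = q}) → toℕ x ≡ 0
In-zeros zero    e           = e
In-zeros (suc q) (inj₁ refl) = refl
In-zeros (suc q) (inj₂ i)    = In-zeros q i

is-zero : ∀ {n} {x : Fin (suc n)} → toℕ x ≡ 0 → x ≡ zero
is-zero {x = zero} _ = refl

zeros-unique : ∀ {n q} (A : Vec (Fin (suc n)) q) → (∀ x → In x A → toℕ x ≡ 0) → A ≡ zeros
zeros-unique []      h = refl
zeros-unique (a ∷ A) h = cong₂ _∷_ (is-zero (h a (inj₁ refl))) (zeros-unique A (λ x i → h x (inj₂ i)))

In-++ˡ : ∀ {n p q} {x : Fin n} (A : Vec (Fin n) p) (B : Vec (Fin n) q) → In x A → In x (A ++ B)
In-++ˡ []      B e        = In-0 B e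
In-++ˡ (a ∷ A) B (inj₁ e) = inj₁ e
In-++ˡ (a ∷ A) B (inj₂ i) = inj₂ (In-++ˡ A B i)

In-++ʳ : ∀ {n p q} {x : Fin n} (A : Vec (Fin n) p) (B : Vec (Fin n) q) → In x B → In x (A ++ B)
In-++ʳ []      B i = i
In-++ʳ (a ∷ A) B i = inj₂ (In-++ʳ A B i)

In-++⁻ : ∀ {n p q} {x : Fin n} (A : Vec (Fin n) p) (B : Vec (Fin n) q) → In x (A ++ B) → In x A ⊎ In x B
In-++⁻ []      B i        = inj₂ i
In-++⁻ (a ∷ A) B (inj₁ e) = inj₁ (inj₁ e)
In-++⁻ (a ∷ A) B (inj₂ i) with In-++⁻ A B i
... | inj₁ j = inj₁ (inj₂ j)
... | inj₂ j = inj₂ j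

-- Removing members must not change the length of a tuple, so they are overwritten by the padding
-- vertex 0.
keep : ∀ {n q} {P : Fin (suc n) → Set} → DecP P → Vec (Fin (suc n)) q → Vec (Fin (suc n)) q
keep P? []      = []
keep P? (a ∷ A) with P? a
... | yes _ = a ∷ keep P? A
... | no _  = zero ∷ keep P? A

In-keep⁺ : ∀ {n q} {P : Fin (suc n) → Set} (P? : DecP P) (A : Vec (Fin (suc n)) q) {x} → In x A → P x → In x (keep P? A)
In-keep⁺ P? []      i p = i
In-keep⁺ P? (a ∷ A) i p with P? a | i
... | yes _ | inj₁ refl = inj₁ refl
... | no np | inj₁ refl = ⊥-elim (np p)
... | yes _ | inj₂ j = inj₂ (In-keep⁺ P? A j p)
... | no _  | inj₂ j = inj₂ (In-keep⁺ P? A j p)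

In-keep⁻ : ∀ {n q} {P : Fin (suc n) → Set} (P? : DecP P) (A : Vec (Fin (suc n)) q) {x} →
           In x (keep P? A) → toℕ x ≡ 0 ⊎ (In x A × P x)
In-keep⁻ P? []      i = inj₁ i
In-keep⁻ P? (a ∷ A) i with P? a | i
... | yes p | inj₁ refl = inj₂ (inj₁ refl , p)
... | no _  | inj₁ refl = inj₁ refl
... | yes _ | inj₂ j = [ inj₁ , (λ (k , q) → inj₂ (inj₂ k , q)) ]′ (In-keep⁻ P? A j)
... | no _  | inj₂ j = [ inj₁ , (λ (k , q) → inj₂ (inj₂ k , q)) ]′ (In-keep⁻ P? A j)

opaque
  unfolding count

  -- Positions are counted instead of vertices. This agrees with the weight by which boundary tuples
  -- are halved, where repeated entries count repeatedly.
  select : ∀ {n q} {P : Fin (suc n) → Set} (P? : DecP P) (A : Vec (Fin (suc n)) q) h → count (P? ∘ lookup A) ≤ h →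
           ∃ λ (B : Vec (Fin (suc n)) h) → ∀ {x} → In x A → P x → In x B
  select P? []      h b = zeros , λ e p → In-0 _ e
  select P? (a ∷ A) h b with P? a
  select P? (a ∷ A) (suc h) b | yes _ with select P? A h (s≤s⁻¹ b)
  ... | B , f = (a ∷ B) , λ { (inj₁ e) p → inj₁ e ; (inj₂ i) p → inj₂ (f i p) }
  select P? (a ∷ A) h b | no np with select P? A h b
  ... | B , f = B , λ { (inj₁ refl) p → ⊥-elim (np p) ; (inj₂ i) p → f i p }

fromList : ∀ {n} (xs : List (Fin (suc n))) q → length xs ≤ q → ∃ λ (A : Vec (Fin (suc n)) q) → ∀ {x} → x ∈ xs → In x A
fromList []       q l = zeros , λ ()
fromList (y ∷ xs) (suc q) (s≤s l) with fromList xs q l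
... | A , f = (y ∷ A) , λ { (here e) → inj₁ e ; (there i) → inj₂ (f i) }

In-toList : ∀ {n q} {x : Fin n} (A : Vec (Fin n) q) → In x A → toℕ x ≡ 0 ⊎ x ∈ V.toList A
In-toList []      e        = inj₁ e
In-toList (a ∷ A) (inj₁ e) = inj₂ (here e)
In-toList (a ∷ A) (inj₂ i) = [ inj₁ , inj₂ ∘ there ]′ (In-toList A i)

data Conn {n} (E : Graph n) (A : Fin n → Set) (u : Fin n) : Fin n → Set where
  start : ¬ A u → Conn E A u u
  ext   : ∀ {v w} → Conn E A u v → E v w → ¬ A w → Conn E A u w

module _ {n} {E : Graph n} {A : Fin n → Set} where

  conn-src : ∀ {u v} → Conn E A u v → ¬ A u
  conn-src (start a)   = a
  conn-src (ext p _ _) = conn-src p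

  conn-tgt : ∀ {u v} → Conn E A u v → ¬ A v
  conn-tgt (start a)   = a
  conn-tgt (ext _ _ a) = a

  conn-trans : ∀ {u v w} → Conn E A u v → Conn E A v w → Conn E A u w
  conn-trans p (start _)   = p
  conn-trans p (ext q e a) = ext (conn-trans p q) e a

  conn-sym : (∀ {x y} → E x y → E y x) → ∀ {u v} → Conn E A u v → Conn E A v u
  conn-sym s (start a)   = start a
  conn-sym s (ext p e a) = conn-trans (ext (start a) (s e) (conn-tgt p)) (conn-sym s p)

  conn-map : ∀ {E' : Graph n} {A' : Fin n → Set} → (∀ {x y} → ¬ A x → ¬ A y → E x y → E' x y) →
             (∀ {x} → A' x → A x) → ∀ {u v} → Conn E A u v → Conn E' A' u v
  conn-map f g (start a)   = start (a ∘ g)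
  conn-map f g (ext p e a) = ext (conn-map f g p) (f (conn-tgt p) a e) (a ∘ g)

  conn-closed : (P : Fin n → Set) → (∀ {x y} → P x → ¬ A x → E x y → ¬ A y → P y) →
                ∀ {u v} → Conn E A u v → P u → P v
  conn-closed P c (start _)   p = p
  conn-closed P c (ext q e a) p = c (conn-closed P c q p) (conn-tgt q) e a

  opaque
    -- Loop erasure bounds the length of the paths to be searched by the number of vertices.
    conn? : (∀ x y → Dec (E x y)) → DecP A → ∀ u v → Dec (Conn E A u v)
    conn? E? A? u v = map′ to from ((¬? (A? u)) ×-dec FP.any? (λ (j : Fin (suc (length (L.allFin n)))) → reach? (toℕ j) u v))
      where
      R : Fin n → Fin n → Set
      R x y = E x y × ¬ A y
      reach? : ∀ j x y → Dec (ReachIn R j x y)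
      reach? zero x y = map′ (λ { refl → here }) (λ { here → refl }) (x FP.≟ y)
      reach? (suc j) x y = map′ (λ (z , r , p) → up r p) (λ { (up r p) → _ , r , p })
        (FP.any? (λ z → (E? x z ×-dec ¬? (A? z)) ×-dec reach? j z y))
      fromStar : ∀ {x y w} → Conn E A w x → Star R x y → Conn E A w y
      fromStar c ε = c
      fromStar c ((e , a) ◅ p) = fromStar (ext c e a) p
      toStar : ∀ {x y} → Conn E A x y → Star R x y
      toStar (start _)   = ε
      toStar (ext p e a) = toStar p ◅◅ (e , a) ◅ ε
      to : ¬ A u × (∃ λ (j : Fin (suc (length (L.allFin n)))) → ReachIn R (toℕ j) u v) → Conn E A u v
      to (a , j , p) = fromStar (start a) (reach→star p)
      from : Conn E A u v → ¬ A u × (∃ λ (j : Fin (suc (length (L.allFin n)))) → ReachIn R (toℕ j) u v)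
      from c with Shorten.shorten FP._≟_ R _≡_ (λ { _ refl refl → refl }) (L.allFin n)
                    (λ {s} {t} r → t , refl , ∈-allFin t) (toStar c)
      ... | j , b , p = conn-src c , fromℕ< (s≤s b) , subst (λ i → ReachIn R i u v) (sym (FP.toℕ-fromℕ< (s≤s b))) p

conn : ∀ {n q} → Graph n → Vec (Fin n) q → Fin n → Fin n → Set
conn E A = Conn E (λ x → In x A)

-- The padding vertex 0 imposes no adjacency, so that for a tuple of zeros every vertex except 0
-- qualifies.
Full : ∀ {n q} → (Fin n → Fin n → Set) → Graph n → Vec (Fin n) q → Fin n → Set
Full cn E A w = ¬ In w A × (∀ a → In a A × ¬ toℕ a ≡ 0 → ∃ λ w' → cn w w' × E w' a)

-- For u ≠ 0 the component of u; for u = 0 the union of the components adjacent to every member of A.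
InC : ∀ {n q} → (Fin n → Fin n → Set) → Graph n → Vec (Fin n) q → Fin n → Fin n → Set
InC cn E A u w = cn u w ⊎ (toℕ u ≡ 0 × Full cn E A w)

opaque

  Full? : ∀ {n q} {cn} {E : Graph n} → (∀ u v → Dec (cn u v)) → (∀ x y → Dec (E x y)) → (A : Vec (Fin n) q) → DecP (Full cn E A)
  Full? cn? E? A w = ¬? (In? w A) ×-dec FP.all? (λ a → (In? a A ×-dec ¬? (toℕ a ≟ 0)) →-dec FP.any? (λ w' → cn? w w' ×-dec E? w' a))

  InC? : ∀ {n q} {cn} {E : Graph n} → (∀ u v → Dec (cn u v)) → (∀ x y → Dec (E x y)) → (A : Vec (Fin n) q) → ∀ u → DecP (InC cn E A u)
  InC? cn? E? A u w = cn? u w ⊎-dec ((toℕ u ≟ 0) ×-dec Full? cn? E? A w)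

module _ {n} {E : Graph n} (E? : ∀ x y → Dec (E x y)) where

  connᵗ? : ∀ {q} (A : Vec (Fin n) q) u v → Dec (conn E A u v)
  connᵗ? A = conn? E? (λ x → In? x A)

  comp? : ∀ {q} (A : Vec (Fin n) q) u → DecP (InC (conn E A) E A u)
  comp? A u = InC? (connᵗ? A) E? A u

  compSize : ∀ {q} (A : Vec (Fin n) q) (u : Fin n) → ℕ
  compSize A u = count (comp? A u)

InC-∉ : ∀ {n q} {E : Graph n} {A : Vec (Fin n) q} {u w} → InC (conn E A) E A u w → ¬ In w A
InC-∉ (inj₁ c) = conn-tgt c
InC-∉ (inj₂ (_ , a , _)) = a

InC-nonzero : ∀ {n q} {E : Graph n} {A : Vec (Fin n) q} {u w} → InC (conn E A) E A u w → ¬ toℕ w ≡ 0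
InC-nonzero {A = A} c e = InC-∉ c (In-0 A e)

InC-conn : ∀ {n q} {E : Graph n} {A : Vec (Fin n) q} {u w} → ¬ toℕ u ≡ 0 → InC (conn E A) E A u w → conn E A u w
InC-conn u≢0 (inj₁ c) = c
InC-conn u≢0 (inj₂ (e , _)) = ⊥-elim (u≢0 e)

InC-step : ∀ {n q} {E : Graph n} {A : Vec (Fin n) q} {u w w'} → (∀ {x y} → E x y → E y x) →
           InC (conn E A) E A u w → conn E A w w' → InC (conn E A) E A u w'
InC-step s (inj₁ c) d = inj₁ (conn-trans c d)
InC-step s (inj₂ (z , a , h)) d = inj₂ (z , conn-tgt d , λ b i → let w'' , c , e = h b i in w'' , conn-trans (conn-sym s d) c , e)

-- Balanced separators

-- Abstract because bags have to halve two measures: the vertices of a component and the entries of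
-- its boundary tuple.
record Weight (n : ℕ) : Set₁ where
  field
    wt       : ∀ {P : Fin n → Set} → DecP P → ℕ
    total    : ℕ
    mono     : ∀ {P Q : Fin n → Set} (P? : DecP P) (Q? : DecP Q) → (∀ x → P x → Q x) → wt P? ≤ wt Q?
    disjoint : ∀ {P Q : Fin n → Set} (P? : DecP P) (Q? : DecP Q) → (∀ x → P x → ¬ Q x) → wt P? + wt Q? ≤ total

maxBy : ∀ {N} {P : Fin N → Set} → DecP P → (f : Fin N → ℕ) → ∃ P → ∃ λ x → P x × (∀ y → P y → f y ≤ f x)
maxBy {suc N} {P} P? f (a , p) with FP.any? (P? ∘ suc)
maxBy {suc N} P? f (zero , p)  | no nq = zero , p , λ { zero _ → ≤-refl ; (suc y) q → ⊥-elim (nq (y , q)) }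
maxBy {suc N} P? f (suc a , p) | no nq = ⊥-elim (nq (a , p))
maxBy {suc N} P? f (a , p) | yes q with maxBy (P? ∘ suc) (f ∘ suc) q | P? zero
... | x , px , h | no np = suc x , px , λ { zero p₀ → ⊥-elim (np p₀) ; (suc y) → h y }
... | x , px , h | yes p₀ with ≤-total (f zero) (f (suc x))
...   | inj₁ l = suc x , px , λ { zero _ → l ; (suc y) → h y }
...   | inj₂ l = zero , p₀ , λ { zero _ → ≤-refl ; (suc y) q → ≤-trans (h y q) l }

reach-last : ∀ {X : Set} {R : X → X → Set} {j x z} → ReachIn R (suc j) x z → ∃ λ c → ReachIn R j x c × R c z
reach-last (up r here) = _ , here , r
reach-last (up r (up r' p)) with reach-last (up r' p)
... | c , q , r'' = c , up r q , r''

walk-head : ∀ {X : Set} {Par : X → X → Set} {P : X → Set} {s t} → Walk Par P s t → P s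
walk-head (stop p)     = p
walk-head (down p _ _) = p
walk-head (upw p _ _)  = p

-- The bag of a deepest node whose subtree is heavy separates the graph: a component of its complement
-- lies either in the subtree of a child, which is light, or outside the heavy subtree.
module _ {n N k : ℕ} {E : Graph (suc n)} (E? : ∀ x y → Dec (E x y)) (E-sym : ∀ {x y} → E x y → E y x)
  {Par : Fin N → Fin N → Set} {Bag : Fin N → Fin (suc n) → Set} {root : Fin N}
  (td : IsTreeDecomposition E (λ _ → ⊤) Par Bag root) (wd : WidthAtMost (λ _ → ⊤) Bag k) (W : Weight (suc n))
  where

  open IsTreeDecomposition td
  open Weight W

  private
    Below : Fin N → Fin N → Set
    Below t t' = ∃ λ j → ReachIn Par j t t'

    Sub : Fin N → Fin (suc n) → Set
    Sub t u = ∃ λ t' → Below t' t × Bag t' u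

    reach-unique : ∀ {j j' x} → ReachIn Par j x root → ReachIn Par j' x root → j ≡ j'
    reach-unique here     here     = refl
    reach-unique here     (up r _) = ⊥-elim (root-noParent r)
    reach-unique (up r _) here     = ⊥-elim (root-noParent r)
    reach-unique (up r p) (up r' q) with par-fun r r'
    ... | refl = cong suc (reach-unique p q)

    depth : Fin N → ℕ
    depth t = proj₁ (reach-root {t} tt)

    depth-child : ∀ {c t} → Par c t → depth c ≡ suc (depth t)
    depth-child {c} {t} r = reach-unique (proj₂ (reach-root {c} tt)) (up r (proj₂ (reach-root {t} tt)))

    -- A walk can leave the subtree of `c` only through its parent `t`, whose bag does not contain
    -- `u`.
    stays-below : ∀ {c t u s s'} → Par c t → ¬ Bag t u → Below s c → Walk Par (λ x → Bag x u) s s' → Below s' c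
    stays-below r b d (stop _) = d
    stays-below r b (j , p) (down _ q w) = stays-below r b (suc j , up q p) w
    stays-below r b (zero , here) (upw _ q w) with par-fun r q
    ... | refl = ⊥-elim (b (walk-head w))
    stays-below r b (suc j , up q' p) (upw _ q w) with par-fun q' q
    ... | refl = stays-below r b (j , p) w

    Sub-step : ∀ {c t u u'} → Par c t → ¬ Bag t u → Sub c u → E u u' → Sub c u'
    Sub-step r b (t' , d , i) e with cover-edge e
    ... | t'' , i₁ , i₂ = t'' , stays-below r b d (connected i i₁) , i₂

    bagTuple : ∀ t → ∃ λ (X : Vec (Fin (suc n)) (suc k)) → ∀ {x} → Bag t x → In x X
    bagTuple t with wd t tt
    ... | L , l , f with fromList L (suc k) l
    ...   | X , g = X , λ {x} b → g (f x b)

    Separates : Vec (Fin (suc n)) (suc k) → Set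
    Separates X = ∀ w → 2 * wt (connᵗ? E? X w) ≤ total

    module Decided (Par? : ∀ t t' → Dec (Par t t')) (Below? : ∀ t t' → Dec (Below t t'))
                   (Bag? : ∀ t u → Dec (Bag t u)) where

      Sub? : ∀ t → DecP (Sub t)
      Sub? t u = FP.any? (λ t' → Below? t' t ×-dec Bag? t' u)

      Heavy : Fin N → Set
      Heavy t = total < 2 * wt (Sub? t)

      deepest : Heavy root → ∃ λ t → Heavy t × (∀ {c} → Par c t → ¬ Heavy c)
      deepest h with maxBy (λ t → total <? 2 * wt (Sub? t)) depth (root , h)
      ... | t , ht , mx = t , ht , λ {c} r hc →
        <⇒≱ (subst (depth t <_) (sym (depth-child r)) ≤-refl) (mx c hc)

      twice : ∀ a b {T} → a + b ≤ T → T < 2 * b → 2 * a ≤ T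
      twice a b {T} h l rewrite +-identityʳ a | +-identityʳ b = <⇒≤ (+-cancelʳ-< T (a + a) T
        (<-≤-trans (+-monoʳ-< (a + a) l)
          (≤-trans (≤-reflexive (interchange a a b b)) (+-mono-≤ h h))))

      separator : ∃ Separates
      separator with total <? 2 * wt (Sub? root)
      -- `total` is only an upper bound on weights, so even the root may be light. Then all vertices
      -- together weigh at most half, and any bag will do.
      ... | no light = proj₁ (bagTuple root) , λ w →
        ≤-trans (*-monoʳ-≤ 2 (mono (connᵗ? E? _ w) (Sub? root) (λ u _ → everything u))) (≮⇒≥ light)
        where
        everything : ∀ u → Sub root u
        everything u with cover-vertex u
        ... | t , b = t , reach-root tt , b
      ... | yes heavy with deepest heavy
      ...   | t , ht , light = X , sep
        where
        X = proj₁ (bagTuple t)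
        ∉Bag : ∀ {u} → ¬ In u X → ¬ Bag t u
        ∉Bag i b = i (proj₂ (bagTuple t) b)
        along : ∀ {c u u'} → Par c t → conn E X u u' → Sub c u → Sub c u'
        along {c} r = conn-closed (Sub c) (λ s x e y → Sub-step r (∉Bag x) s e)
        sep : Separates X
        sep w with FP.any? (λ c → Par? c t ×-dec Sub? c w)
        ... | yes (c , r , s) = ≤-trans
          (*-monoʳ-≤ 2 (mono (connᵗ? E? X w) (Sub? c) (λ u p → along r p s))) (≮⇒≥ (light r))
        ... | no out = twice (wt (connᵗ? E? X w)) (wt (Sub? t)) (disjoint (connᵗ? E? X w) (Sub? t) outside) ht
          where
          outside : ∀ u → conn E X w u → ¬ Sub t u
          outside u p (.t , (zero , here) , b) = ∉Bag (conn-tgt p) b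
          outside u p (t' , (suc j , q) , b) with reach-last q
          ... | c , q' , r = out (c , r , along r (conn-sym E-sym p) (t' , (j , q') , b))

  -- Parents, descendants and bags of the given decomposition are arbitrary propositions; excluded
  -- middle for these finitely many instances is available under double negation.
  separator : ¬ ¬ ∃ Separates
  separator k =
    ¬¬∀ Par λ Par? → ¬¬∀ Below λ Below? → ¬¬∀ Bag λ Bag? → k (Decided.separator Par? Below? Bag?)
    where
    ¬¬∀ : ∀ {a b} (R : Fin a → Fin b → Set) → ¬ ¬ (∀ x y → Dec (R x y))
    ¬¬∀ {zero}  R k = k λ ()
    ¬¬∀ {suc a} R k = ¬¬Dec (R zero) λ d → ¬¬∀ (R ∘ suc) λ h → k λ { zero → d ; (suc x) → h x }

-- A tree decomposition defined from components and their sizes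

n≤2^⌈log₂n⌉ : ∀ n → n ≤ 2 ^ ⌈log₂ n ⌉
n≤2^⌈log₂n⌉ = <-rec _ step
  where
  step : ∀ n → (∀ {i} → i < n → i ≤ 2 ^ ⌈log₂ i ⌉) → n ≤ 2 ^ ⌈log₂ n ⌉
  step 0 _ = z≤n
  step 1 _ = s≤s z≤n
  step n@(suc (suc n')) rec = begin
    n                                   ≡⟨ ⌊n/2⌋+⌈n/2⌉≡n n ⟨
    ⌊ n /2⌋ + ⌈ n /2⌉          ≤⟨ +-monoˡ-≤ ⌈ n /2⌉ (⌊n/2⌋≤⌈n/2⌉ n) ⟩
    ⌈ n /2⌉ + ⌈ n /2⌉                   ≡⟨ cong (⌈ n /2⌉ +_) (+-identityʳ _) ⟨
    2 * ⌈ n /2⌉                         ≤⟨ *-monoʳ-≤ 2 (rec (⌈n/2⌉<n n')) ⟩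
    2 ^ suc ⌈log₂ ⌈ n /2⌉ ⌉             ≡⟨ cong (2 ^_) (trans (cong suc (⌈log₂⌈n/2⌉⌉≡⌈log₂n⌉∸1 n)) (m+[n∸m]≡n 1≤log)) ⟩
    2 ^ ⌈log₂ n ⌉                       ∎
    where
    open ≤-Reasoning
    1≤log : 1 ≤ ⌈log₂ n ⌉
    1≤log = ⌈log₂⌉-mono-≤ {2} {n} (s≤s (s≤s z≤n))

2^j<n⇒j≤log : ∀ j n → 2 ^ j ≤ n → j ≤ ⌈log₂ n ⌉
2^j<n⇒j≤log j n l = subst (_≤ ⌈log₂ n ⌉) (⌈log₂2^n⌉≡n j) (⌈log₂⌉-mono-≤ l)

walk-++ : ∀ {X : Set} {Par : X → X → Set} {P : X → Set} {s t u} → Walk Par P s t → Walk Par P t u → Walk Par P s u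
walk-++ (stop _)     w' = w'
walk-++ (down p q w) w' = down p q (walk-++ w w')
walk-++ (upw p q w)  w' = upw p q (walk-++ w w')

walk-sym : ∀ {X : Set} {Par : X → X → Set} {P : X → Set} {s t} → Walk Par P s t → Walk Par P t s
walk-sym (stop p)     = stop p
walk-sym (down p q w) = walk-++ (walk-sym w) (upw (walk-head w) q (stop p))
walk-sym (upw p q w)  = walk-++ (walk-sym w) (down (walk-head w) q (stop p))

double : ℕ → ℕ
double a = a + a

-- The boundary of a component has at most mm k vertices, a bag has at most ss k (besides 0).
hh mm ss : ℕ → ℕ
hh k = double (suc k)
mm k = double (hh k)
ss k = mm k + hh k

module Build {n' : ℕ} (k : ℕ) {E : Graph (suc n')} (E? : ∀ x y → Dec (E x y)) where

  V : Set
  V = Fin (suc n')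

  Bagᵗ : Set
  Bagᵗ = Vec V (ss k)

  C : Bagᵗ → V → V → Set
  C Z v w = InC (conn E Z) E Z v w

  C? : ∀ Z v → DecP (C Z v)
  C? = comp? E?

  ∣C∣ : Bagᵗ → V → ℕ
  ∣C∣ = compSize E?

  HasSize : Bagᵗ → V → V → Set
  HasSize Z v z = toℕ z ≡ ∣C∣ Z v

  -- Halving is stated with witnesses in the domain, since a formula can speak about sizes only
  -- through elements that name them.
  Half : Bagᵗ → V → Bagᵗ → V → Set
  Half Z' w Z v = Σ V λ a → Σ V λ b → Σ V λ c →
    HasSize Z' w a × toℕ a + toℕ a ≡ toℕ b × HasSize Z v c × toℕ b ≤ toℕ c

  Boundary : Bagᵗ → V → V → Set
  Boundary Z v z = In z Z × Σ V λ w → C Z v w × E w z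

  opaque
    -- The second clause, that a bag draws only on the previous bag and on the component, makes the
    -- nodes whose bags contain a given vertex connected. The fourth hands the invariant `Small` on
    -- to the children; under this invariant good tuples exist.
    Good : Bagᵗ → V → Bagᵗ → Set
    Good Z v Z' =
        (∀ z → Boundary Z v z → In z Z')
      × (∀ z → In z Z' → In z Z ⊎ C Z v z)
      × (∀ w → C Z v w × ¬ In w Z' → Half Z' w Z v)
      × (∀ w → C Z v w × ¬ In w Z' → Σ (Vec V (mm k)) λ Y → ∀ z → In z Z' × (Σ V λ w' → conn E Z' w w' × E w' z) → In z Y)

    good₁ : ∀ {Z v Z'} → Good Z v Z' → ∀ z → Boundary Z v z → In z Z'
    good₁ (g , _) = g

    good₂ : ∀ {Z v Z'} → Good Z v Z' → ∀ z → In z Z' → In z Z ⊎ C Z v z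
    good₂ (_ , g , _) = g

    good₃ : ∀ {Z v Z'} → Good Z v Z' → ∀ w → C Z v w × ¬ In w Z' → Half Z' w Z v
    good₃ (_ , _ , g , _) = g

    good₄ : ∀ {Z v Z'} → Good Z v Z' → ∀ w → C Z v w × ¬ In w Z' →
            Σ (Vec V (mm k)) λ Y → ∀ z → In z Z' × (Σ V λ w' → conn E Z' w w' × E w' z) → In z Y
    good₄ (_ , _ , _ , g) = g

  Next : Bagᵗ → V → Bagᵗ → Set
  Next Z v Z' = Good Z v Z' × (∀ Z'' → Lex Z'' Z' → ¬ Good Z v Z'')

  -- A node carries the bag of its parent, and its own bag is recomputed as the least good tuple.
  -- Naming a component by its least vertex makes the child belonging to it unique.
  Child : V → Bagᵗ → V → Bagᵗ → Set
  Child v Z v' Z' = Next Z v Z' × C Z v v' × ¬ In v' Z' × (∀ v'' → toℕ v'' < toℕ v' → ¬ conn E Z' v'' v')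

  Small : Bagᵗ → V → Set
  Small Z v = Σ (Vec V (mm k)) λ Y → ∀ z → Boundary Z v z → In z Y

  Boundary? : ∀ Z v → DecP (Boundary Z v)
  Boundary? Z v z = In? z Z ×-dec FP.any? (λ w → C? Z v w ×-dec E? w z)

  opaque
    unfolding Good

    good : ∀ {Z v Z'} → (∀ z → Boundary Z v z → In z Z') → (∀ z → In z Z' → In z Z ⊎ C Z v z) →
           (∀ w → C Z v w × ¬ In w Z' → Half Z' w Z v) →
           (∀ w → C Z v w × ¬ In w Z' →
             Σ (Vec V (mm k)) λ Y → ∀ z → In z Z' × (Σ V λ w' → conn E Z' w w' × E w' z) → In z Y) → Good Z v Z'
    good g₁ g₂ g₃ g₄ = g₁ , g₂ , g₃ , g₄

    Good? : ∀ Z v → DecP (Good Z v)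
    Good? Z v Z' =
      FP.all? (λ z → Boundary? Z v z →-dec In? z Z')
      ×-dec FP.all? (λ z → In? z Z' →-dec (In? z Z ⊎-dec C? Z v z))
      ×-dec FP.all? (λ w → out? w →-dec FP.any? (λ a → FP.any? λ b → FP.any? λ c →
              (_ Data.Nat.≟ _) ×-dec (_ Data.Nat.≟ _) ×-dec (_ Data.Nat.≟ _) ×-dec (_ ≤? _)))
      ×-dec FP.all? (λ w → out? w →-dec anyᴱ (tup (mm k)) (λ Y → FP.all? λ z →
              (In? z Z' ×-dec FP.any? (λ w' → connᵗ? E? Z' w w' ×-dec E? w' z)) →-dec In? z Y))
      where
      out? : DecP (λ w → C Z v w × ¬ In w Z')
      out? w = C? Z v w ×-dec ¬? (In? w Z')

  ∣C∣<n : ∀ Z v → ∣C∣ Z v < suc n'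
  ∣C∣<n Z v = count-nonzero (C? Z v) (λ x → InC-nonzero) (s≤s z≤n)

  module _ (E-sym : ∀ {x y} → E x y → E y x) where

    -- The only ways out of the component lead through its boundary, which `Z'` contains.
    inside : ∀ {Z v w w'} {Z' : Bagᵗ} → (∀ z → Boundary Z v z → In z Z') → C Z v w → conn E Z' w w' → C Z v w'
    inside {Z} {v} {Z' = Z'} g₁ c p = conn-closed (C Z v) step p c
      where
      step : ∀ {x y} → C Z v x → ¬ In x Z' → E x y → ¬ In y Z' → C Z v y
      step {x} {y} cx x∉ e y∉ with In? y Z
      ... | yes i = ⊥-elim (y∉ (g₁ y (i , x , cx , e)))
      ... | no y∉Z = InC-step E-sym cx (ext (start (InC-∉ cx)) e y∉Z)

    module _ (tw : TreewidthAtMost k E) where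

      -- The new bag consists of the boundary and of two separators, one halving the component and one
      -- halving the boundary; the second keeps the boundaries of the children small.
      good-exists : ∀ Z v → Small Z v → ¬ ¬ (∃ λ Z' → Good Z v Z')
      good-exists Z v (Y , small) notGood =
        let _ , _ , _ , _ , td , wd = tw in
        separator E? E-sym td wd W₁ λ (X₁ , sep₁) →
        separator E? E-sym td wd W₂ λ (X₂ , sep₂) →
        notGood (Z* X₁ sep₁ X₂ sep₂ , Z*-good X₁ sep₁ X₂ sep₂)
        where
        W₁ W₂ : Weight (suc n')
        W₁ = record
          { wt = λ P? → count (λ x → P? x ×-dec C? Z v x)
          ; total = ∣C∣ Z v
          ; mono = λ P? Q? h → count-mono (λ x → P? x ×-dec C? Z v x) (λ x → Q? x ×-dec C? Z v x) (λ x (p , c) → h x p , c)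
          ; disjoint = λ P? Q? d → count-disjoint (λ x → P? x ×-dec C? Z v x) (λ x → Q? x ×-dec C? Z v x) (C? Z v)
              (λ x (p , _) (q , _) → d x p q) (λ x → proj₂) (λ x → proj₂) }
        -- Counting positions of `Y` makes the total the constant `mm k`, however many vertices
        -- repeat.
        W₂ = record
          { wt = λ P? → count (λ i → P? (lookup Y i))
          ; total = mm k
          ; mono = λ P? Q? h → count-mono (λ i → P? (lookup Y i)) (λ i → Q? (lookup Y i)) (λ i → h (lookup Y i))
          ; disjoint = λ P? Q? d → ≤-trans (count-disjoint (λ i → P? (lookup Y i)) (λ i → Q? (lookup Y i)) (λ i → yes tt)
              (λ i → d (lookup Y i)) (λ _ _ → tt) (λ _ _ → tt)) (count-≤ {P = λ _ → ⊤} (λ i → yes tt)) }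
        module _ (X₁ : Vec V (suc k)) (sep₁ : ∀ w → 2 * Weight.wt W₁ (connᵗ? E? X₁ w) ≤ ∣C∣ Z v)
                 (X₂ : Vec V (suc k)) (sep₂ : ∀ w → 2 * Weight.wt W₂ (connᵗ? E? X₂ w) ≤ mm k) where
          Z* : Bagᵗ
          -- The three parts are cut down to the boundary and to the component, as the second clause
          -- of `Good` demands.
          Z* = keep (Boundary? Z v) Y ++ (keep (C? Z v) X₁ ++ keep (C? Z v) X₂)

          Z*⁻ : ∀ {z} → In z Z* → toℕ z ≡ 0 ⊎ ((In z Y × Boundary Z v z) ⊎ (In z X₁ × C Z v z) ⊎ (In z X₂ × C Z v z))
          Z*⁻ i with In-++⁻ (keep (Boundary? Z v) Y) _ i
          ... | inj₁ j = [ inj₁ , inj₂ ∘ inj₁ ]′ (In-keep⁻ (Boundary? Z v) Y j)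
          ... | inj₂ j with In-++⁻ (keep (C? Z v) X₁) _ j
          ...   | inj₁ l = [ inj₁ , inj₂ ∘ inj₂ ∘ inj₁ ]′ (In-keep⁻ (C? Z v) X₁ l)
          ...   | inj₂ l = [ inj₁ , inj₂ ∘ inj₂ ∘ inj₂ ]′ (In-keep⁻ (C? Z v) X₂ l)

          X₁⊆ : ∀ {z} → In z X₁ → C Z v z → In z Z*
          X₁⊆ i c = In-++ʳ (keep (Boundary? Z v) Y) _ (In-++ˡ (keep (C? Z v) X₁) _ (In-keep⁺ (C? Z v) X₁ i c))

          X₂⊆ : ∀ {z} → In z X₂ → C Z v z → In z Z*
          X₂⊆ i c = In-++ʳ (keep (Boundary? Z v) Y) _ (In-++ʳ (keep (C? Z v) X₁) _ (In-keep⁺ (C? Z v) X₂ i c))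

          g₁ : ∀ z → Boundary Z v z → In z Z*
          g₁ z b = In-++ˡ (keep (Boundary? Z v) Y) _ (In-keep⁺ (Boundary? Z v) Y (small z b) b)

          g₂ : ∀ z → In z Z* → In z Z ⊎ C Z v z
          g₂ z i with Z*⁻ i
          ... | inj₁ e = inj₁ (In-0 Z e)
          ... | inj₂ (inj₁ (_ , b , _)) = inj₁ b
          ... | inj₂ (inj₂ (inj₁ (_ , c))) = inj₂ c
          ... | inj₂ (inj₂ (inj₂ (_ , c))) = inj₂ c

          -- Cutting a separator down to the component loses nothing: a path in `G - Z*` never
          -- leaves the component, and in there `Z*` contains all of `X`.
          avoids : ∀ {w w'} (X : Vec V (suc k)) → (∀ {z} → In z X → C Z v z → In z Z*) →
                   C Z v w → ¬ In w Z* → conn E Z* w w' → conn E X w w'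
          avoids {w} X X⊆ c w∉ p = proj₂ (conn-closed (λ y → C Z v y × conn E X w y)
            (λ { (cx , q) x∉ e y∉ → let cy = inside g₁ cx (ext (start x∉) e y∉) in
                 cy , ext q e (λ i → y∉ (X⊆ i cy)) }) p (c , start (λ i → w∉ (X⊆ i c))))

          g₃ : ∀ w → C Z v w × ¬ In w Z* → Half Z* w Z v
          g₃ w (c , w∉) = fromℕ< a<n , fromℕ< b<n , fromℕ< (∣C∣<n Z v)
            , FP.toℕ-fromℕ< a<n
            , trans (cong₂ _+_ (FP.toℕ-fromℕ< a<n) (FP.toℕ-fromℕ< a<n)) (sym (FP.toℕ-fromℕ< b<n))
            , FP.toℕ-fromℕ< (∣C∣<n Z v)
            , subst₂ _≤_ (sym (FP.toℕ-fromℕ< b<n)) (sym (FP.toℕ-fromℕ< (∣C∣<n Z v))) 2a≤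
            where
            a = ∣C∣ Z* w
            a<n = ∣C∣<n Z* w
            2a≤ : a + a ≤ ∣C∣ Z v
            2a≤ = ≤-trans (≤-reflexive (cong (a +_) (sym (+-identityʳ a))))
              (≤-trans (*-monoʳ-≤ 2 (count-mono (C? Z* w) (λ x → connᵗ? E? X₁ w x ×-dec C? Z v x) λ x d →
                 let p = InC-conn (InC-nonzero c) d in avoids X₁ X₁⊆ c w∉ p , inside g₁ c p)) (sep₁ w))
            b<n : a + a < suc n'
            b<n = ≤-<-trans 2a≤ (∣C∣<n Z v)

          g₄ : ∀ w → C Z v w × ¬ In w Z* → Σ (Vec V (mm k)) λ Y' →
               ∀ z → In z Z* × (Σ V λ w' → conn E Z* w w' × E w' z) → In z Y'
          g₄ w (c , w∉) with select (connᵗ? E? X₂ w) Y (hh k) few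
            where
            few : count (λ i → connᵗ? E? X₂ w (lookup Y i)) ≤ hh k
            few = *-cancelˡ-≤ 2 (≤-trans (sep₂ w) (≤-reflexive (cong (hh k +_) (sym (+-identityʳ (hh k))))))
          -- A neighbour of the new component that comes from `Y` and is not in `X₂` lies in the
          -- component of `w` in `G - X₂`, which has at most half of the entries of `Y`. So `hh k`
          -- entries suffice for these, and the separators fill the other `hh k`.
          ... | B , f = B ++ (X₁ ++ X₂) , covered
            where
            covered : ∀ z → In z Z* × (Σ V λ w' → conn E Z* w w' × E w' z) → In z (B ++ (X₁ ++ X₂))
            covered z (i , w' , p , e) with Z*⁻ i
            ... | inj₁ z≡0 = In-0 (B ++ (X₁ ++ X₂)) z≡0
            ... | inj₂ (inj₂ (inj₁ (j , _))) = In-++ʳ B _ (In-++ˡ X₁ X₂ j)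
            ... | inj₂ (inj₂ (inj₂ (j , _))) = In-++ʳ B _ (In-++ʳ X₁ X₂ j)
            ... | inj₂ (inj₁ (j , _)) with In? z X₂
            ...   | yes l = In-++ʳ B _ (In-++ʳ X₁ X₂ l)
            ...   | no z∉ = In-++ˡ B _ (f j (ext (avoids X₂ X₂⊆ c w∉ p) e z∉))

          Z*-good : Good Z v Z*
          Z*-good = good g₁ g₂ g₃ g₄

      next-exists : ∀ Z v → Small Z v → ∃ λ Z' → Next Z v Z'
      next-exists Z v sm = lexLeast (ss k) (Good? Z v)
        -- Here the double negation disappears, since a good tuple can be found by search.
        (decidable-stable (anyᴱ (tup (ss k)) (Good? Z v)) (good-exists Z v sm))

-- Correctness of the defined decomposition

module Tree {n' : ℕ} (k : ℕ) {E : Graph (suc n')} (E? : ∀ x y → Dec (E x y))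
  (E-sym : ∀ {x y} → E x y → E y x) (E-irr : ∀ {x} → ¬ E x x) (tw : TreewidthAtMost k E) where

  open Build k E? public

  Node : Set
  Node = Vec V (suc (ss k))

  Comp : Node → V → Set
  Comp (v ∷ Z) = C Z v

  Comp? : ∀ P → DecP (Comp P)
  Comp? (v ∷ Z) = C? Z v

  ∣_∣ : Node → ℕ
  ∣ v ∷ Z ∣ = ∣C∣ Z v

  NextOf : Node → Bagᵗ → Set
  NextOf (v ∷ Z) Z' = Next Z v Z'

  ChildOf : Node → Node → Set
  ChildOf (v ∷ Z) (v' ∷ Z') = Child v Z v' Z'

  -- For the tuple of zeros the class attached to vertex 0 consists of all other vertices, so that
  -- the root covers the graph even when it is disconnected.
  root : Node
  root = zero ∷ zeros

  data Active : Node → Set where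
    a-root  : Active root
    a-child : ∀ {P Q} → Active P → ChildOf P Q → Active Q

  Par : Node → Node → Set
  Par Q P = Active P × ChildOf P Q

  Bag : Node → V → Set
  Bag P x = Active P × (toℕ x ≡ 0 ⊎ Σ Bagᵗ λ Z' → NextOf P Z' × In x Z')

  next-unique : ∀ P {Z₁ Z₂} → NextOf P Z₁ → NextOf P Z₂ → Z₁ ≡ Z₂
  next-unique (v ∷ Z) {Z₁} {Z₂} (g₁ , l₁) (g₂ , l₂) with Lex-tri Z₁ Z₂
  ... | inj₁ l        = ⊥-elim (l₂ Z₁ l g₁)
  ... | inj₂ (inj₁ e) = e
  ... | inj₂ (inj₂ l) = ⊥-elim (l₁ Z₂ l g₂)

  child-comp : ∀ {P v' Z' x} → ChildOf P (v' ∷ Z') → Comp (v' ∷ Z') x → conn E Z' v' x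
  child-comp {v ∷ Z} {v'} {Z'} (_ , _ , v'∉ , _) = InC-conn (λ e → v'∉ (In-0 Z' e))

  child-⊆ : ∀ {P Q x} → ChildOf P Q → Comp Q x → Comp P x
  child-⊆ {v ∷ Z} {v' ∷ Z'} ch@((g , _) , c , _) d = inside E-sym (good₁ g) c (child-comp {v ∷ Z} ch d)

  comp-∉ : ∀ {v Z x} → Comp (v ∷ Z) x → ¬ In x Z
  comp-∉ = InC-∉

  child-self : ∀ {P v' Z'} → ChildOf P (v' ∷ Z') → Comp (v' ∷ Z') v'
  child-self {v ∷ Z} (_ , _ , v'∉ , _) = inj₁ (start v'∉)

  child-half : ∀ {P Q} → ChildOf P Q → ∣ Q ∣ + ∣ Q ∣ ≤ ∣ P ∣
  child-half {v ∷ Z} {v' ∷ Z'} ((g , _) , c , v'∉ , _) = half (good₃ g v' (c , v'∉))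
    where
    half : Half Z' v' Z v → ∣C∣ Z' v' + ∣C∣ Z' v' ≤ ∣C∣ Z v
    half (a , b , d , ea , eb , ed , l) = subst₂ _≤_ (trans (sym eb) (cong₂ _+_ ea ea)) ed l

  comp-pos : ∀ P {x} → Comp P x → 1 ≤ ∣ P ∣
  comp-pos (v ∷ Z) {x} c = count-pos (C? Z v) x c

  child-pos : ∀ {P Q} → ChildOf P Q → 1 ≤ ∣ Q ∣
  child-pos {P} {v' ∷ Z'} ch = comp-pos (v' ∷ Z') (child-self {P} ch)

  child-< : ∀ {P Q} → ChildOf P Q → ∣ Q ∣ < ∣ P ∣
  child-< {P} {Q} ch = <-≤-trans (m<m+n ∣ Q ∣ (child-pos {P} {Q} ch)) (child-half {P} {Q} ch)

  child-unique : ∀ {P Q₁ Q₂ x} → ChildOf P Q₁ → ChildOf P Q₂ → Comp Q₁ x → Comp Q₂ x → Q₁ ≡ Q₂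
  child-unique {v ∷ Z} {v₁ ∷ Z₁} {v₂ ∷ Z₂} {x} ch₁@(n₁ , _ , _ , l₁) ch₂@(n₂ , _ , _ , l₂) c₁ c₂
    with next-unique (v ∷ Z) n₁ n₂
  ... | refl = cong (_∷ Z₁) (least-unique {P = λ u → conn E Z₁ u x}
          p₁ (λ u l q → l₁ u l (conn-trans q (conn-sym E-sym p₁)))
          p₂ (λ u l q → l₂ u l (conn-trans q (conn-sym E-sym p₂))))
    where
    p₁ = child-comp {v ∷ Z} ch₁ c₁
    p₂ = child-comp {v ∷ Z} ch₂ c₂

  child-exists : ∀ P {Z' x} → NextOf P Z' → Comp P x → ¬ In x Z' → ∃ λ v' → ChildOf P (v' ∷ Z') × Comp (v' ∷ Z') x
  child-exists (v ∷ Z) {Z'} {x} nx c x∉ with least (λ u → connᵗ? E? Z' u x) (x , start x∉)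
  ... | v' , p , l = v' , (nx , inside E-sym (good₁ (proj₁ nx)) c (conn-sym E-sym p) , conn-src p
                          , λ u l' q → l u l' (conn-trans q p)) , inj₁ p

  small : ∀ {P} → Active P → Small (V.tail P) (V.head P)
  small a-root = zeros , λ z (i , _) → In-0 (zeros {q = mm k}) (In-zeros (ss k) i)
  small (a-child {v ∷ Z} {v' ∷ Z'} a ch@((g , _) , c , v'∉ , _)) =
    let Y , f = good₄ g v' (c , v'∉) in Y , λ z (i , w , d , e) → f z (i , w , child-comp {v ∷ Z} ch d , e)

  next : ∀ {P} → Active P → ∃ (NextOf P)
  next {v ∷ Z} a = next-exists E-sym tw Z v (small a)

  active-star : ∀ {P} → Active P → Star ChildOf root P
  active-star a-root         = ε
  active-star (a-child a ch) = active-star a ◅◅ ch ◅ ε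

  star-active : ∀ {P Q} → Active P → Star ChildOf P Q → Active Q
  star-active a ε        = a
  star-active a (ch ◅ s) = star-active (a-child a ch) s

  star-⊆ : ∀ {P Q x} → Star ChildOf P Q → Comp Q x → Comp P x
  star-⊆ ε c = c
  star-⊆ (_◅_ {P} {Q} ch s) c = child-⊆ {P} {Q} ch (star-⊆ s c)

  -- The component of `R` lies inside that of `Q`, which was formed after removing the bag of `P`.
  below-∉ : ∀ {P Q R Z' x} → NextOf P Z' → ChildOf P Q → Star ChildOf Q R → Comp R x → ¬ In x Z'
  below-∉ {v ∷ Z} {v' ∷ Z''} nx ch s c i with next-unique (v ∷ Z) nx (proj₁ ch)
  ... | refl = comp-∉ (star-⊆ s c) i

  -- Distinct children of a node have disjoint components, so two descents towards a common vertex
  -- coincide until one of them ends.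
  laminar : ∀ {O P Q x} → Star ChildOf O P → Star ChildOf O Q → Comp P x → Comp Q x →
            Star ChildOf P Q ⊎ Star ChildOf Q P
  laminar ε s _ _ = inj₁ s
  laminar s ε _ _ = inj₂ s
  laminar {O} (_◅_ {j = P'} ch s) (_◅_ {j = Q'} ch' s') c d
    with child-unique {O} {P'} {Q'} ch ch' (star-⊆ s c) (star-⊆ s' d)
  ... | refl = laminar s s' c d

  comp-nonzero : ∀ P {x} → Comp P x → ¬ toℕ x ≡ 0
  comp-nonzero (v ∷ Z) = InC-nonzero

  root-comp : ∀ {x} → ¬ toℕ x ≡ 0 → Comp root x
  root-comp x≢0 = inj₂ (refl , (λ i → x≢0 (In-zeros (ss k) i)) , λ a (i , a≢0) → ⊥-elim (a≢0 (In-zeros (ss k) i)))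

  top-unique : ∀ {P Q x} → Active P → Active Q → Comp P x → Comp Q x → Bag P x → Bag Q x → P ≡ Q
  top-unique {P} {Q} {x} a b c d (_ , i) (_ , j) with laminar (active-star a) (active-star b) c d
  ... | inj₁ ε = refl
  ... | inj₂ ε = refl
  ... | inj₁ (ch ◅ s) = ⊥-elim ([ comp-nonzero P c , (λ (Z' , nx , l) → below-∉ {P} nx ch s d l) ]′ i)
  ... | inj₂ (ch ◅ s) = ⊥-elim ([ comp-nonzero Q d , (λ (Z' , nx , l) → below-∉ {Q} nx ch s c l) ]′ j)

  -- The highest node at which `x` occurs: it is in the bag and still in the component. Vertex 0 is
  -- in no component and gets the root.
  Top : V → Node → Set
  Top x P = Active P × Bag P x × (Comp P x ⊎ (toℕ x ≡ 0 × P ≡ root))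

  -- A member of a bag that is not in the component of the node comes from the previous bag, which
  -- is the bag of the parent. So every occurrence walks up to the top, and the top is unique.
  climb : ∀ {P x} → Active P → Bag P x → ∃ λ T → Top x T × Walk Par (λ Q → Bag Q x) P T
  climb a-root b@(_ , inj₁ e) = root , (a-root , b , inj₂ (e , refl)) , stop b
  climb {x = x} a-root b@(_ , inj₂ (Z' , (g , _) , i)) with good₂ g x i
  ... | inj₁ j = root , (a-root , b , inj₂ (In-zeros (ss k) j , refl)) , stop b
  ... | inj₂ c = root , (a-root , b , inj₁ c) , stop b
  climb {P = Q} {x} (a-child {P} a ch) b@(_ , inj₁ e) with climb {P} {x} a (a , inj₁ e)
  ... | T , t , w = T , t , upw b (a , ch) w
  climb {P = v' ∷ Z} {x} a'@(a-child {P@(u ∷ Z₀)} a ch) b@(_ , inj₂ (Z' , (g , _) , i)) with good₂ g x i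
  ... | inj₂ c = v' ∷ Z , (a' , b , inj₁ c) , stop b
  ... | inj₁ j with climb {P} {x} a (a , inj₂ (Z , proj₁ ch , j))
  ...   | T , t , w = T , t , upw b (a , ch) w

  Top-unique : ∀ {x P Q} → Top x P → Top x Q → P ≡ Q
  Top-unique (a , b , inj₁ c) (a' , b' , inj₁ c') = top-unique a a' c c' b b'
  Top-unique {P = P} (_ , _ , inj₁ c) (_ , _ , inj₂ (e , _)) = ⊥-elim (comp-nonzero P c e)
  Top-unique {Q = Q} (_ , _ , inj₂ (e , _)) (_ , _ , inj₁ c) = ⊥-elim (comp-nonzero Q c e)
  Top-unique (_ , _ , inj₂ (_ , e)) (_ , _ , inj₂ (_ , e')) = trans e (sym e')

  bags-connected : ∀ {x P Q} → Bag P x → Bag Q x → Walk Par (λ R → Bag R x) P Q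
  bags-connected {x} {P} {Q} b@(a , _) b'@(a' , _) with climb {P} {x} a b | climb {Q} {x} a' b'
  ... | T , t , w | T' , t' , w' with Top-unique t t'
  ...   | refl = walk-++ w (walk-sym w')

  star-≤ : ∀ {P Q} → Star ChildOf P Q → ∣ Q ∣ ≤ ∣ P ∣
  star-≤ ε = ≤-refl
  star-≤ (_◅_ {P} {Q} ch s) = ≤-trans (star-≤ s) (<⇒≤ (child-< {P} {Q} ch))

  -- If `P₁` were strictly above `P₂`, its child in the direction of `P₂` would share a vertex with
  -- `Q` and hence be `Q`; but `Q` is smaller than `P₂`.
  parent-below : ∀ {Q P₁ P₂} → ChildOf P₁ Q → ChildOf P₂ Q → Star ChildOf P₁ P₂ → P₁ ≡ P₂
  parent-below ch₁ ch₂ ε = refl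
  parent-below {v' ∷ Z'} {P₁} {P₂} ch₁ ch₂ (_◅_ {j = R} ch s)
    with child-unique {P₁} {v' ∷ Z'} {R} ch₁ ch (child-self {P₁} ch₁) (star-⊆ s (child-⊆ {P₂} {v' ∷ Z'} ch₂ (child-self {P₂} ch₂)))
  ... | refl = ⊥-elim (<-irrefl refl (≤-<-trans (star-≤ s) (child-< {P₂} {v' ∷ Z'} ch₂)))

  parent-unique : ∀ {Q P₁ P₂} → Par Q P₁ → Par Q P₂ → P₁ ≡ P₂
  parent-unique {Q@(v' ∷ Z')} {P₁} {P₂} (a₁ , ch₁) (a₂ , ch₂)
    with laminar (active-star a₁) (active-star a₂) (child-⊆ {P₁} {Q} ch₁ (child-self {P₁} ch₁)) (child-⊆ {P₂} {Q} ch₂ (child-self {P₂} ch₂))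
  ... | inj₁ s = parent-below {Q} ch₁ ch₂ s
  ... | inj₂ s = sym (parent-below {Q} ch₂ ch₁ s)

  find-vertex : ∀ f {P x} → ∣ P ∣ ≤ f → Active P → Comp P x → ∃ λ Q → Bag Q x
  find-vertex zero    {P} l a c = ⊥-elim (<⇒≱ (comp-pos P c) l)
  find-vertex (suc f) {P} {x} l a c with next a
  ... | Z' , nx with In? x Z'
  ...   | yes i = P , a , inj₂ (Z' , nx , i)
  ...   | no x∉ with child-exists P nx c x∉
  ...     | v' , ch , d = find-vertex f (s≤s⁻¹ (<-≤-trans (child-< {P} {v' ∷ Z'} ch) l)) (a-child a ch) d

  -- One endpoint may enter the bags before the other. It is then on the boundary of the component
  -- of the other endpoint, and so it stays in the bags along the descent until they meet.
  find-edge : ∀ f {v Z x y} → ∣ v ∷ Z ∣ ≤ f → Active (v ∷ Z) → Comp (v ∷ Z) x → Comp (v ∷ Z) y ⊎ In y Z → E x y →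
              ∃ λ Q → Bag Q x × Bag Q y
  find-edge zero {v} {Z} l a c d e = ⊥-elim (<⇒≱ (comp-pos (v ∷ Z) c) l)
  find-edge (suc f) {v} {Z} {x} {y} l a c d e with next a
  ... | Z' , nx with In? x Z' | In? y Z'
  ...   | yes i | yes j = (v ∷ Z) , (a , inj₂ (Z' , nx , i)) , (a , inj₂ (Z' , nx , j))
  ...   | no x∉ | yes j with child-exists (v ∷ Z) nx c x∉
  ...     | v' , ch , c' = find-edge f (s≤s⁻¹ (<-≤-trans (child-< {v ∷ Z} {v' ∷ Z'} ch) l)) (a-child a ch) c' (inj₂ j) e
  find-edge (suc f) {v} {Z} {x} {y} l a c (inj₂ j) e | Z' , nx | _ | no y∉ =
    ⊥-elim (y∉ (good₁ (proj₁ nx) y (j , x , c , e)))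
  find-edge (suc f) {v} {Z} {x} {y} l a c (inj₁ d) e | Z' , nx | yes i | no y∉ with child-exists (v ∷ Z) nx d y∉
  ... | v' , ch , d' with find-edge f (s≤s⁻¹ (<-≤-trans (child-< {v ∷ Z} {v' ∷ Z'} ch) l)) (a-child a ch) d' (inj₂ i) (E-sym e)
  ...   | Q , b , b' = Q , b' , b
  find-edge (suc f) {v} {Z} {x} {y} l a c (inj₁ d) e | Z' , nx | no x∉ | no y∉ with child-exists (v ∷ Z) nx c x∉
  ... | v' , ch , c' = find-edge f (s≤s⁻¹ (<-≤-trans (child-< {v ∷ Z} {v' ∷ Z'} ch) l)) (a-child a ch) c'
    (inj₁ (inj₁ (ext (child-comp {v ∷ Z} ch c') e y∉))) e

  reach-up : ∀ {P} → Active P → ∃ λ j → ReachIn Par j P root × (2 ^ j * ∣ P ∣ ≤ ∣ root ∣)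
  reach-up a-root = 0 , here , ≤-reflexive (+-identityʳ _)
  reach-up (a-child {P} {Q} a ch) with reach-up a
  ... | j , r , l = suc j , up (a , ch) r , ≤-trans (≤-reflexive (eqn (2 ^ j) ∣ Q ∣)) (≤-trans (*-monoʳ-≤ (2 ^ j) (child-half {P} {Q} ch)) l)
    where
    eqn : ∀ p q → (2 * p) * q ≡ p * (q + q)
    eqn p q = trans (cong (_* q) (*-comm 2 p)) (trans (*-assoc p 2 q) (cong (λ t → p * (q + t)) (+-identityʳ q)))

  ∣root∣<n : ∣ root ∣ < suc n'
  ∣root∣<n = ∣C∣<n zeros zero

  depth-bound : ∀ {P} → Active P → ∃ λ j → j ≤ ⌈log₂ suc n' ⌉ × ReachIn Par j P root
  depth-bound a-root = 0 , z≤n , here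
  depth-bound a@(a-child {P} {Q} _ ch) with reach-up a
  ... | j , r , l = j , 2^j<n⇒j≤log j (suc n') (≤-trans (m≤m*n' (child-pos {P} {Q} ch)) (≤-trans l (<⇒≤ ∣root∣<n))) , r
    where
    m≤m*n' : ∀ {m n} → 1 ≤ n → m ≤ m * n
    m≤m*n' {m} h = ≤-trans (≤-reflexive (sym (*-identityʳ m))) (*-monoʳ-≤ m h)

  isTD : IsTreeDecomposition E Active Par Bag root
  isTD = record
    { par-node      = λ { (a , ch) → a-child a ch , a }
    ; par-fun       = parent-unique
    ; root-node     = a-root
    ; root-noParent = λ { {u ∷ Z} (a , _ , _ , v'∉ , _) → v'∉ (In-0 (zeros {q = ss k}) refl) }
    ; reach-root    = λ a → let j , r , _ = reach-up a in j , r
    ; bag-node      = proj₁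
    ; cover-vertex  = cover
    ; cover-edge    = cover-edge'
    ; connected     = bags-connected
    }
    where
    cover : ∀ x → ∃ λ P → Bag P x
    cover zero    = root , a-root , inj₁ refl
    cover (suc x) = find-vertex ∣ root ∣ ≤-refl a-root (root-comp λ ())
    cover-edge' : ∀ {x y} → E x y → ∃ λ P → Bag P x × Bag P y
    cover-edge' {zero}  {zero}  e = ⊥-elim (E-irr e)
    cover-edge' {zero}  {suc y} e with find-edge ∣ root ∣ ≤-refl a-root (root-comp {suc y} λ ()) (inj₂ (In-0 (zeros {q = ss k}) refl)) (E-sym e)
    ... | Q , b , b' = Q , b' , b
    cover-edge' {suc x} {zero}  e = find-edge ∣ root ∣ ≤-refl a-root (root-comp λ ()) (inj₂ (In-0 (zeros {q = ss k}) refl)) e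
    cover-edge' {suc x} {suc y} e = find-edge ∣ root ∣ ≤-refl a-root (root-comp λ ()) (inj₁ (root-comp λ ())) e

  In⇒∈ : ∀ {q x} (A : Vec V q) → In x A → x ∈ zero ∷ toList A
  In⇒∈ A i with In-toList A i
  ... | inj₁ e = here (FP.toℕ-injective e)
  ... | inj₂ j = there j

  width-bound : ∀ P → Active P → ∃ λ (L : List V) → length L ≤ suc (ss k) × (∀ x → Bag P x → x ∈ L)
  width-bound P a with next a
  ... | Z' , nx = zero ∷ toList Z' , ≤-reflexive (cong suc (VP.length-toList Z')) , λ where
    x (_ , inj₁ e) → here (FP.toℕ-injective e)
    x (_ , inj₂ (Z'' , nx' , i)) → In⇒∈ Z' (subst (In x) (next-unique P nx' nx) i)

  -- All bags on the way from the root to the node where `x` enters a bag: these are the nodes whose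
  -- components contain `x`.
  Closure : V → V → Set
  Closure x y = y ≡ x ⊎ Σ V λ v → Σ Bagᵗ λ Z → Active (v ∷ Z) × C Z v x × Σ Bagᵗ λ Z' → Next Z v Z' × In y Z'

  -- Sizes halve, so at most `f` bags are collected; once `x` is in the bag itself, no component
  -- further down contains it.
  chain : ∀ f {P x} → ∣ P ∣ < 2 ^ f → Active P → Comp P x → ∃ λ (L : List V) → length L ≤ f * suc (ss k) ×
          (∀ {Q Z' y} → Star ChildOf P Q → Comp Q x → NextOf Q Z' → In y Z' → y ∈ L)
  chain zero    {P} l a c = ⊥-elim (<⇒≱ (comp-pos P c) (s≤s⁻¹ l))
  chain (suc f) {P} {x} l a c with next a
  ... | Z' , nx with In? x Z'
  ...   | yes i = zero ∷ toList Z' , ≤-trans (≤-reflexive (cong suc (VP.length-toList Z'))) (m≤m+n _ (f * suc (ss k))) , λ where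
    (ch ◅ s) d nx' j → ⊥-elim (below-∉ {P} nx ch s d i)
    {y = y} ε d nx' j → In⇒∈ Z' (subst (In y) (next-unique P nx' nx) j)
  ...   | no x∉ with child-exists P nx c x∉
  ...     | v' , ch , d with chain f {v' ∷ Z'} (*-cancelˡ-< 2 _ _ (≤-<-trans (≤-reflexive (cong (∣ v' ∷ Z' ∣ +_) (+-identityʳ _))) (≤-<-trans (child-half {P} {v' ∷ Z'} ch) l))) (a-child a ch) d
  ...       | L , b , h = (zero ∷ toList Z') L.++ L
    , ≤-trans (≤-reflexive (LP.length-++ (zero ∷ toList Z'))) (+-mono-≤ (≤-reflexive (cong suc (VP.length-toList Z'))) b)
    , found
    where
    found : ∀ {Q Z'' y} → Star ChildOf P Q → Comp Q x → NextOf Q Z'' → In y Z'' → y ∈ (zero ∷ toList Z') L.++ L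
    found {y = y} ε d' nx' j = ∈-++⁺ˡ (In⇒∈ Z' (subst (In y) (next-unique P nx' nx) j))
    found {Q} (_◅_ {j = R} ch' s) d' nx' j = ∈-++⁺ʳ (zero ∷ toList Z')
      (h (subst (λ T → Star ChildOf T Q) (child-unique {P} {R} {v' ∷ Z'} ch' ch (star-⊆ s d') d) s) d' nx' j)

  closure-bound : ∀ x → ∃ λ (L : List V) → length L ≤ suc (⌈log₂ suc n' ⌉ * suc (ss k)) × (∀ y → Closure x y → y ∈ L)
  closure-bound x with Comp? root x
  ... | no out = x ∷ [] , s≤s z≤n , λ where
    y (inj₁ e) → here e
    y (inj₂ (v , Z , a , c , _)) → ⊥-elim (out (star-⊆ (active-star a) c))
  ... | yes c with chain ⌈log₂ suc n' ⌉ (<-≤-trans ∣root∣<n (n≤2^⌈log₂n⌉ (suc n'))) a-root c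
  ...   | L , b , h = x ∷ L , s≤s b , λ where
    y (inj₁ e) → here e
    y (inj₂ (v , Z , a , d , Z' , nx , i)) → there (h (active-star a) d nx i)

  -- A vertex of the component of `Q` is in no bag strictly above `Q`, and it occurs at or below its
  -- top. So every node whose bag contains it is `Q` or a descendant.
  bag-below : ∀ {P Q x} → Active P → Active Q → Comp Q x → ∀ {Z'} → NextOf P Z' → In x Z' → ∀ {y} → Comp P y → Comp Q y
  bag-below {P@(v ∷ Z)} {Q} {x} a b c {Z'} nx@(g , _) i {y} d with good₂ g x i
  ... | inj₂ c' with laminar (active-star a) (active-star b) c' c
  ...   | inj₂ s = star-⊆ s d
  ...   | inj₁ ε = d
  ...   | inj₁ (ch ◅ s) = ⊥-elim (below-∉ {P} nx ch s c i)
  bag-below {Q = Q} a-root b c nx i d | inj₁ j = ⊥-elim (comp-nonzero Q c (In-zeros (ss k) j))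
  bag-below {v ∷ Z} {Q} (a-child {P'@(u ∷ Z₀)} a ch) b c nx i d | inj₁ j =
    bag-below {P'} {Q} a b c (proj₁ ch) j (child-⊆ {P'} {v ∷ Z} ch d)

  -- Descend towards `w` while the component also contains a member of `M`. The bag at which they
  -- part is in the closure of that member. By `bag-below`, a closure vertex on the side of `w`
  -- would put a member of `M` on that side.
  closure-separates : ∀ {M : V → Set} → DecP M → ∀ w → ¬ toℕ w ≡ 0 → (∀ m → M m → ¬ Closure m w) →
    ∃ λ (Y : Bagᵗ) → (∀ y → In y Y → toℕ y ≡ 0 ⊎ ∃ λ m → M m × Closure m y) ×
                     (∀ x → conn E Y w x → ∀ m → M m → ¬ Closure m x)
  closure-separates {M} M? w w≢0 w∉ = start'
    where
    Goal = ∃ λ (Y : Bagᵗ) → (∀ y → In y Y → toℕ y ≡ 0 ⊎ ∃ λ m → M m × Closure m y) ×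
                     (∀ x → conn E Y w x → ∀ m → M m → ¬ Closure m x)
    descend : ∀ f {P} → ∣ P ∣ ≤ f → Active P → Comp P w → (∃ λ m → M m × Comp P m) → Goal
    descend zero {P} l a c _ = ⊥-elim (<⇒≱ (comp-pos P c) l)
    descend (suc f) {P@(v ∷ Z)} l a c (m , m∈ , cm) with next a
    ... | Z' , nx with In? w Z'
    ...   | yes i = ⊥-elim (w∉ m m∈ (inj₂ (v , Z , a , cm , Z' , nx , i)))
    ...   | no w∉Z' with child-exists P nx c w∉Z'
    ...     | v' , ch , d with FP.any? (λ m' → M? m' ×-dec Comp? (v' ∷ Z') m')
    ...       | yes q = descend f (s≤s⁻¹ (<-≤-trans (child-< {P} {v' ∷ Z'} ch) l)) (a-child a ch) d q
    ...       | no none = Z' , (λ y i → inj₂ (m , m∈ , inj₂ (v , Z , a , cm , Z' , nx , i))) , λ where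
      x p m' m'∈ (inj₁ refl) → none (m' , m'∈ , inj₁ (conn-trans (child-comp {P} ch d) p))
      x p m' m'∈ (inj₂ (u , U , b , c' , U' , nx' , i)) →
        none (m' , m'∈ , bag-below {u ∷ U} {v' ∷ Z'} b (a-child a ch) (inj₁ (conn-trans (child-comp {P} ch d) p)) nx' i c')
    start' : Goal
    -- If `M` contains at most vertex 0, its closure does too, because 0 is in no component, and the
    -- tuple of zeros separates.
    start' with FP.any? (λ m → M? m ×-dec ¬? (toℕ m Data.Nat.≟ 0))
    ... | yes (m , m∈ , m≢0) = descend ∣ root ∣ ≤-refl a-root (root-comp w≢0) (m , m∈ , root-comp m≢0)
    ... | no none = zeros , (λ y i → inj₁ (In-zeros (ss k) i)) , λ where
      x p m m∈ (inj₁ refl) → conn-tgt p (In-0 (zeros {q = ss k}) (decidable-stable (_ Data.Nat.≟ _) (λ x≢0 → none (m , m∈ , x≢0))))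
      x p m m∈ (inj₂ (u , U , b , c' , _)) → none (m , m∈ , comp-nonzero (u ∷ U) c')

-- Components and their sizes after a change

count-nz : ∀ {n'} {P : Fin (suc n') → Set} (P? : DecP P) → (∀ x → P x → ¬ toℕ x ≡ 0) → count P? < suc n'
count-nz P? h = count-nonzero P? h (s≤s z≤n)

Cell : ℕ → ℕ → Set
Cell n q = Env n (elt ∷ tup q ∷ elt ∷ [])

-- Cardinality of P by adding up, in increasing order of the items, the sizes of the classes {z | rep z i}.
module SumPath {n' q : ℕ} {I P : Fin (suc n') → Set} {rep : Fin (suc n') → Fin (suc n') → Set}
  (I? : DecP I) (P? : DecP P) (rep? : ∀ z i → Dec (rep z i))
  (rep-I : ∀ {z i} → rep z i → I i) (rep-P : ∀ {z i} → rep z i → P z)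
  (rep-fun : ∀ {z i j} → rep z i → rep z j → i ≡ j) (rep-total : ∀ {z} → P z → ∃ (rep z))
  (I≢0 : ∀ {i} → I i → ¬ toℕ i ≡ 0) (P≢0 : ∀ {z} → P z → ¬ toℕ z ≡ 0)
  (Val : Fin (suc n') → Fin (suc n') → Set)
  (val-ok : ∀ {i} → I i → ∀ d → Val i d ⟺ (toℕ d ≡ count (λ z → rep? z i)))
  where

  private
    V = Fin (suc n')

  -- A state holds the last item added and the sum so far. The tuple is carried along unchanged, so
  -- that all closures share one type of states.
  Step : Cell (suc n') q → Cell (suc n') q → Set
  Step (w , Z , z , _) (w' , Z' , z' , _) = Z ≡ Z' × toℕ w < toℕ w' × I w'
    × (∀ x → toℕ w < toℕ x × toℕ x < toℕ w' → ¬ I x) × Σ V λ d → Val w' d × toℕ z + toℕ d ≡ toℕ z'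

  Total : V → Vec V q → V → Set
  Total o Z z = Σ V λ w → (∀ x → toℕ w < toℕ x → ¬ I x) × Star Step (o , Z , o , tt) (w , Z , z , tt)

  private
    Pre : V → V → Set
    Pre w p = Σ V λ i → toℕ i ≤ toℕ w × rep p i

    Pre? : ∀ w → DecP (Pre w)
    Pre? w p = FP.any? (λ i → (toℕ i ≤? toℕ w) ×-dec rep? p i)

    Pre-step : ∀ {w w'} → toℕ w < toℕ w' → (∀ x → toℕ w < toℕ x × toℕ x < toℕ w' → ¬ I x) →
               count (Pre? w') ≡ count (Pre? w) + count (λ z → rep? z w')
    Pre-step {w} {w'} l gap = count-⊎ (Pre? w) (λ z → rep? z w') (Pre? w')
      (λ { p (i , i≤ , r) r' → <-irrefl refl (<-≤-trans l (subst (λ j → toℕ j ≤ toℕ w) (rep-fun r r') i≤)) })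
      (λ p → split p , [ (λ (i , i≤ , r) → i , ≤-trans i≤ (<⇒≤ l) , r) , (λ r → w' , ≤-refl , r) ]′)
      where
      split : ∀ p → Pre w' p → Pre w p ⊎ rep p w'
      split p (i , i≤ , r) with toℕ i ≤? toℕ w | <-cmp (toℕ i) (toℕ w')
      ... | yes i≤w | _ = inj₁ (i , i≤w , r)
      ... | no _ | tri≈ _ e _ = inj₂ (subst (rep p) (FP.toℕ-injective e) r)
      ... | no _ | tri> _ _ g = ⊥-elim (<⇒≱ g i≤)
      ... | no i≰ | tri< g _ _ = ⊥-elim (gap i (≰⇒> i≰ , g) (rep-I r))

    sound : ∀ {s t} → toℕ (proj₁ (proj₂ (proj₂ s))) ≡ count (Pre? (proj₁ s)) → Star Step s t →
            toℕ (proj₁ (proj₂ (proj₂ t))) ≡ count (Pre? (proj₁ t))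
    sound h ε = h
    sound {w , Z , z , _} h (_◅_ {j = w' , Z' , z' , _} (_ , l , i , gap , d , v , e) s) = sound
      (trans (sym e) (trans (cong₂ _+_ h (proj₁ (val-ok i d) v)) (sym (Pre-step l gap)))) s

    Pre-0 : ∀ {o} → toℕ o ≡ 0 → count (Pre? o) ≡ 0
    Pre-0 e = count-none (Pre? _) (λ { p (i , i≤ , r) → I≢0 (rep-I r) (n≤0⇒n≡0 (≤-trans i≤ (≤-reflexive e))) })

    Pre-≤ : ∀ w → count (Pre? w) ≤ count P?
    Pre-≤ w = count-mono (Pre? w) P? (λ { p (i , _ , r) → rep-P r })

    -- The path never leaves the domain: each partial sum counts a subset of `P`, which does not
    -- contain 0.
    build : ∀ {o} → toℕ o ≡ 0 → (Z : Vec V q) → ∀ p → p < suc n' → Σ V λ w → Σ V λ z → toℕ w ≤ p ×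
            (∀ x → toℕ w < toℕ x → toℕ x ≤ p → ¬ I x) × Star Step (o , Z , o , tt) (w , Z , z , tt)
    build {o} o≡0 Z zero l = o , o , ≤-reflexive o≡0 , (λ x a b → ⊥-elim (<⇒≱ a (≤-trans b z≤n))) , ε
    build {o} o≡0 Z (suc p) l with build o≡0 Z p (<⇒≤ l)
    ... | w , z , w≤ , gap , s with I? (fromℕ< l)
    ...   | no ni = w , z , m≤n⇒m≤1+n w≤ , gap' , s
      where
      gap' : ∀ x → toℕ w < toℕ x → toℕ x ≤ suc p → ¬ I x
      gap' x a b i with toℕ x Data.Nat.≟ suc p
      ... | yes e = ni (subst I (FP.toℕ-injective (trans e (sym (FP.toℕ-fromℕ< l)))) i)
      ... | no ne = gap x a (s≤s⁻¹ (≤∧≢⇒< b ne)) i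
    ...   | yes i = x , fromℕ< z'<n , ≤-reflexive (FP.toℕ-fromℕ< l) , (λ y a b → ⊥-elim (<⇒≱ a (≤-trans b (≤-reflexive (sym (FP.toℕ-fromℕ< l))))))
                  , s ◅◅ (refl , w<x , i , (λ y (a , b) → gap y a (s≤s⁻¹ (<-≤-trans b (≤-reflexive (FP.toℕ-fromℕ< l)))))
                         , fromℕ< d<n , proj₂ (val-ok i _) (FP.toℕ-fromℕ< d<n) , trans (cong (toℕ z +_) (FP.toℕ-fromℕ< d<n)) (sym (FP.toℕ-fromℕ< z'<n))) ◅ ε
      where
      x : V
      x = fromℕ< l
      w<x : toℕ w < toℕ x
      w<x = ≤-trans (s≤s w≤) (≤-reflexive (sym (FP.toℕ-fromℕ< l)))
      d : ℕ
      d = count (λ y → rep? y x)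
      d<n : d < suc n'
      d<n = count-nz (λ y → rep? y x) (λ y r → P≢0 (rep-P r))
      z'<n : toℕ z + d < suc n'
      z'<n = ≤-<-trans (≤-reflexive (trans (cong (_+ d) (sound (trans o≡0 (sym (Pre-0 o≡0))) s))
          (sym (Pre-step w<x (λ y (a , b) → gap y a (s≤s⁻¹ (<-≤-trans b (≤-reflexive (FP.toℕ-fromℕ< l)))))))))
        (≤-<-trans (Pre-≤ x) (count-nz P? (λ y → P≢0)))

    finish : ∀ {w} → (∀ x → toℕ w < toℕ x → ¬ I x) → count (Pre? w) ≡ count P?
    finish {w} h = count-cong (Pre? w) P? λ p → (λ { (i , _ , r) → rep-P r })
      , λ pp → let i , r = rep-total pp in i , ≮⇒≥ (λ l → h i l (rep-I r)) , r

  total-correct : ∀ {o} → toℕ o ≡ 0 → ∀ Z z → Total o Z z ⟺ (toℕ z ≡ count P?)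
  total-correct {o} o≡0 Z z = to , from
    where
    to : ∀ {z} → Total o Z z → toℕ z ≡ count P?
    to (w , h , s) = trans (sound (trans o≡0 (sym (Pre-0 o≡0))) s) (finish h)
    from : toℕ z ≡ count P? → Total o Z z
    from e with build o≡0 Z n' ≤-refl
    ... | w , z' , _ , gap , s = w , last , subst (λ u → Star Step (o , Z , o , tt) (w , Z , u , tt)) z'≡z s
      where
      last : ∀ x → toℕ w < toℕ x → ¬ I x
      last x l = gap x l (s≤s⁻¹ (FP.toℕ<n x))
      z'≡z : z' ≡ z
      z'≡z = FP.toℕ-injective (trans (to (w , last , s)) (sym e))

  module Bound {Code : Set} (_≟_ : (c c' : Code) → Dec (c ≡ c')) (K : V → Code → Set)
    (K-inj : ∀ {w w' c} → I w → I w' → K w c → K w' c → ¬ toℕ w < toℕ w')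
    (L : List Code) (code : ∀ {w} → I w → ∃ λ c → K w c × c ∈ L) where

    private
      increasing : ∀ {s t} → Star Step s t → s ≡ t ⊎ toℕ (proj₁ s) < toℕ (proj₁ t)
      increasing ε = inj₁ refl
      increasing (_◅_ (_ , l , _) s) with increasing s
      ... | inj₁ refl = inj₂ l
      ... | inj₂ l' = inj₂ (<-trans l l')

      Kₛ : Cell (suc n') q → Code → Set
      Kₛ (w , _) c = I w × K w c

      -- Items strictly increase along a path; hence one code cannot be visited at two different
      -- states.
      same : ∀ {s t c} → Star Step s t → Kₛ s c → Kₛ t c → s ≡ t
      same s (i , k) (j , k') with increasing s
      ... | inj₁ e = e
      ... | inj₂ l = ⊥-elim (K-inj i j k k' l)

    bounded : ∀ {s t} → Star Step s t → ∃ λ j → j ≤ length L × ReachIn Step j s t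
    bounded = Shorten.shorten _≟_ Step Kₛ same L (λ (_ , _ , i , _) → let c , k , m = code i in c , (i , k) , m)

One : ∀ {n} → Fin n → Set
One {n} d = Σ (Fin n) λ o → toℕ o ≡ 0 × toℕ o < toℕ d × ((e : Fin n) → toℕ e < toℕ d → toℕ e ≡ 0)

One-correct : ∀ {n'} (d : Fin (suc n')) → One d ⟺ (toℕ d ≡ 1)
One-correct zero    = (λ { (o , _ , () , _) }) , λ ()
One-correct (suc zero) = (λ _ → refl) , (λ _ → zero , refl , s≤s z≤n , λ { zero _ → refl ; (suc e) (s≤s ()) })
One-correct {suc n'} (suc (suc d)) = big , λ ()
  where
  big : One {suc (suc n')} (suc (suc d)) → suc (suc (toℕ d)) ≡ 1
  big (o , _ , _ , h) with h (suc zero) (s≤s (s≤s z≤n))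
  ... | ()

-- X contains all endpoints of changed edges; every component of the complement of X, which is the same
-- in the old graph E and in the new graph E', is cut off from X by a tuple of members of X.
module Torso {n' q : ℕ} {E E' : Graph (suc n')} (E? : ∀ x y → Dec (E x y)) (E'? : ∀ x y → Dec (E' x y))
  (E-sym : ∀ {x y} → E x y → E y x) (E'-sym : ∀ {x y} → E' x y → E' y x)
  {X : Fin (suc n') → Set} (X? : DecP X) (0∈X : ∀ {x} → toℕ x ≡ 0 → X x)
  (E⇒E' : ∀ {x y} → ¬ X x → E x y → E' x y) (E'⇒E : ∀ {x y} → ¬ X x → E' x y → E x y)
  (sep : ∀ w → ¬ X w → Σ (Vec (Fin (suc n')) q) λ Y → (∀ y → In y Y → X y) × (∀ x → X x → ¬ conn E Y w x))
  where

  private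
    V = Fin (suc n')

  -- Connectivity in `G - X`, although `X` is too large to be a tuple: removing a tuple `Y` from `X`
  -- that already cuts off the component has the same effect, and for tuples connectivity is stored.
  Via : V → V → Set
  Via w w' = Σ (Vec V q) λ Y → (∀ y → In y Y → X y) × (∀ x → X x → ¬ conn E Y w x) × conn E Y w w'

  Adj : V → V → Set
  Adj w x = Σ V λ w' → Via w w' × E' w' x

  via⇒conn : ∀ {w w'} → Via w w' → Conn E X w w'
  via⇒conn {w} (Y , Y⊆ , av , p) = proj₂ (conn-closed (λ y → conn E Y w y × Conn E X w y)
    (λ { (a , b) x∉ e y∉ → let a' = ext a e y∉ in a' , ext b e (λ xy → av _ xy a') })
    p (w-start , start (λ xw → av w xw w-start)))
    where
    w-start = start (conn-src p)

  conn⇒via : ∀ {w w'} → Conn E X w w' → Via w w'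
  conn⇒via {w} p with sep w (conn-src p)
  ... | Y , Y⊆ , av = Y , Y⊆ , av , conn-map (λ _ _ e → e) (Y⊆ _) p

  Via? : ∀ w w' → Dec (Via w w')
  Via? w w' = dec-⟺ (conn⇒via , via⇒conn) (conn? E? X? w w')

  Adj? : ∀ w x → Dec (Adj w x)
  Adj? w x = FP.any? (λ w' → Via? w w' ×-dec E'? w' x)

  adj : ∀ {w w' x} → Conn E X w w' → E' w' x → Adj w x
  adj p e = _ , conn⇒via p , e

  lift : ∀ {r} {A : Vec V r} → (∀ {x} → In x A → X x) → ∀ {w w'} → Conn E X w w' → conn E' A w w'
  lift A⊆ = conn-map (λ x∉ _ → E⇒E' x∉) A⊆

  -- Before its first vertex in `X` the path runs in an unchanged component, so that this vertex is
  -- adjacent to the component in the sense of the old data. `F` is the old or the new graph.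
  firstHit : ∀ {F : Graph (suc n')} {A : V → Set} → (∀ {x y} → ¬ X x → F x y → E' x y) → ∀ {w w'} → ¬ X w →
             Conn F A w w' → Conn E X w w' ⊎ Σ V λ y → X y × ¬ A y × Adj w y × Conn F A y w'
  firstHit f w∉ (start a) = inj₁ (start w∉)
  firstHit f w∉ (ext {v} {u} p e a) with firstHit f w∉ p
  ... | inj₂ (y , xy , ay , ad , p') = inj₂ (y , xy , ay , ad , ext p' e a)
  ... | inj₁ p' with X? u
  ...   | yes xu = inj₂ (u , xu , a , adj p' (f (conn-tgt p') e) , start a)
  ...   | no u∉ = inj₁ (ext p' (E'⇒E (conn-tgt p') (f (conn-tgt p') e)) u∉)

  module Connectivity (A : Vec V q) (A⊆ : ∀ {x} → In x A → X x) where

    Hop : V → V → Set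
    Hop x y = (X x × X y) × (¬ In x A × ¬ In y A) × (E' x y ⊎ Σ V λ w → Adj w x × Adj w y)

    private
      -- While the path is outside `X`, the member `x` from which it left and the vertex `w` at
      -- which it entered the outside component are remembered; on return they form a single hop.
      toHops : ∀ {u p} → X u → conn E' A u p →
        (X p × Star Hop u p) ⊎ (¬ X p × Σ V λ x → X x × ¬ In x A × Star Hop u x × Σ V λ w → E' w x × Conn E X w p)
      toHops xu (start a) = inj₁ (xu , ε)
      toHops xu (ext {p} {r} c e a) with toHops xu c | X? r
      ... | inj₁ (xp , s) | yes xr = inj₁ (xr , s ◅◅ ((xp , xr) , (conn-tgt c , a) , inj₁ e) ◅ ε)
      ... | inj₁ (xp , s) | no r∉ = inj₂ (r∉ , p , xp , conn-tgt c , s , r , E'-sym e , start r∉)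
      ... | inj₂ (p∉ , x , xx , x∉A , s , w , e' , d) | yes xr =
        inj₁ (xr , s ◅◅ ((xx , xr) , (x∉A , a) , inj₂ (w , adj (start (conn-src d)) e' , adj d e)) ◅ ε)
      ... | inj₂ (p∉ , x , xx , x∉A , s , w , e' , d) | no r∉ =
        inj₂ (r∉ , x , xx , x∉A , s , w , e' , ext d (E'⇒E p∉ e) r∉)

      fromHops : ∀ {u v w} → conn E' A w u → Star Hop u v → conn E' A w v
      fromHops c ε = c
      fromHops c ((_ , (_ , y∉) , inj₁ e) ◅ s) = fromHops (ext c e y∉) s
      fromHops c ((_ , (x∉ , y∉) , inj₂ (w , (w₁ , a₁ , e₁) , (w₂ , a₂ , e₂))) ◅ s) =
        fromHops (ext (conn-trans (conn-trans (ext c (E'-sym e₁) (conn-tgt w₁~)) (conn-sym E'-sym w₁~)) w₂~) e₂ y∉) s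
        where
        w₁~ = lift {A = A} A⊆ (via⇒conn a₁)
        w₂~ = lift {A = A} A⊆ (via⇒conn a₂)

    hops-correct : ∀ {u v} → X u → X v → (¬ In u A × ¬ In v A × Star Hop u v) ⟺ conn E' A u v
    hops-correct {u} {v} xu xv = (λ (a , _ , s) → fromHops (start a) s) , back
      where
      back : conn E' A u v → ¬ In u A × ¬ In v A × Star Hop u v
      back c with toHops xu c
      ... | inj₁ (_ , s) = conn-src c , conn-tgt c , s
      ... | inj₂ (v∉ , _) = ⊥-elim (v∉ xv)

  module Meeting (Y : Vec V q) where

    FullY : V → Set
    FullY = Full (conn E Y) E Y

    FullY? : DecP FullY
    FullY? = Full? (connᵗ? E? Y) E? Y

    -- The components to be subtracted meet `X` and can thus be listed by their least members in
    -- `X`; their sizes are stored ones.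
    Item : V → Set
    Item x = X x × FullY x × (∀ x' → toℕ x' < toℕ x → X x' → ¬ conn E Y x' x)

    Met : V → Set
    Met w = FullY w × Σ V λ x → X x × conn E Y x w

    Rep : V → V → Set
    Rep w x = Item x × conn E Y x w

    Item? : DecP Item
    Item? x = X? x ×-dec FullY? x ×-dec FP.all? (λ x' → (toℕ x' <? toℕ x) →-dec (X? x' →-dec ¬? (connᵗ? E? Y x' x)))

    Met? : DecP Met
    Met? w = FullY? w ×-dec FP.any? (λ x → X? x ×-dec connᵗ? E? Y x w)

    Rep? : ∀ w x → Dec (Rep w x)
    Rep? w x = Item? x ×-dec connᵗ? E? Y x w

    FullY-conn : ∀ {w w'} → FullY w → conn E Y w w' → FullY w'
    FullY-conn (_ , h) p = conn-tgt p , λ a i → let w'' , c , e = h a i in w'' , conn-trans (conn-sym E-sym p) c , e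

    FullY≢0 : ∀ {w} → FullY w → ¬ toℕ w ≡ 0
    FullY≢0 (w∉ , _) e = w∉ (In-0 Y e)

    Val : V → V → Set
    Val x d = toℕ d ≡ compSize E? Y x

    opaque
      val-ok : ∀ {x} → Item x → ∀ d → Val x d ⟺ (toℕ d ≡ count (λ w → Rep? w x))
      val-ok {x} it@(_ , f , _) d = ≡⟺ refl (count-cong (comp? E? Y x) (λ w → Rep? w x) λ w →
        (λ c → it , InC-conn (FullY≢0 f) c) , (λ (_ , c) → inj₁ c))

      rep-fun : ∀ {w x y} → Rep w x → Rep w y → x ≡ y
      rep-fun {w} {x} {y} ((xx , _ , lx) , cx) ((xy , _ , ly) , cy) = least-unique {P = λ z → X z × conn E Y z w}
        (xx , cx) (λ z l (xz , c) → lx z l xz (conn-trans c (conn-sym E-sym cx)))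
        (xy , cy) (λ z l (xz , c) → ly z l xz (conn-trans c (conn-sym E-sym cy)))

      rep-total : ∀ {w} → Met w → ∃ (Rep w)
      rep-total {w} (f , x , xx , c) with least (λ z → X? z ×-dec connᵗ? E? Y z w) (x , xx , c)
      ... | z , (xz , cz) , l = z , (xz , FullY-conn f (conn-sym E-sym cz) , λ z' l' xz' c' → l z' l' (xz' , conn-trans c' cz)) , cz

      rep-P : ∀ {w x} → Rep w x → Met w
      rep-P ((xx , f , _) , c) = FullY-conn f c , _ , xx , c

    module Sum = SumPath {q = q} {P = Met} {rep = Rep} Item? Met? Rep? proj₁
      rep-P rep-fun rep-total
      (λ (_ , f , _) → FullY≢0 f) (λ (f , _) → FullY≢0 f) Val val-ok

  module Sizes (A : Vec V q) (u : V) (A⊆ : ∀ {x} → In x A → X x) (u∈X : X u) where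

    P : V → Set
    P = InC (conn E' A) E' A u

    Same : V → V → Set
    Same w w' = ∀ y → X y × ¬ toℕ y ≡ 0 → Adj w y ⟺ Adj w' y

    Item : V → Set
    Item w = P w × (X w ⊎ (¬ X w × (∀ w' → toℕ w' < toℕ w → ¬ X w' → ¬ Same w' w)))

    Rep : V → V → Set
    Rep z i = Item i × ((X z × z ≡ i) ⊎ (¬ X z × ¬ X i × Same z i))

    Exact : Vec V q → V → Set
    Exact Y w = ∀ y → In y Y ⟺ (toℕ y ≡ 0 ⊎ (X y × Adj w y))

    -- An item outside X stands for all vertices w' outside X whose component has the same neighbourhood
    -- Y: these are the components adjacent to all of Y except for those that meet X.
    Val : V → V → Set
    Val w d = (X w × One d) ⊎ (¬ X w × Σ (Vec V q) λ Y → Exact Y w × Σ V λ o → toℕ o ≡ 0 × Σ V λ z₁ → Σ V λ z₂ →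
      toℕ z₁ ≡ compSize E? Y o × toℕ z₂ ≡ count (Meeting.Met? Y) × toℕ d + toℕ z₂ ≡ toℕ z₁)

    P? : DecP P
    P? = comp? E'? A u

    Same? : ∀ w w' → Dec (Same w w')
    Same? w w' = FP.all? (λ y → (X? y ×-dec ¬? (toℕ y Data.Nat.≟ 0)) →-dec
      ((Adj? w y →-dec Adj? w' y) ×-dec (Adj? w' y →-dec Adj? w y)))

    Item? : DecP Item
    Item? w = P? w ×-dec (X? w ⊎-dec (¬? (X? w) ×-dec
      FP.all? (λ w' → (toℕ w' <? toℕ w) →-dec (¬? (X? w') →-dec ¬? (Same? w' w)))))

    Rep? : ∀ z i → Dec (Rep z i)
    Rep? z i = Item? i ×-dec ((X? z ×-dec (z FP.≟ i)) ⊎-dec (¬? (X? z) ×-dec ¬? (X? i) ×-dec Same? z i))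

    Same-sym : ∀ {w w'} → Same w w' → Same w' w
    Same-sym s y h = ⟺-sym (s y h)

    Same-trans : ∀ {w w' w''} → Same w w' → Same w' w'' → Same w w''
    Same-trans s s' y h = ⟺-trans (s y h) (s' y h)

    -- With equal neighbourhoods in `X`, `w` and `z` either share a neighbour outside `A` and are
    -- connected through it, or have neighbours in `A` only. The latter is possible only for
    -- `u = 0`, where adjacency to all of `A` carries over.
    P-same : ∀ {w z} → P w → ¬ X w → ¬ X z → Same w z → P z
    P-same {w} {z} (inj₁ c) w∉ z∉ s with firstHit {F = E'} (λ _ e → e) w∉ (conn-sym E'-sym c)
    ... | inj₁ d = ⊥-elim (conn-tgt d u∈X)
    ... | inj₂ (y , xy , y∉A , a , c') with proj₁ (s y (xy , λ e → y∉A (In-0 A e))) a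
    ...   | z' , v , e = inj₁ (conn-trans (conn-sym E'-sym c') (conn-sym E'-sym (ext (lift {A = A} A⊆ (via⇒conn v)) e y∉A)))
    P-same {w} {z} (inj₂ (u≡0 , w∉A , full)) w∉ z∉ s
      with FP.any? (λ y → X? y ×-dec ¬? (In? y A) ×-dec Adj? w y)
    ... | yes (y , xy , y∉A , a@(w' , v , e)) with proj₁ (s y (xy , λ e → y∉A (In-0 A e))) a
    ...   | z' , v' , e' = InC-step {A = A} {w = w} E'-sym (inj₂ (u≡0 , w∉A , full))
      (conn-trans (ext (lift {A = A} A⊆ (via⇒conn v)) e y∉A) (conn-sym E'-sym (ext (lift {A = A} A⊆ (via⇒conn v')) e' y∉A)))
    P-same {w} {z} (inj₂ (u≡0 , w∉A , full)) w∉ z∉ s | no none = inj₂ (u≡0 , (λ i → z∉ (A⊆ i)) , full')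
      where
      full' : ∀ a → In a A × ¬ toℕ a ≡ 0 → Σ V λ z' → conn E' A z z' × E' z' a
      full' a (i , a≢0) with full a (i , a≢0)
      ... | w' , c , e with firstHit {F = E'} (λ _ e → e) w∉ c
      ...   | inj₂ (y , xy , y∉A , ad , _) = ⊥-elim (none (y , xy , y∉A , ad))
      ...   | inj₁ d with proj₁ (s a (A⊆ i , a≢0)) (adj d e)
      ...     | z' , v , e' = z' , lift {A = A} A⊆ (via⇒conn v) , e'

    P≢0 : ∀ {w} → P w → ¬ toℕ w ≡ 0
    P≢0 = InC-nonzero

    -- Every neighbour in `X` belongs to the tuple that separates `w` from `X`; this is why a
    -- neighbourhood fits into a tuple.
    exact-exists : ∀ w → ¬ X w → ∃ λ Y → Exact Y w
    exact-exists w w∉ with sep w w∉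
    ... | Y₀ , Y₀⊆ , av = keep Q? Y₀ , λ y → (λ i → [ inj₁ , (λ (_ , h) → inj₂ h) ]′ (In-keep⁻ Q? Y₀ i))
                                           , [ In-0 (keep Q? Y₀) , (λ h → In-keep⁺ Q? Y₀ (inside h) h) ]′
      where
      Q? : DecP (λ y → X y × Adj w y)
      Q? y = X? y ×-dec Adj? w y
      inside : ∀ {y} → X y × Adj w y → In y Y₀
      inside {y} (xy , w' , v , e) with In? y Y₀
      ... | yes i = i
      ... | no y∉ = ⊥-elim (av y xy (ext (conn-map (λ _ _ e → e) (Y₀⊆ _) c) (E'⇒E (conn-tgt c) e) y∉))
        where c = via⇒conn v

    -- A component of `G - Y` that avoids `X` has no neighbour in `X` outside `Y`. If it is moreover
    -- adjacent to all of `Y`, its neighbourhood is exactly `Y`. This turns the class into a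
    -- difference of old sizes.
    same-iff : ∀ {Y w} → ¬ X w → Exact Y w → ∀ z → (¬ X z × Same z w) ⟺ (Meeting.FullY Y z × ¬ Meeting.Met Y z)
    same-iff {Y} {w} w∉ exa z = to , from
      where
      open Meeting Y using (FullY; Met)
      Y⊆ : ∀ {y} → In y Y → X y
      Y⊆ {y} i = [ 0∈X , proj₁ ]′ (proj₁ (exa y) i)
      to : ¬ X z × Same z w → FullY z × ¬ Met z
      to (z∉ , s) = ((λ i → z∉ (Y⊆ i)) , full) , λ { (_ , x , xx , c) → unmet x xx (conn-sym E-sym c) }
        where
        full : ∀ a → In a Y × ¬ toℕ a ≡ 0 → Σ V λ z' → conn E Y z z' × E z' a
        full a (i , a≢0) with proj₁ (exa a) i
        ... | inj₁ e = ⊥-elim (a≢0 e)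
        ... | inj₂ (xa , ad) with proj₂ (s a (xa , a≢0)) ad
        ...   | z' , v , e = z' , conn-map (λ _ _ e → e) Y⊆ (via⇒conn v) , E'⇒E (conn-tgt (via⇒conn v)) e
        unmet : ∀ x → X x → ¬ conn E Y z x
        unmet x xx c with firstHit {F = E} (λ h e → E⇒E' h e) z∉ c
        ... | inj₁ d = conn-tgt d xx
        ... | inj₂ (y , xy , y∉ , ad , _) = y∉ (proj₂ (exa y) (inj₂ (xy , proj₁ (s y (xy , λ e → y∉ (In-0 Y e))) ad)))
      from : FullY z × ¬ Met z → ¬ X z × Same z w
      from (f@(z∉Y , full) , nm) = z∉ , λ y (xy , y≢0) → there' y xy y≢0 , back y xy y≢0
        where
        av : ∀ x → X x → ¬ conn E Y z x
        av x xx c = nm (f , x , xx , conn-sym E-sym c)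
        z∉ : ¬ X z
        z∉ xz = av z xz (start z∉Y)
        inX : ∀ {z'} → conn E Y z z' → Conn E X z z'
        inX c = via⇒conn (Y , (λ y i → Y⊆ i) , av , c)
        there' : ∀ y → X y → ¬ toℕ y ≡ 0 → Adj z y → Adj w y
        there' y xy y≢0 (z' , v , e) with In? y Y
        ... | yes i = [ (λ e → ⊥-elim (y≢0 e)) , proj₂ ]′ (proj₁ (exa y) i)
        ... | no y∉ = ⊥-elim (av y xy (ext (conn-map (λ _ _ e → e) Y⊆ (via⇒conn v)) (E'⇒E (conn-tgt (via⇒conn v)) e) y∉))
        back : ∀ y → X y → ¬ toℕ y ≡ 0 → Adj w y → Adj z y
        back y xy y≢0 ad with full y (proj₂ (exa y) (inj₂ (xy , ad)) , y≢0)
        ... | z' , c , e = adj (inX c) (E⇒E' (conn-tgt (inX c)) e)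

    opaque
      val-ok : ∀ {w} → Item w → ∀ d → Val w d ⟺ (toℕ d ≡ count (λ z → Rep? z w))
      val-ok {w} it@(pw , inj₁ xw) d = (λ v → trans (one v) (sym cnt)) , (λ e → inj₁ (xw , proj₂ (One-correct d) (trans e cnt)))
        where
        cnt : count (λ z → Rep? z w) ≡ 1
        cnt = count-one (λ z → Rep? z w) w λ z →
          (λ { (_ , inj₁ (_ , e)) → e ; (_ , inj₂ (_ , w∉ , _)) → ⊥-elim (w∉ xw) })
          , (λ { refl → it , inj₁ (xw , refl) })
        one : Val w d → toℕ d ≡ 1
        one (inj₁ (_ , o)) = proj₁ (One-correct d) o
        one (inj₂ (w∉ , _)) = ⊥-elim (w∉ xw)
      val-ok {w} it@(pw , inj₂ (w∉ , _)) d = to , from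
        where
        module _ (Y : Vec V q) (exa : Exact Y w) where
          open Meeting Y using (FullY; FullY?; Met; Met?)
          full-split : count FullY? ≡ count (λ z → Rep? z w) + count Met?
          full-split = count-⊎ (λ z → Rep? z w) Met? FullY?
            (λ { z (_ , inj₁ (xz , refl)) _ → w∉ xz ; z (_ , inj₂ (z∉ , _ , s)) m → proj₂ (proj₁ (same-iff w∉ exa z) (z∉ , s)) m })
            (λ z → split z , [ (λ { (_ , inj₁ (xz , refl)) → ⊥-elim (w∉ xz) ; (_ , inj₂ (z∉ , _ , s)) → proj₁ (proj₁ (same-iff w∉ exa z) (z∉ , s)) }) , proj₁ ]′)
            where
            split : ∀ z → FullY z → Rep z w ⊎ Met z
            split z f with Met? z
            ... | yes m = inj₂ m
            ... | no nm = let z∉ , s = proj₂ (same-iff w∉ exa z) (f , nm) in inj₁ (it , inj₂ (z∉ , w∉ , s))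
          full-size : ∀ {o} → toℕ o ≡ 0 → compSize E? Y o ≡ count FullY?
          full-size {o} e = count-cong (comp? E? Y o) FullY? λ z →
            [ (λ c → ⊥-elim (conn-src c (In-0 Y e))) , proj₂ ]′ , (λ f → inj₂ (e , f))
        to : Val w d → toℕ d ≡ count (λ z → Rep? z w)
        to (inj₁ (xw , _)) = ⊥-elim (w∉ xw)
        to (inj₂ (_ , Y , exa , o , e , z₁ , z₂ , e₁ , e₂ , e₃)) = +-cancelʳ-≡ (toℕ z₂) _ _
          (trans e₃ (trans e₁ (trans (full-size Y exa e) (trans (full-split Y exa) (cong (count (λ z → Rep? z w) +_) (sym e₂))))))
        from : toℕ d ≡ count (λ z → Rep? z w) → Val w d
        from e = choose (exact-exists w w∉)
          where
          choose : (∃ λ Y → Exact Y w) → Val w d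
          choose (Y , exa) = inj₂ (w∉ , Y , exa , zero , refl , fromℕ< a<n , fromℕ< b<n , FP.toℕ-fromℕ< a<n , FP.toℕ-fromℕ< b<n
                , trans (cong₂ _+_ e (FP.toℕ-fromℕ< b<n)) (trans (sym (trans (full-size Y exa refl) (full-split Y exa))) (sym (FP.toℕ-fromℕ< a<n))))
              where
              a<n : compSize E? Y zero < suc n'
              a<n = count-nz (comp? E? Y zero) (λ z → InC-nonzero)
              b<n : count (Meeting.Met? Y) < suc n'
              b<n = count-nz (Meeting.Met? Y) (λ z (f , _) → Meeting.FullY≢0 Y f)

      rep-fun : ∀ {z i j} → Rep z i → Rep z j → i ≡ j
      rep-fun (_ , inj₁ (_ , e)) (_ , inj₁ (_ , e')) = trans (sym e) e'
      rep-fun (_ , inj₁ (xz , _)) (_ , inj₂ (z∉ , _)) = ⊥-elim (z∉ xz)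
      rep-fun (_ , inj₂ (z∉ , _)) (_ , inj₁ (xz , _)) = ⊥-elim (z∉ xz)
      rep-fun ((_ , inj₁ xi) , inj₂ (_ , i∉ , _)) (_ , inj₂ _) = ⊥-elim (i∉ xi)
      rep-fun (_ , inj₂ _) ((_ , inj₁ xj) , inj₂ (_ , j∉ , _)) = ⊥-elim (j∉ xj)
      rep-fun {z} ((_ , inj₂ (_ , li)) , inj₂ (z∉ , i∉ , s)) ((_ , inj₂ (_ , lj)) , inj₂ (_ , j∉ , s')) =
        least-unique {P = λ x → ¬ X x × Same x z}
          (i∉ , Same-sym s) (λ x l (x∉ , t) → li x l x∉ (Same-trans t s))
          (j∉ , Same-sym s') (λ x l (x∉ , t) → lj x l x∉ (Same-trans t s'))

      rep-total : ∀ {z} → P z → ∃ (Rep z)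
      rep-total {z} pz with X? z
      ... | yes xz = z , (pz , inj₁ xz) , inj₁ (xz , refl)
      ... | no z∉ with least (λ x → ¬? (X? x) ×-dec Same? x z) (z , z∉ , λ y _ → ⟺-refl)
      ...   | i , (i∉ , s) , l = i , (P-same pz z∉ i∉ (Same-sym s) , inj₂ (i∉ , λ x l' x∉ t → l x l' (x∉ , Same-trans t s)))
                              , inj₂ (z∉ , i∉ , Same-sym s)

      rep-P : ∀ {z i} → Rep z i → P z
      rep-P ((p , _) , inj₁ (_ , refl)) = p
      rep-P ((p , _) , inj₂ (z∉ , i∉ , s)) = P-same p i∉ z∉ (Same-sym s)

    module Sum = SumPath {q = q} {P = P} {rep = Rep} Item? P? Rep? proj₁ rep-P rep-fun rep-total
      (λ (p , _) → P≢0 p) P≢0 Val val-ok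

-- Polynomial bounds

-- The base `2 * ℓ` is at least 2 even for `ℓ = 1`, so that constants and sums are absorbed by the
-- exponent.
PolyBounded : (ℕ → ℕ) → Set
PolyBounded f = ∃ λ e → ∀ ℓ → 1 ≤ ℓ → f ℓ ≤ (2 * ℓ) ^ e

1≤2ℓ : ∀ {ℓ} → 1 ≤ ℓ → 1 ≤ 2 * ℓ
1≤2ℓ h = ≤-trans h (m≤m+n _ _)

2≤2ℓ : ∀ {ℓ} → 1 ≤ ℓ → 2 ≤ 2 * ℓ
2≤2ℓ h = *-monoʳ-≤ 2 h

^-mono-exp : ∀ x → 1 ≤ x → ∀ {e e'} → e ≤ e' → x ^ e ≤ x ^ e'
^-mono-exp (suc x) _ = ^-monoʳ-≤ (suc x)

poly-id : PolyBounded (λ ℓ → ℓ)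
poly-id = 1 , λ ℓ h → ≤-trans (m≤m+n ℓ _) (≤-reflexive (sym (*-identityʳ (2 * ℓ))))

n≤2^n : ∀ n → n ≤ 2 ^ n
n≤2^n zero    = z≤n
n≤2^n (suc n) = ≤-trans (+-mono-≤ (m^n>0 2 n) (n≤2^n n)) (≤-reflexive (cong (2 ^ n +_) (sym (+-identityʳ (2 ^ n)))))

poly-const : ∀ c → PolyBounded (λ _ → c)
poly-const c = c , λ ℓ h → ≤-trans (n≤2^n c) (^-monoˡ-≤ c (2≤2ℓ h))

poly-+ : ∀ {f g} → PolyBounded f → PolyBounded g → PolyBounded (λ ℓ → f ℓ + g ℓ)
poly-+ {f} {g} (e , p) (e' , q) = suc (e + e') , λ ℓ h → begin
  f ℓ + g ℓ                                       ≤⟨ +-mono-≤ (p ℓ h) (q ℓ h) ⟩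
  (2 * ℓ) ^ e + (2 * ℓ) ^ e'                      ≤⟨ +-mono-≤ (^-mono-exp _ (1≤2ℓ h) (m≤m+n e e')) (^-mono-exp _ (1≤2ℓ h) (m≤n+m e' e)) ⟩
  (2 * ℓ) ^ (e + e') + (2 * ℓ) ^ (e + e')         ≡⟨ cong ((2 * ℓ) ^ (e + e') +_) (+-identityʳ _) ⟨
  2 * (2 * ℓ) ^ (e + e')                          ≤⟨ *-monoˡ-≤ ((2 * ℓ) ^ (e + e')) (2≤2ℓ h) ⟩
  (2 * ℓ) ^ suc (e + e')                          ∎
  where open ≤-Reasoning

poly-* : ∀ {f g} → PolyBounded f → PolyBounded g → PolyBounded (λ ℓ → f ℓ * g ℓ)
poly-* (e , p) (e' , q) = e + e' , λ ℓ h → ≤-trans (*-mono-≤ (p ℓ h) (q ℓ h)) (≤-reflexive (sym (^-distribˡ-+-* (2 * ℓ) e e')))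

poly-^ : ∀ {f} → PolyBounded f → ∀ q → PolyBounded (λ ℓ → f ℓ ^ q)
poly-^ p zero    = poly-const 1
poly-^ p (suc q) = poly-* p (poly-^ p q)

-- With ℓ ≤ 2 ^ ⌈log₂ ℓ⌉ a polynomial in ℓ is at most 2 to a linear function of ⌈log₂ ℓ⌉.
poly-log : ∀ {f} ((e , _) : PolyBounded f) → ∀ ℓ → 1 ≤ ℓ → f ℓ ≤ 2 ^ ((1 + ⌈log₂ ℓ ⌉) * e)
poly-log (e , p) ℓ h = ≤-trans (p ℓ h) (≤-trans (^-monoˡ-≤ e (*-monoʳ-≤ 2 (n≤2^⌈log₂n⌉ ℓ))) (≤-reflexive (^-*-assoc 2 (1 + ⌈log₂ ℓ ⌉) e)))

-- The dynamic program

Fm-cong : ∀ {n Voc sig} {S S' : TStr n Voc sig} → (∀ R ρ → S R ρ ⟺ S' R ρ) →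
          ∀ {Γ} (φ : Fm Voc sig Γ) ρ → ⟪ φ ⟫ S ρ ⟺ ⟪ φ ⟫ S' ρ
Fm-cong h (atom R is)  ρ = h R _
Fm-cong h (i ≐ j)      ρ = ⟺-refl
Fm-cong h (i ≺ j)      ρ = ⟺-refl
Fm-cong h (i ≼ j)      ρ = ⟺-refl
Fm-cong h (add i j l)  ρ = ⟺-refl
Fm-cong h (isZ i)      ρ = ⟺-refl
Fm-cong h (i ∊ a)      ρ = ⟺-refl
Fm-cong h (lex a b)    ρ = ⟺-refl
Fm-cong h (~ φ)        ρ = ¬-cong (Fm-cong h φ ρ)
Fm-cong h (φ ∧ ψ)      ρ = ×-cong (Fm-cong h φ ρ) (Fm-cong h ψ ρ)
Fm-cong h (φ ∨ ψ)      ρ = ⊎-cong (Fm-cong h φ ρ) (Fm-cong h ψ ρ)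
Fm-cong h (φ ⇒ ψ)      ρ with Fm-cong h φ ρ | Fm-cong h ψ ρ
... | f , g | f' , g' = (λ k → f' ∘ k ∘ g) , (λ k → g' ∘ k ∘ f)
Fm-cong h (∃' φ)       ρ = Σ-cong λ x → Fm-cong h φ (x , ρ)
Fm-cong h (∀' φ)       ρ = Π-cong λ x → Fm-cong h φ (x , ρ)

-- Index 0 marks the data stored before the change, a prime the data after it, which are read off the
-- closures held in the working relation; met counts the vertices of the components cut off by a tuple
-- that contain a member of the torso.
data Stored : Set where
  edgeᵇ changeᵇ edge₀ᵇ conn₀ᵇ size₀ᵇ closure₀ᵇ workᵇ : Stored

data Voc : Set where
  base : Stored → Voc
  conn' met size' node' : Voc

pattern edge'    = base edgeᵇ
pattern change   = base changeᵇ
pattern edge₀    = base edge₀ᵇ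
pattern conn₀    = base conn₀ᵇ
pattern size₀    = base size₀ᵇ
pattern closure₀ = base closure₀ᵇ
pattern work     = base workᵇ

reach-map : ∀ {S : Set} {R R' : S → S → Set} → (∀ {x y} → R x y → R' x y) → ∀ {j x y} → ReachIn R j x y → ReachIn R' j x y
reach-map f here     = here
reach-map f (up r p) = up (f r) (reach-map f p)

star→reach : ∀ {S : Set} {R : S → S → Set} {x y} → Star R x y → ∃ λ j → ReachIn R j x y
star→reach ε       = 0 , here
star→reach (r ◅ s) = let j , p = star→reach s in suc j , up r p

tuples : {A : Set} → List A → ∀ q → List (Vec A q)
tuples L zero    = [] ∷ []
tuples L (suc q) = L.cartesianProductWith _∷_ L (tuples L q)

length-tuples : {A : Set} (L : List A) → ∀ q → length (tuples L q) ≡ length L ^ q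
length-tuples L zero    = refl
length-tuples L (suc q) = trans (length-product L (tuples L q)) (cong (length L *_) (length-tuples L q))
  where
  length-product : ∀ {A B C : Set} {f : A → B → C} (xs : List A) (ys : List B) → length (L.cartesianProductWith f xs ys) ≡ length xs * length ys
  length-product []       ys = refl
  length-product {f = f} (x ∷ xs) ys = trans (LP.length-++ (L.map (f x) ys)) (cong₂ _+_ (LP.length-map (f x) ys) (length-product xs ys))

∈-tuples : ∀ {n q} (L : List (Fin n)) (Y : Vec (Fin n) q) → (∀ y → In y Y → y ∈ L) → Y ∈ tuples L q
∈-tuples L []      h = here refl
∈-tuples L (y ∷ Y) h = ∈-cartesianProductWith⁺ _∷_ (h y (inj₁ refl)) (∈-tuples L Y (λ z i → h z (inj₂ i)))

-- On a domain of two elements only zero and nonzero can be told apart, so selecting one of four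
-- closures takes two elements.
data Phase {n : ℕ} (t₁ t₂ : Fin n) (P₁ P₂ P₃ P₄ : Set) : Set where
  phase₁ :   toℕ t₁ ≡ 0 →   toℕ t₂ ≡ 0 → P₁ → Phase t₁ t₂ P₁ P₂ P₃ P₄
  phase₂ : ¬ toℕ t₁ ≡ 0 →   toℕ t₂ ≡ 0 → P₂ → Phase t₁ t₂ P₁ P₂ P₃ P₄
  phase₃ :   toℕ t₁ ≡ 0 → ¬ toℕ t₂ ≡ 0 → P₃ → Phase t₁ t₂ P₁ P₂ P₃ P₄
  phase₄ : ¬ toℕ t₁ ≡ 0 → ¬ toℕ t₂ ≡ 0 → P₄ → Phase t₁ t₂ P₁ P₂ P₃ P₄

Phase-map : ∀ {n} {t₁ t₂ : Fin n} {P₁ P₂ P₃ P₄ Q₁ Q₂ Q₃ Q₄ : Set} → (P₁ → Q₁) → (P₂ → Q₂) →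
            (toℕ t₁ ≡ 0 → ¬ toℕ t₂ ≡ 0 → P₃ → Q₃) → (¬ toℕ t₁ ≡ 0 → ¬ toℕ t₂ ≡ 0 → P₄ → Q₄) →
            Phase t₁ t₂ P₁ P₂ P₃ P₄ → Phase t₁ t₂ Q₁ Q₂ Q₃ Q₄
Phase-map f₁ f₂ f₃ f₄ (phase₁ a b p) = phase₁ a b (f₁ p)
Phase-map f₁ f₂ f₃ f₄ (phase₂ a b p) = phase₂ a b (f₂ p)
Phase-map f₁ f₂ f₃ f₄ (phase₃ a b p) = phase₃ a b (f₃ a b p)
Phase-map f₁ f₂ f₃ f₄ (phase₄ a b p) = phase₄ a b (f₄ a b p)

Phase-cong : ∀ {n} {t₁ t₂ : Fin n} {P₁ P₂ P₃ P₄ Q₁ Q₂ Q₃ Q₄ : Set} → P₁ ⟺ Q₁ → P₂ ⟺ Q₂ →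
             (toℕ t₁ ≡ 0 → ¬ toℕ t₂ ≡ 0 → P₃ ⟺ Q₃) → (¬ toℕ t₁ ≡ 0 → ¬ toℕ t₂ ≡ 0 → P₄ ⟺ Q₄) →
             Phase t₁ t₂ P₁ P₂ P₃ P₄ ⟺ Phase t₁ t₂ Q₁ Q₂ Q₃ Q₄
Phase-cong h₁ h₂ h₃ h₄ =
    Phase-map (proj₁ h₁) (proj₁ h₂) (λ a b → proj₁ (h₃ a b)) (λ a b → proj₁ (h₄ a b))
  , Phase-map (proj₂ h₁) (proj₂ h₂) (λ a b → proj₂ (h₃ a b)) (λ a b → proj₂ (h₄ a b))

TD-cong : ∀ {n} {E : Graph n} {X : Set} {Node Node' : X → Set} {Par Par' : X → X → Set} {Bag Bag' : X → Fin n → Set} {root : X} →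
  (∀ x → Node x ⟺ Node' x) → (∀ x y → Par x y ⟺ Par' x y) → (∀ x v → Bag x v ⟺ Bag' x v) →
  IsTreeDecomposition E Node Par Bag root → IsTreeDecomposition E Node' Par' Bag' root
TD-cong {Par = Par} {Par'} {Bag} {Bag'} hN hP hB td = record
  { par-node      = λ p → let a , c = par-node (proj₂ (hP _ _) p) in proj₁ (hN _) a , proj₁ (hN _) c
  ; par-fun       = λ p q → par-fun (proj₂ (hP _ _) p) (proj₂ (hP _ _) q)
  ; root-node     = proj₁ (hN _) root-node
  ; root-noParent = λ p → root-noParent (proj₂ (hP _ _) p)
  ; reach-root    = λ a → let j , p = reach-root (proj₂ (hN _) a) in j , reach-map (proj₁ (hP _ _)) p
  ; bag-node      = λ c → proj₁ (hN _) (bag-node (proj₂ (hB _ _) c))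
  ; cover-vertex  = λ v → let t , c = cover-vertex v in t , proj₁ (hB _ _) c
  ; cover-edge    = λ e → let t , c , c' = cover-edge e in t , proj₁ (hB _ _) c , proj₁ (hB _ _) c'
  ; connected     = λ c c' → walk (connected (proj₂ (hB _ _) c) (proj₂ (hB _ _) c'))
  }
  where
  open IsTreeDecomposition td
  walk : ∀ {v s t} → Walk Par (λ x → Bag x v) s t → Walk Par' (λ x → Bag' x v) s t
  walk (stop p)     = stop (proj₁ (hB _ _) p)
  walk (down p q w) = down (proj₁ (hB _ _) p) (proj₁ (hP _ _) q) (walk w)
  walk (upw p q w)  = upw (proj₁ (hB _ _) p) (proj₁ (hP _ _) q) (walk w)

ustr? : ∀ (P : DynProg) {n} {E D : Graph n} {A : Run.AuxState P n} {W : Vec (Fin n) (DynProg.w P) → Set} →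
        (∀ x y → Dec (E x y)) → (∀ x y → Dec (D x y)) → (∀ s t → Dec (A s t)) → (∀ t → Dec (W t)) →
        ∀ s t → Dec (Run.ustr P E D A W s t)
ustr? P E? D? A? W? edge    (x ∷ y ∷ []) = E? x y
ustr? P E? D? A? W? chg     (x ∷ y ∷ []) = D? x y
ustr? P E? D? A? W? wrk     t = W? t
ustr? P E? D? A? W? (old s) t = A? s t

phaseForm : ∀ {Sym ar v} → Fin v → Fin v → (φ₁ φ₂ φ₃ φ₄ : Form Sym ar v) → Form Sym ar v
phaseForm t₁ t₂ φ₁ φ₂ φ₃ φ₄ =
  or (and (zeroF t₁)       (and (zeroF t₂)       φ₁))
 (or (and (neg (zeroF t₁)) (and (zeroF t₂)       φ₂))
 (or (and (zeroF t₁)       (and (neg (zeroF t₂)) φ₃))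
     (and (neg (zeroF t₁)) (and (neg (zeroF t₂)) φ₄))))

phaseForm-correct : ∀ {Sym ar n v} {A : Structure n Sym ar} t₁ t₂ (φ₁ φ₂ φ₃ φ₄ : Form Sym ar v) (ρ : Vec (Fin n) v) →
  ⟦ phaseForm t₁ t₂ φ₁ φ₂ φ₃ φ₄ ⟧ A ρ ⟺ Phase (lookup ρ t₁) (lookup ρ t₂) (⟦ φ₁ ⟧ A ρ) (⟦ φ₂ ⟧ A ρ) (⟦ φ₃ ⟧ A ρ) (⟦ φ₄ ⟧ A ρ)
phaseForm-correct {A = A} t₁ t₂ φ₁ φ₂ φ₃ φ₄ ρ with zeroF-correct {A = A} ρ t₁ | zeroF-correct {A = A} ρ t₂
... | f , g | h , k = (λ { (inj₁ (a , c , p)) → phase₁ (f a) (h c) p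
                         ; (inj₂ (inj₁ (na , c , p))) → phase₂ (na ∘ g) (h c) p
                         ; (inj₂ (inj₂ (inj₁ (a , nc , p)))) → phase₃ (f a) (nc ∘ k) p
                         ; (inj₂ (inj₂ (inj₂ (na , nc , p)))) → phase₄ (na ∘ g) (nc ∘ k) p })
                    , (λ { (phase₁ a c p) → inj₁ (g a , k c , p)
                         ; (phase₂ na c p) → inj₂ (inj₁ (na ∘ f , k c , p))
                         ; (phase₃ a nc p) → inj₂ (inj₂ (inj₁ (g a , nc ∘ h , p)))
                         ; (phase₄ na nc p) → inj₂ (inj₂ (inj₂ (na ∘ f , nc ∘ h , p))) })

InΔ? : ∀ {n} (L : List (Fin n × Fin n)) u v → Dec (InΔ L u v)
InΔ? L u v = mem? (u , v) ⊎-dec mem? (v , u)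
  where
  mem? : ∀ e → Dec (e ∈ L)
  mem? e = Any.any? (PP.≡-dec FP._≟_ FP._≟_ e) L

InΔ-irr : ∀ {n} {L : List (Fin n × Fin n)} → All (λ e → ¬ proj₁ e ≡ proj₂ e) L → ∀ {x} → ¬ InΔ L x x
InΔ-irr ne (inj₁ i) = All.lookup ne i refl
InΔ-irr ne (inj₂ i) = All.lookup ne i refl

InΔ-sym : ∀ {n} {L : List (Fin n × Fin n)} {x y} → InΔ L x y → InΔ L y x
InΔ-sym (inj₁ i) = inj₂ i
InΔ-sym (inj₂ i) = inj₁ i

endpoints : ∀ {n} → List (Fin n × Fin n) → List (Fin n)
endpoints L = L.map proj₁ L L.++ L.map proj₂ L

endpoints-length : ∀ {n} (L : List (Fin n × Fin n)) {B} → length L ≤ B → length (endpoints L) ≤ B + B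
endpoints-length L l = ≤-trans (≤-reflexive (trans (LP.length-++ (L.map proj₁ L)) (cong₂ _+_ (LP.length-map proj₁ L) (LP.length-map proj₂ L))))
  (+-mono-≤ l l)

InΔ-endpoints : ∀ {n} {L : List (Fin n × Fin n)} {x y} → InΔ L x y → x ∈ endpoints L
InΔ-endpoints (inj₁ i) = ∈-++⁺ˡ (∈-map⁺ proj₁ i)
InΔ-endpoints {L = L} (inj₂ i) = ∈-++⁺ʳ (L.map proj₁ L) (∈-map⁺ proj₂ i)

-- The formulas of the program

module Width (k : ℕ) where

  b : ℕ
  b = ss k

  -- A tuple of the working relation is a flag, parameters that are fixed along a path, and two
  -- states. Flag 0 marks the closure, any other flag the copy of the relation being closed.
  params state Ω : Ctx
  params = elt ∷ elt ∷ tup b ∷ tup b ∷ elt ∷ elt ∷ []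
  state  = elt ∷ tup b ∷ elt ∷ []
  Ω = elt ∷ elt ∷ elt ∷ tup b ∷ tup b ∷ elt ∷ elt ∷ elt ∷ tup b ∷ elt ∷ elt ∷ tup b ∷ elt ∷ []

  ΩΦ : Ctx
  ΩΦ = elt ∷ elt ∷ tup b ∷ tup b ∷ elt ∷ elt ∷ elt ∷ tup b ∷ elt ∷ elt ∷ tup b ∷ elt ∷ []

  sig : Voc → Ctx
  sig edge'    = elt ∷ elt ∷ []
  sig change   = elt ∷ elt ∷ []
  sig edge₀    = elt ∷ elt ∷ []
  sig conn₀    = tup b ∷ elt ∷ elt ∷ []
  sig size₀    = tup b ∷ elt ∷ elt ∷ []
  sig closure₀ = elt ∷ elt ∷ []
  sig work     = Ω
  sig conn'    = tup b ∷ elt ∷ elt ∷ []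
  sig met      = tup b ∷ elt ∷ tup b ∷ elt ∷ []
  sig size'    = tup b ∷ elt ∷ elt ∷ []
  sig node'    = elt ∷ tup b ∷ []

  F : Ctx → Set
  F = Fm Voc sig

  -- The torso is generated by the touched vertices and by these variables of the query.
  XV : Ctx → Set
  XV Γ = (Γ ∋ tup b) × (Γ ∋ elt) × (Γ ∋ elt)

  wk : ∀ {Γ σ} → XV Γ → XV (σ ∷ Γ)
  wk (A , u , v) = vs A , vs u , vs v

  Conn3 : Set
  Conn3 = ∀ {Γ} → Γ ∋ tup b → Γ ∋ elt → Γ ∋ elt → F Γ

  Edge2 : Set
  Edge2 = ∀ {Γ} → Γ ∋ elt → Γ ∋ elt → F Γ

  cn₀ cn' : Conn3
  cn₀ A u v = atom conn₀ (A , u , v , tt)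
  cn' A u v = atom conn' (A , u , v , tt)

  e₀ e' : Edge2
  e₀ x y = atom edge₀ (x , y , tt)
  e' x y = atom edge' (x , y , tt)

  xF : ∀ {Γ} → XV Γ → Γ ∋ elt → F Γ
  xF (A , u , v) y = isZ y ∨ (∃' (((∃' atom change (vs vz , vz , tt)) ∨ vz ∊ vs A ∨ vz ≐ vs u ∨ vz ≐ vs v) ∧ atom closure₀ (vz , vs y , tt)))

  viaF : ∀ {Γ} → XV Γ → Γ ∋ elt → Γ ∋ elt → F Γ
  viaF p w w' = ∃'_ {σ = tup b} ((∀' (vz ∊ vs vz ⇒ xF (wk (wk p)) vz)) ∧ (∀' (xF (wk (wk p)) vz ⇒ ~ cn₀ (vs vz) (vs (vs w)) vz)) ∧ cn₀ vz (vs w) (vs w'))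

  adjF : ∀ {Γ} → XV Γ → Γ ∋ elt → Γ ∋ elt → F Γ
  adjF p w x = ∃' (viaF (wk p) (vs w) vz ∧ e' vz (vs x))

  hopF : ∀ {Γ} → XV Γ → Γ ∋ elt → Γ ∋ elt → F Γ
  hopF p@(A , _) x y = (xF p x ∧ xF p y) ∧ (~ (x ∊ A) ∧ ~ (y ∊ A)) ∧ (e' x y ∨ (∃' (adjF (wk p) vz (vs x) ∧ adjF (wk p) vz (vs y))))

  fullF : Conn3 → Edge2 → ∀ {Γ} → Γ ∋ tup b → Γ ∋ elt → F Γ
  fullF c e A w = ~ (w ∊ A) ∧ (∀' (vz ∊ vs A ∧ ~ isZ vz ⇒ (∃' (c (vs (vs A)) (vs (vs w)) vz ∧ e vz (vs vz)))))

  compF : Conn3 → Edge2 → ∀ {Γ} → Γ ∋ tup b → Γ ∋ elt → Γ ∋ elt → F Γ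
  compF c e A u w = c A u w ∨ (isZ u ∧ fullF c e A w)

  metItemF : ∀ {Γ} → XV Γ → Γ ∋ tup b → Γ ∋ elt → F Γ
  metItemF p Y x = xF p x ∧ fullF cn₀ e₀ Y x ∧ (∀' (vz ≺ vs x ⇒ xF (wk p) vz ⇒ ~ cn₀ (vs Y) vz (vs x)))

  stepF : ∀ {Γ} → (item : ∀ {Δ} → Args Δ Γ → Δ ∋ elt → F Δ) → (val : ∀ {Δ} → Args Δ Γ → Δ ∋ elt → Δ ∋ elt → F Δ) →
          ∀ {Δ} → Args Δ Γ → (∀ {σ} → Args (σ ∷ Δ) Γ) → Args Δ state → Args Δ state → F Δ
  stepF item val g g↑ (w , Z , z , _) (w' , Z' , z' , _) = Z ≐ Z' ∧ w ≺ w' ∧ item g w'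
    ∧ (∀' (vs w ≺ vz ∧ vz ≺ vs w' ⇒ ~ item g↑ vz)) ∧ (∃' (val g↑ (vs w') vz ∧ add (vs z) vz (vs z')))

  sameF : ∀ {Γ} → XV Γ → Γ ∋ elt → Γ ∋ elt → F Γ
  sameF p w w' = ∀' (xF (wk p) vz ∧ ~ isZ vz ⇒
    (adjF (wk p) (vs w) vz ⇒ adjF (wk p) (vs w') vz) ∧ (adjF (wk p) (vs w') vz ⇒ adjF (wk p) (vs w) vz))

  sizeItemF : ∀ {Γ} → XV Γ → Γ ∋ elt → F Γ
  sizeItemF p@(A , u , _) w = compF cn' e' A u w
    ∧ (xF p w ∨ (~ xF p w ∧ (∀' (vz ≺ vs w ⇒ ~ xF (wk p) vz ⇒ ~ sameF (wk p) vz (vs w)))))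

  exactF : ∀ {Γ} → XV Γ → Γ ∋ tup b → Γ ∋ elt → F Γ
  exactF p Y w = ∀' ((vz ∊ vs Y ⇒ isZ vz ∨ (xF (wk p) vz ∧ adjF (wk p) (vs w) vz))
                   ∧ (isZ vz ∨ (xF (wk p) vz ∧ adjF (wk p) (vs w) vz) ⇒ vz ∊ vs Y))

  oneF : ∀ {Γ} → Γ ∋ elt → F Γ
  oneF d = ∃' (isZ vz ∧ vz ≺ vs d ∧ (∀' (vz ≺ vs (vs d) ⇒ isZ vz)))

  sizeValF : ∀ {Γ} → XV Γ → Γ ∋ elt → Γ ∋ elt → F Γ
  sizeValF p@(A , u , _) w d = (xF p w ∧ oneF d) ∨ (~ xF p w ∧ (∃'_ {σ = tup b} (exactF (wk p) vz (vs w) ∧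
    (∃' (isZ vz ∧ (∃' (∃' (atom size₀ (vs (vs (vs vz)) , vs (vs vz) , vs vz , tt)
      ∧ atom met (vs (vs (vs (vs A))) , vs (vs (vs (vs u))) , vs (vs (vs vz)) , vz , tt)
      ∧ add (vs (vs (vs (vs d)))) vz (vs vz)))))))))

  boundaryF : ∀ {Γ} → Γ ∋ tup b → Γ ∋ elt → Γ ∋ elt → F Γ
  boundaryF Z v z = z ∊ Z ∧ (∃' (compF cn' e' (vs Z) (vs v) vz ∧ e' vz (vs z)))

  halfF : ∀ {Γ} → Γ ∋ tup b → Γ ∋ elt → Γ ∋ tup b → Γ ∋ elt → F Γ
  halfF Z' w Z v = ∃' (∃' (∃' (atom size' (vs (vs (vs Z')) , vs (vs (vs w)) , vs (vs vz) , tt) ∧ add (vs (vs vz)) (vs (vs vz)) (vs vz)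
    ∧ atom size' (vs (vs (vs Z)) , vs (vs (vs v)) , vz , tt) ∧ vs vz ≼ vz)))

  goodF : ∀ {Γ} → Γ ∋ tup b → Γ ∋ elt → Γ ∋ tup b → F Γ
  goodF Z v Z' =
      (∀' (boundaryF (vs Z) (vs v) vz ⇒ vz ∊ vs Z'))
    ∧ (∀' (vz ∊ vs Z' ⇒ vz ∊ vs Z ∨ compF cn' e' (vs Z) (vs v) vz))
    ∧ (∀' (compF cn' e' (vs Z) (vs v) vz ∧ ~ (vz ∊ vs Z') ⇒ halfF (vs Z') vz (vs Z) (vs v)))
    ∧ (∀' (compF cn' e' (vs Z) (vs v) vz ∧ ~ (vz ∊ vs Z') ⇒ (∃'_ {σ = tup (mm k)}
        (∀' (vz ∊ vs (vs (vs Z')) ∧ (∃' (cn' (vs (vs (vs (vs Z')))) (vs (vs (vs vz))) vz ∧ e' vz (vs vz))) ⇒ vz ∊ vs vz)))))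

  nextF : ∀ {Γ} → Γ ∋ tup b → Γ ∋ elt → Γ ∋ tup b → F Γ
  nextF Z v Z' = goodF Z v Z' ∧ (∀' (lex vz (vs Z') ⇒ ~ goodF (vs Z) (vs v) vz))

  childF : ∀ {Γ} → Γ ∋ elt → Γ ∋ tup b → Γ ∋ elt → Γ ∋ tup b → F Γ
  childF v Z v' Z' = nextF Z v Z' ∧ compF cn' e' Z v v' ∧ ~ (v' ∊ Z') ∧ (∀' (vz ≺ vs v' ⇒ ~ cn' (vs Z') vz (vs v')))

  pattern v0 = vz
  pattern v1 = vs v0
  pattern v2 = vs v1
  pattern v3 = vs v2
  pattern v4 = vs v3
  pattern v5 = vs v4
  pattern v6 = vs v5
  pattern v7 = vs v6
  pattern v8 = vs v7
  pattern v9 = vs v8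
  pattern v10 = vs v9
  pattern v11 = vs v10
  pattern v12 = vs v11

  -- Variables: t₁ t₂ A Y u v and then the two states; t₁ and t₂ select the closure by being 0 or not.
  hopStep metStep sizeStep childStep : F ΩΦ
  hopStep  = v7 ≐ v10 ∧ v8 ≐ v11 ∧ hopF (v2 , v4 , v5) v6 v9
  metStep  = stepF {params} (λ (_ , _ , A , Y , u , v , _) x → metItemF (A , u , u) Y x)
    (λ (_ , _ , A , Y , u , v , _) x d → atom size₀ (Y , x , d , tt))
    (v0 , v1 , v2 , v3 , v4 , v5 , tt) (v1 , v2 , v3 , v4 , v5 , v6 , tt) (v6 , v7 , v8 , tt) (v9 , v10 , v11 , tt)
  sizeStep = stepF {params} (λ (_ , _ , A , Y , u , v , _) x → sizeItemF (A , u , u) x)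
    (λ (_ , _ , A , Y , u , v , _) x d → sizeValF (A , u , u) x d)
    (v0 , v1 , v2 , v3 , v4 , v5 , tt) (v1 , v2 , v3 , v4 , v5 , v6 , tt) (v6 , v7 , v8 , tt) (v9 , v10 , v11 , tt)
  childStep = v8 ≐ v11 ∧ childF v6 v7 v9 v10

  connF : F (sig conn')
  connF = ~ (v1 ∊ v0) ∧ ~ (v2 ∊ v0) ∧ (∃' (isZ v0 ∧
    atom work (v0 , v0 , v0 , v1 , v1 , v2 , v3 , v2 , v1 , v0 , v3 , v1 , v0 , tt)))

  -- The path starts at element 0, which is never an item, with sum 0, and ends at the last item
  -- with the total.
  metF : F (sig met)
  metF = ∃' (∃' (isZ v1 ∧ ~ isZ v0 ∧ (∃' ((∀' (v1 ≺ v0 ⇒ ~ metItemF (v4 , v5 , v5) v6 v0))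
    ∧ atom work (v2 , v1 , v2 , v3 , v5 , v4 , v4 , v2 , v3 , v2 , v0 , v3 , v6 , tt)))))

  sizeF : F (sig size')
  sizeF = ∃' (∃' (isZ v1 ∧ ~ isZ v0 ∧ (∃' ((∀' (v1 ≺ v0 ⇒ ~ sizeItemF (v4 , v5 , v5) v0))
    ∧ atom work (v2 , v2 , v1 , v3 , v3 , v4 , v4 , v2 , v3 , v2 , v0 , v3 , v5 , tt)))))

  nodeF : F (sig node')
  nodeF = ∃'_ {σ = tup b} (∃' (∃' (isZ v1 ∧ ~ isZ v0 ∧ (∀' (v0 ∊ v3 ⇒ isZ v0))
    ∧ atom work (v1 , v0 , v0 , v2 , v2 , v1 , v1 , v1 , v2 , v1 , v3 , v4 , v1 , tt))))

  data Voc₂ : Set where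
    work₂ baseStep : Voc₂

  sig₂ : Voc₂ → Ctx
  sig₂ work₂    = Ω
  sig₂ baseStep = ΩΦ

  copyF : ∀ {Γ} → Args (elt ∷ Γ) ΩΦ → Fm Voc₂ sig₂ Γ
  copyF as = ∃' (~ isZ vz ∧ atom work₂ (vz , as))

  -- The gate compares all pairs of states for the same parameters, so that each closure is reset
  -- independently of the others.
  iterF : Fm Voc₂ sig₂ Ω
  iterF = (~ isZ v0 ∧ atom baseStep (v1 , v2 , v3 , v4 , v5 , v6 , v7 , v8 , v9 , v10 , v11 , v12 , tt))
    ∨ (isZ v0
      ∧ (∀'_ {σ = elt} (∀'_ {σ = tup b} (∀'_ {σ = elt} (∀'_ {σ = elt} (∀'_ {σ = tup b} (∀'_ {σ = elt}
          ((now ⇒ before) ∧ (before ⇒ now))))))))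
      ∧ (atom baseStep (v1 , v2 , v3 , v4 , v5 , v6 , v7 , v8 , v9 , v10 , v11 , v12 , tt)
        ∨ (v7 ≐ v10 ∧ v8 ≐ v11 ∧ v9 ≐ v12)
        ∨ (∃'_ {σ = elt} (∃'_ {σ = tup b} (∃'_ {σ = elt} (
            atom work₂ (v3 , v4 , v5 , v6 , v7 , v8 , v9 , v10 , v11 , v12 , v2 , v1 , v0 , tt)
          ∧ atom work₂ (v3 , v4 , v5 , v6 , v7 , v8 , v9 , v2 , v1 , v0 , vs v12 , vs (vs v12) , vs (vs (vs v12)) , tt)))))))
    where
    now before : Fm Voc₂ sig₂ (elt ∷ tup b ∷ elt ∷ elt ∷ tup b ∷ elt ∷ Ω)
    now = atom baseStep (v7 , v8 , v9 , v10 , v11 , v12 , v5 , v4 , v3 , v2 , v1 , v0 , tt)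
    before = copyF (v8 , v9 , v10 , v11 , v12 , vs v12 , v6 , v5 , v4 , v3 , v2 , v1 , tt)

  pattern #conn    = extra zero
  pattern #size    = extra (suc zero)
  pattern #closure = extra (suc (suc zero))
  pattern #edge    = extra (suc (suc (suc zero)))

  arities : Vec ℕ 4
  arities = size (sig conn₀) ∷ size (sig size₀) ∷ size (sig closure₀) ∷ size (sig edge₀) ∷ []

  USig : USym 4 → ℕ
  USig = uAr (suc b) arities (size Ω)

  -- Derived symbols are replaced in the order of their dependence; before its turn a symbol is read
  -- as false.
  int₀ int₁ int₂ int₃ : Int {USym 4} {USig} Voc sig
  int₀ edge'    p = rel edge (flat (sig edge') p)
  int₀ change   p = rel chg (flat (sig change) p)
  int₀ edge₀    p = rel (old #edge) (flat (sig edge₀) p)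
  int₀ conn₀    p = rel (old #conn) (flat (sig conn₀) p)
  int₀ size₀    p = rel (old #size) (flat (sig size₀) p)
  int₀ closure₀ p = rel (old #closure) (flat (sig closure₀) p)
  int₀ work     p = rel wrk (flat Ω p)
  int₀ conn'    p = falseF
  int₀ met      p = falseF
  int₀ size'    p = falseF
  int₀ node'    p = falseF

  int₁ conn' p = cmp int₀ p connF
  int₁ met   p = cmp int₀ p metF
  int₁ R     p = int₀ R p

  int₂ size' p = cmp int₁ p sizeF
  int₂ R     p = int₁ R p

  int₃ node' p = cmp int₀ p nodeF
  int₃ R     p = int₂ R p

  intᵢ : Int {USym 4} {USig} Voc₂ sig₂
  intᵢ work₂    p = rel wrk (flat Ω p)
  intᵢ baseStep p = phaseForm (proj₁ p) (proj₁ (proj₂ p))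
    (cmp int₀ p hopStep) (cmp int₀ p metStep) (cmp int₁ p sizeStep) (cmp int₂ p childStep)

  -- On a one-element domain all tuples are nodes and all vertices are in their bags.
  trivialF : ∀ {v} → Form (USym 4) USig v
  trivialF = all (zeroF zero)

  outΓ : AuxSym 4 → Ctx
  outΓ node     = elt ∷ tup b ∷ []
  outΓ par      = elt ∷ tup b ∷ elt ∷ tup b ∷ []
  outΓ bag      = elt ∷ elt ∷ tup b ∷ []
  outΓ #conn    = sig conn₀
  outΓ #size    = sig size₀
  outΓ #closure = sig closure₀
  outΓ #edge    = sig edge₀

  outF : ∀ s → F (outΓ s)
  outF node     = atom node' (v0 , v1 , tt)
  outF par      = atom node' (v2 , v3 , tt) ∧ childF v2 v3 v0 v1
  outF bag      = atom node' (v1 , v2 , tt) ∧ (isZ v0 ∨ (∃' (nextF v3 v2 v0 ∧ v1 ∊ v0)))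
  outF #conn    = atom conn' (v0 , v1 , v2 , tt)
  outF #size    = atom size' (v0 , v1 , v2 , tt)
  outF #closure = v1 ≐ v0 ∨ (∃'_ {σ = elt} (∃'_ {σ = tup b} (atom node' (v1 , v0 , tt) ∧ compF cn' e' v0 v1 v2
                    ∧ (∃' (nextF v1 v2 v0 ∧ v4 ∊ v0)))))
  outF #edge    = atom edge' (v0 , v1 , tt)

  outForm : ∀ s → Form (USym 4) USig (auxAr (suc b) arities s)
  outForm node     = or (cmp int₃ (pos (outΓ node)) (outF node)) trivialF
  outForm par      = and (cmp int₃ (pos (outΓ par)) (outF par)) (neg trivialF)
  outForm bag      = or (cmp int₃ (pos (outΓ bag)) (outF bag)) trivialF
  outForm #conn    = cmp int₃ (pos (outΓ #conn)) (outF #conn)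
  outForm #size    = cmp int₃ (pos (outΓ #size)) (outF #size)
  outForm #closure = cmp int₃ (pos (outΓ #closure)) (outF #closure)
  outForm #edge    = cmp int₃ (pos (outΓ #edge)) (outF #edge)

  stepForm : Form (USym 4) USig (size Ω)
  stepForm = cmp intᵢ (pos Ω) iterF

  noSig : ⊥ → Ctx
  noSig ()

  starF : ∀ {Γ q} → Γ ∋ tup q → Fm ⊥ noSig Γ
  starF Z = ∀' (v0 ∊ vs Z ⇒ isZ v0)

  -- The empty graph gets a star with centre 0 and bags of one vertex. A component has one vertex,
  -- but the class attached to 0 has `n - 1` for the tuple of zeros and is empty for all other
  -- tuples, since nothing is adjacent to their members.
  initF : ∀ s → Fm ⊥ noSig (outΓ s)
  initF node     = starF v1
  initF par      = starF v1 ∧ starF v3 ∧ ~ isZ v0 ∧ isZ v2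
  initF bag      = starF v2 ∧ v0 ≐ v1
  initF #conn    = ~ (v1 ∊ v0) ∧ v1 ≐ v2
  initF #size    = (~ (v1 ∊ v0) ∧ (∃' (isZ v0 ∧ v0 ≺ v3 ∧ (∀' (v0 ≺ v4 ⇒ isZ v0)))))
                 ∨ (v1 ∊ v0 ∧ ((isZ v1 ∧ starF v0 ∧ (∀' v0 ≼ v3)) ∨ (~ (isZ v1 ∧ starF v0) ∧ isZ v2)))
  initF #closure = v1 ≐ v0
  initF #edge    = ~ (v0 ≐ v0)

  noInt : ∀ {Sym ar} → Int {Sym} {ar} ⊥ noSig
  noInt ()

  initForm : ∀ {Sym ar} s → Form Sym ar (auxAr (suc b) arities s)
  initForm node     = cmp noInt (pos (outΓ node)) (initF node)
  initForm par      = cmp noInt (pos (outΓ par)) (initF par)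
  initForm bag      = cmp noInt (pos (outΓ bag)) (initF bag)
  initForm #conn    = cmp noInt (pos (outΓ #conn)) (initF #conn)
  initForm #size    = cmp noInt (pos (outΓ #size)) (initF #size)
  initForm #closure = cmp noInt (pos (outΓ #closure)) (initF #closure)
  initForm #edge    = cmp noInt (pos (outΓ #edge)) (initF #edge)

  program : ℕ → ℕ → DynProg
  program a₀ b₀ = record
    { r = suc b ; m = 4 ; w = size Ω ; ars = arities ; a = a₀ ; b = b₀
    ; init = initForm ; stepIns = stepForm ; stepDel = stepForm ; outIns = outForm ; outDel = outForm }

  module _ (a₀ b₀ : ℕ) {n' : ℕ} where

    open Run (program a₀ b₀)

    private
      V : Set
      V = Fin (suc n')

    closureRel : AuxState (suc n') → V → V → Set
    closureRel A x y = A #closure (x ∷ y ∷ [])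

    -- Of the closure only its size and its separation property are kept, so that the identity can
    -- serve for the empty graph. The decomposition is absent because each step defines it anew.
    record Inv (cb : ℕ) (E : Graph (suc n')) (A : AuxState (suc n')) : Set₁ where
      field
        E?       : ∀ x y → Dec (E x y)
        E-sym    : ∀ {x y} → E x y → E y x
        E-irr    : ∀ {x} → ¬ E x x
        A?       : ∀ s t → Dec (A s t)
        conn-inv : ∀ B u v → A #conn (flat (sig conn₀) (B , u , v , tt)) ⟺ conn E B u v
        size-inv : ∀ B u z → A #size (flat (sig size₀) (B , u , z , tt)) ⟺ (toℕ z ≡ compSize E? B u)
        edge-inv : ∀ x y → A #edge (x ∷ y ∷ []) ⟺ E x y
        cl-refl  : ∀ x → closureRel A x x
        cl-sep   : ∀ {M : V → Set} → DecP M → ∀ w → ¬ toℕ w ≡ 0 → (∀ m → M m → ¬ closureRel A m w) →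
          ∃ λ (Y : Vec V b) → (∀ y → In y Y → toℕ y ≡ 0 ⊎ ∃ λ m → M m × closureRel A m y) ×
                             (∀ x → conn E Y w x → ∀ m → M m → ¬ closureRel A m x)
        cl-list  : ∀ x → ∃ λ (L : List V) → length L ≤ cb × (∀ y → closureRel A x y → y ∈ L)

  Aux : ℕ → Set₁
  Aux n = Structure n (AuxSym 4) (auxAr (suc b) arities)

  Encodes : ∀ {n} → Graph n → Aux n → ℕ → ℕ → Set
  Encodes {n} E A wd dp = Σ (Vec (Fin n) (suc b)) λ root →
    IsTreeDecomposition E (A node) (λ x y → A par (x ++ y)) (λ t v → A bag (v ∷ t)) root
    × WidthAtMost (A node) (λ t v → A bag (v ∷ t)) wd × DepthAtMost (A node) (λ x y → A par (x ++ y)) root dp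

  -- Correctness of one update

  module Update {n' : ℕ} {E E' D : Graph (suc n')}
    (E? : ∀ x y → Dec (E x y)) (E'? : ∀ x y → Dec (E' x y)) (D? : ∀ x y → Dec (D x y))
    (E-sym : ∀ {x y} → E x y → E y x) (E'-sym : ∀ {x y} → E' x y → E' y x)
    (unchanged : ∀ {x y} → ¬ D x y → E x y ⟺ E' x y)
    {Cl : Fin (suc n') → Fin (suc n') → Set} (Cl? : ∀ x y → Dec (Cl x y)) (Cl-refl : ∀ x → Cl x x)
    (Cl-sep : ∀ {M : Fin (suc n') → Set} → DecP M → ∀ w → ¬ toℕ w ≡ 0 → (∀ m → M m → ¬ Cl m w) →
      ∃ λ (Y : Vec (Fin (suc n')) (ss k)) → (∀ y → In y Y → toℕ y ≡ 0 ⊎ ∃ λ m → M m × Cl m y) ×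
                       (∀ x → conn E Y w x → ∀ m → M m → ¬ Cl m x))
    (E'-irr : ∀ {x} → ¬ E' x x) (tw : TreewidthAtMost k E')
    (one : Fin (suc n')) (one≢0 : ¬ toℕ one ≡ 0)
    where

    module Tr = Tree k {E'} E'? E'-sym E'-irr tw

    private
      V : Set
      V = Fin (suc n')

    Touched : Vec V b → V → V → V → Set
    Touched A u v x = (Σ V λ y → D x y) ⊎ In x A ⊎ x ≡ u ⊎ x ≡ v

    InX : Vec V b → V → V → V → Set
    InX A u v y = toℕ y ≡ 0 ⊎ Σ V λ x → Touched A u v x × Cl x y

    Touched? : ∀ A u v → DecP (Touched A u v)
    Touched? A u v x = FP.any? (D? x) ⊎-dec In? x A ⊎-dec (x FP.≟ u) ⊎-dec (x FP.≟ v)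

    InX? : ∀ A u v → DecP (InX A u v)
    InX? A u v y = (toℕ y Data.Nat.≟ 0) ⊎-dec FP.any? (λ x → Touched? A u v x ×-dec Cl? x y)

    A⊆X : ∀ A u v {x} → In x A → InX A u v x
    A⊆X A u v {x} i = inj₂ (x , inj₂ (inj₁ i) , Cl-refl x)

    u∈X : ∀ A u v → InX A u v u
    u∈X A u v = inj₂ (u , inj₂ (inj₂ (inj₁ refl)) , Cl-refl u)

    v∈X : ∀ A u v → InX A u v v
    v∈X A u v = inj₂ (v , inj₂ (inj₂ (inj₂ refl)) , Cl-refl v)

    untouched : ∀ {A u v x y} → ¬ InX A u v x → ¬ D x y
    untouched {x = x} {y} x∉ d = x∉ (inj₂ (x , inj₁ (y , d) , Cl-refl x))

    sep : ∀ A u v w → ¬ InX A u v w → Σ (Vec V b) λ Y → (∀ y → In y Y → InX A u v y) × (∀ x → InX A u v x → ¬ conn E Y w x)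
    sep A u v w w∉ with Cl-sep (Touched? A u v) w (λ e → w∉ (inj₁ e)) (λ m t c → w∉ (inj₂ (m , t , c)))
    ... | Y , Y⊆ , av = Y , Y⊆ , λ where
      x (inj₁ e) c → conn-tgt c (In-0 Y e)
      x (inj₂ (m , t , cl)) c → av x c m t cl

    module To (A : Vec V b) (u v : V) = Torso {q = b} E? E'? E-sym E'-sym {X = InX A u v} (InX? A u v) inj₁
      (λ x∉ → proj₁ (unchanged (untouched {A} {u} {v} x∉))) (λ x∉ → proj₂ (unchanged (untouched {A} {u} {v} x∉))) (sep A u v)

    module Hops (A : Vec V b) (u v : V) = To.Connectivity A u v A (A⊆X A u v)
    module Mets (A : Vec V b) (u : V) (Y : Vec V b) = To.Meeting A u u Y
    module Szs (A : Vec V b) (u : V) = To.Sizes A u u A u (A⊆X A u u) (u∈X A u u)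

    Env-Ω : Set₁
    Env-Ω = Env (suc n') Ω → Set

    Str : Set₁
    Str = TStr (suc n') Voc sig

    S₀ : Env-Ω → Str
    S₀ W edge'    (x , y , _)     = E' x y
    S₀ W change   (x , y , _)     = D x y
    S₀ W edge₀    (x , y , _)     = E x y
    S₀ W conn₀    (A , u , v , _) = conn E A u v
    S₀ W size₀    (A , u , z , _) = toℕ z ≡ compSize E? A u
    S₀ W closure₀ (x , y , _)     = Cl x y
    S₀ W work     ρ               = W ρ
    S₀ W conn'    ρ               = ⊥
    S₀ W met      ρ               = ⊥
    S₀ W size'    ρ               = ⊥
    S₀ W node'    ρ               = ⊥

    -- The structures `S₁` to `S₃` give derived symbols the meaning of their defining formulas, `I₁`
    -- to `I₃` the intended meaning. Both agree once the closures read by these formulas are right.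
    S₁ : Env-Ω → Str
    S₁ W conn' ρ = ⟪ connF ⟫ (S₀ W) ρ
    S₁ W met   ρ = ⟪ metF ⟫ (S₀ W) ρ
    S₁ W R     ρ = S₀ W R ρ

    S₂ : Env-Ω → Str
    S₂ W size' ρ = ⟪ sizeF ⟫ (S₁ W) ρ
    S₂ W R     ρ = S₁ W R ρ

    S₃ : Env-Ω → Str
    S₃ W node' ρ = ⟪ nodeF ⟫ (S₀ W) ρ
    S₃ W R     ρ = S₂ W R ρ

    I₁ : Env-Ω → Str
    I₁ W conn' (A , u , v , _)     = conn E' A u v
    I₁ W met   (A , u , Y , z , _) = toℕ z ≡ count (Mets.Met? A u Y)
    I₁ W R     ρ = S₀ W R ρ

    I₂ : Env-Ω → Str
    I₂ W size' (A , u , z , _) = toℕ z ≡ compSize E'? A u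
    I₂ W R     ρ = I₁ W R ρ

    I₃ : Env-Ω → Str
    I₃ W node' (v , Z , _) = Tr.Active (v ∷ Z)
    I₃ W R     ρ = I₂ W R ρ

    opaque
      Φ : Env-Ω → Env (suc n') ΩΦ → Set
      Φ W ρ = Phase (proj₁ ρ) (proj₁ (proj₂ ρ))
        (⟪ hopStep ⟫ (S₀ W) ρ) (⟪ metStep ⟫ (S₀ W) ρ) (⟪ sizeStep ⟫ (S₁ W) ρ) (⟪ childStep ⟫ (S₂ W) ρ)

      Φ-cong : ∀ W ρ {P₁ P₂ P₃ P₄ : Set} → P₁ ⟺ ⟪ hopStep ⟫ (S₀ W) ρ → P₂ ⟺ ⟪ metStep ⟫ (S₀ W) ρ →
        (toℕ (proj₁ ρ) ≡ 0 → ¬ toℕ (proj₁ (proj₂ ρ)) ≡ 0 → P₃ ⟺ ⟪ sizeStep ⟫ (S₁ W) ρ) →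
        (¬ toℕ (proj₁ ρ) ≡ 0 → ¬ toℕ (proj₁ (proj₂ ρ)) ≡ 0 → P₄ ⟺ ⟪ childStep ⟫ (S₂ W) ρ) →
        Phase (proj₁ ρ) (proj₁ (proj₂ ρ)) P₁ P₂ P₃ P₄ ⟺ Φ W ρ
      Φ-cong W ρ h₁ h₂ h₃ h₄ = Phase-cong h₁ h₂ h₃ h₄

    Params : Set
    Params = Env (suc n') params

    St : Set
    St = Env (suc n') state

    ρΦ : Params → St → St → Env (suc n') ΩΦ
    ρΦ (t₁ , t₂ , A , Y , u , v , _) (x , Z , z , _) (x' , Z' , z' , _) = t₁ , t₂ , A , Y , u , v , x , Z , z , x' , Z' , z' , tt

    HopSt MetSt SizeSt ChildSt : Params → St → St → Set
    HopSt (_ , _ , A , Y , u , v , _) (x , Z , z , _) (x' , Z' , z' , _) = Z ≡ Z' × z ≡ z' × Hops.Hop A u v x x'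
    MetSt (_ , _ , A , Y , u , v , _) = Mets.Sum.Step A u Y
    SizeSt (_ , _ , A , Y , u , v , _) = Szs.Sum.Step A u
    ChildSt _ (x , Z , z , _) (x' , Z' , z' , _) = z ≡ z' × Tr.Child x Z x' Z'

    Base : Params → St → St → Set
    Base γ@(t₁ , t₂ , _) s t = Phase t₁ t₂ (HopSt γ s t) (MetSt γ s t) (SizeSt γ s t) (ChildSt γ s t)

    -- This equivalence and its companions hold by computation: the relations were written to be
    -- literally the meanings of the formulas.
    hop-ok : ∀ W γ s t → ⟪ hopStep ⟫ (S₀ W) (ρΦ γ s t) ⟺ HopSt γ s t
    hop-ok W γ s t = ⟺-refl

    met-ok : ∀ W γ s t → ⟪ metStep ⟫ (S₀ W) (ρΦ γ s t) ⟺ MetSt γ s t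
    met-ok W γ s t = ⟺-refl

    size-ok : ∀ W γ s t → ⟪ sizeStep ⟫ (I₁ W) (ρΦ γ s t) ⟺ SizeSt γ s t
    size-ok W γ s t = ⟺-refl

    opaque
      unfolding Build.Good

      child-ok : ∀ W γ s t → ⟪ childStep ⟫ (I₂ W) (ρΦ γ s t) ⟺ ChildSt γ s t
      child-ok W γ s t = ⟺-refl

    rank : Params → ℕ
    rank (zero  , zero  , _) = 0
    rank (suc _ , zero  , _) = 1
    rank (zero  , suc _ , _) = 2
    rank (suc _ , suc _ , _) = 3

    wenv : V → Params → St → St → Env (suc n') Ω
    wenv f γ s t = f , ρΦ γ s t

    Correct : ℕ → Env-Ω → Set
    Correct r W = ∀ γ → rank γ < r → ∀ s t → W (wenv zero γ s t) ⟺ Star (Base γ) s t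

    opaque
      hop-star : ∀ A Y u v x y → Star (Base (zero , zero , A , Y , u , v , tt)) (x , A , zero , tt) (y , A , zero , tt) ⟺ Star (Hops.Hop A u v) x y
      hop-star A Y u v x y = gmap proj₁ (λ { (phase₁ _ _ (_ , _ , h)) → h
                                           ; (phase₂ e _ _) → ⊥-elim (e refl)
                                           ; (phase₃ _ e _) → ⊥-elim (e refl)
                                           ; (phase₄ e _ _) → ⊥-elim (e refl) })
                         , gmap (λ x → x , A , zero , tt) (λ h → phase₁ refl refl (refl , refl , h))

      met-star : ∀ e → ¬ toℕ e ≡ 0 → ∀ A Y u v s t → Star (Base (e , zero , A , Y , u , v , tt)) s t ⟺ Star (Mets.Sum.Step A u Y) s t
      met-star e e≢0 A Y u v s t = Star-map (λ { (phase₁ e≡0 _ _) → ⊥-elim (e≢0 e≡0)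
                                               ; (phase₂ _ _ h) → h
                                               ; (phase₃ e≡0 _ _) → ⊥-elim (e≢0 e≡0)
                                               ; (phase₄ _ z _) → ⊥-elim (z refl) })
                                 , Star-map (phase₂ e≢0 refl)

      size-star : ∀ e → ¬ toℕ e ≡ 0 → ∀ A Y u v s t → Star (Base (zero , e , A , Y , u , v , tt)) s t ⟺ Star (Szs.Sum.Step A u) s t
      size-star e e≢0 A Y u v s t = Star-map (λ { (phase₁ _ e≡0 _) → ⊥-elim (e≢0 e≡0)
                                                ; (phase₂ z _ _) → ⊥-elim (z refl)
                                                ; (phase₃ _ _ h) → h
                                                ; (phase₄ z _ _) → ⊥-elim (z refl) })
                                  , Star-map (phase₃ refl e≢0)

      child-star : ∀ e → ¬ toℕ e ≡ 0 → ∀ A Y u v x Z x' Z' →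
        Star (Base (e , e , A , Y , u , v , tt)) (x , Z , zero , tt) (x' , Z' , zero , tt) ⟺ Star Tr.ChildOf (x ∷ Z) (x' ∷ Z')
      child-star e e≢0 A Y u v x Z x' Z' = gmap (λ (x , Z , _) → x ∷ Z)
            (λ { (phase₁ e≡0 _ _) → ⊥-elim (e≢0 e≡0)
               ; (phase₂ _ e≡0 _) → ⊥-elim (e≢0 e≡0)
               ; (phase₃ e≡0 _ _) → ⊥-elim (e≢0 e≡0)
               ; (phase₄ _ _ (_ , h)) → h })
        , gmap st (λ { {w ∷ U} {w' ∷ U'} h → phase₄ e≢0 e≢0 (refl , h) })
        where
        st : Tr.Node → St
        st (x ∷ Z) = x , Z , zero , tt

      rank-1 : ∀ e A Y u v → ¬ toℕ e ≡ 0 → rank (e , zero , A , Y , u , v , tt) < 2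
      rank-1 zero    A Y u v h = ⊥-elim (h refl)
      rank-1 (suc e) A Y u v h = s≤s (s≤s z≤n)

      rank-2 : ∀ e A Y u v → ¬ toℕ e ≡ 0 → rank (zero , e , A , Y , u , v , tt) < 3
      rank-2 zero    A Y u v h = ⊥-elim (h refl)
      rank-2 (suc e) A Y u v h = s≤s (s≤s (s≤s z≤n))

      rank-3 : ∀ e A Y u v → ¬ toℕ e ≡ 0 → rank (e , e , A , Y , u , v , tt) < 4
      rank-3 zero    A Y u v h = ⊥-elim (h refl)
      rank-3 (suc e) A Y u v h = s≤s (s≤s (s≤s (s≤s z≤n)))

      conn-ok : ∀ W → Correct 1 W → ∀ A u v → ⟪ connF ⟫ (S₀ W) (A , u , v , tt) ⟺ conn E' A u v
      conn-ok W ok A u v = ⟺-trans (×-cong ⟺-refl (×-cong ⟺-refl read)) (Hops.hops-correct A u v (u∈X A u v) (v∈X A u v))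
        where
        read : (Σ V λ o → toℕ o ≡ 0 × W (wenv o (o , o , A , A , u , v , tt) (u , A , o , tt) (v , A , o , tt))) ⟺ Star (Hops.Hop A u v) u v
        read = ⟺-trans ((λ { (zero , _ , w) → w }) , (λ w → zero , refl , w))
          (⟺-trans (ok (zero , zero , A , A , u , v , tt) (s≤s z≤n) _ _) (hop-star A A u v u v))

      met-correct : ∀ W → Correct 2 W → ∀ A u Y z → ⟪ metF ⟫ (S₀ W) (A , u , Y , z , tt) ⟺ (toℕ z ≡ count (Mets.Met? A u Y))
      met-correct W ok A u Y z = ⟺-trans (to , from) (Mets.Sum.total-correct A u Y {o = zero} refl A z)
        where
        T : Set
        T = Mets.Sum.Total A u Y zero A z
        to : ⟪ metF ⟫ (S₀ W) (A , u , Y , z , tt) → T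
        to (zero , e , _ , e≢0 , w , l , r) = w , l , proj₁ (⟺-trans (ok _ (rank-1 e A Y u u e≢0) _ _) (met-star e e≢0 A Y u u _ _)) r
        from : T → ⟪ metF ⟫ (S₀ W) (A , u , Y , z , tt)
        from (w , l , s) = zero , one , refl , one≢0 , w , l
          , proj₂ (⟺-trans (ok _ (rank-1 one A Y u u one≢0) _ _) (met-star one one≢0 A Y u u _ _)) s

    S₁-ok : ∀ W → Correct 2 W → ∀ R ρ → S₁ W R ρ ⟺ I₁ W R ρ
    S₁-ok W ok (base R) ρ = ⟺-refl
    S₁-ok W ok conn'    (A , u , v , _)     = conn-ok W (λ γ l → ok γ (m≤n⇒m≤1+n l)) A u v
    S₁-ok W ok met      (A , u , Y , z , _) = met-correct W ok A u Y z
    S₁-ok W ok size'    ρ = ⟺-refl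
    S₁-ok W ok node'    ρ = ⟺-refl

    opaque
      size-correct : ∀ W → Correct 3 W → ∀ A u z → ⟪ sizeF ⟫ (S₁ W) (A , u , z , tt) ⟺ (toℕ z ≡ compSize E'? A u)
      size-correct W ok A u z = ⟺-trans (Fm-cong (S₁-ok W (λ γ l → ok γ (m≤n⇒m≤1+n l))) sizeF (A , u , z , tt))
        (⟺-trans (to , from) (Szs.Sum.total-correct A u {o = zero} refl A z))
        where
        T : Set
        T = Szs.Sum.Total A u zero A z
        to : ⟪ sizeF ⟫ (I₁ W) (A , u , z , tt) → T
        to (zero , e , _ , e≢0 , w , l , r) = w , l , proj₁ (⟺-trans (ok _ (rank-2 e A A u u e≢0) _ _) (size-star e e≢0 A A u u _ _)) r
        from : T → ⟪ sizeF ⟫ (I₁ W) (A , u , z , tt)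
        from (w , l , s) = zero , one , refl , one≢0 , w , l
          , proj₂ (⟺-trans (ok _ (rank-2 one A A u u one≢0) _ _) (size-star one one≢0 A A u u _ _)) s

    S₂-ok : ∀ W → Correct 3 W → ∀ R ρ → S₂ W R ρ ⟺ I₂ W R ρ
    S₂-ok W ok (base R) ρ = ⟺-refl
    S₂-ok W ok conn'    ρ = S₁-ok W (λ γ l → ok γ (m≤n⇒m≤1+n l)) conn' ρ
    S₂-ok W ok met      ρ = S₁-ok W (λ γ l → ok γ (m≤n⇒m≤1+n l)) met ρ
    S₂-ok W ok size'    (A , u , z , _) = size-correct W ok A u z
    S₂-ok W ok node'    ρ = ⟺-refl

    opaque
      node-correct : ∀ W → Correct 4 W → ∀ v Z → ⟪ nodeF ⟫ (S₀ W) (v , Z , tt) ⟺ Tr.Active (v ∷ Z)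
      node-correct W ok v Z = ⟺-trans (to , from) (Tr.star-active Tr.a-root , Tr.active-star)
        where
        to : ⟪ nodeF ⟫ (S₀ W) (v , Z , tt) → Star Tr.ChildOf Tr.root (v ∷ Z)
        to (O , o , e , o≡0 , e≢0 , h , r) = at e e≢0 (is-zero o≡0) (zeros-unique O h) r
          where
          at : ∀ e → ¬ toℕ e ≡ 0 → ∀ {O o} → o ≡ zero → O ≡ zeros → W (wenv o (e , e , O , O , o , o , tt) (o , O , o , tt) (v , Z , o , tt)) →
               Star Tr.ChildOf Tr.root (v ∷ Z)
          at e e≢0 refl refl r = proj₁ (⟺-trans (ok _ (rank-3 e zeros zeros zero zero e≢0) _ _) (child-star e e≢0 zeros zeros zero zero zero zeros v Z)) r
        from : Star Tr.ChildOf Tr.root (v ∷ Z) → ⟪ nodeF ⟫ (S₀ W) (v , Z , tt)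
        from s = zeros , zero , one , refl , one≢0 , (λ x i → In-zeros b i)
          , proj₂ (⟺-trans (ok _ (rank-3 one zeros zeros zero zero one≢0) _ _) (child-star one one≢0 zeros zeros zero zero zero zeros v Z)) s

    S₃-ok : ∀ W → Correct 4 W → ∀ R ρ → S₃ W R ρ ⟺ I₃ W R ρ
    S₃-ok W ok (base R) ρ = ⟺-refl
    S₃-ok W ok conn'    ρ = S₂-ok W (λ γ l → ok γ (m≤n⇒m≤1+n l)) conn' ρ
    S₃-ok W ok met      ρ = S₂-ok W (λ γ l → ok γ (m≤n⇒m≤1+n l)) met ρ
    S₃-ok W ok size'    ρ = S₂-ok W (λ γ l → ok γ (m≤n⇒m≤1+n l)) size' ρ
    S₃-ok W ok node'    (v , Z , _) = node-correct W ok v Z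

    rank≡2 : ∀ t₁ t₂ {ps} → toℕ t₁ ≡ 0 → ¬ toℕ t₂ ≡ 0 → 2 ≤ rank (t₁ , t₂ , ps)
    rank≡2 zero zero    _ ne = ⊥-elim (ne refl)
    rank≡2 zero (suc _) _ _  = ≤-refl

    rank≡3 : ∀ t₁ t₂ {ps} → ¬ toℕ t₁ ≡ 0 → ¬ toℕ t₂ ≡ 0 → 3 ≤ rank (t₁ , t₂ , ps)
    rank≡3 zero    _       ne _ = ⊥-elim (ne refl)
    rank≡3 (suc _) zero    _ ne = ⊥-elim (ne refl)
    rank≡3 (suc _) (suc _) _ _  = ≤-refl

    -- Each phase refers only to closures of lower rank, so it is correct as soon as those are.
    opaque
      Φ-base : ∀ W γ → Correct (rank γ) W → ∀ s t → Φ W (ρΦ γ s t) ⟺ Base γ s t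
      Φ-base W γ@(t₁ , t₂ , ps) ok s t = ⟺-sym (Φ-cong W (ρΦ γ s t) {HopSt γ s t} {MetSt γ s t} {SizeSt γ s t} {ChildSt γ s t}
        (⟺-sym (hop-ok W γ s t)) (⟺-sym (met-ok W γ s t)) third fourth)
        where
        third : toℕ t₁ ≡ 0 → ¬ toℕ t₂ ≡ 0 → SizeSt γ s t ⟺ ⟪ sizeStep ⟫ (S₁ W) (ρΦ γ s t)
        third e ne = ⟺-sym (⟺-trans {Q = ⟪ sizeStep ⟫ (I₁ W) (ρΦ γ s t)}
          (Fm-cong {suc n'} {Voc} {sig} {S₁ W} {I₁ W} (S₁-ok W (λ γ' l → ok γ' (<-≤-trans l (rank≡2 t₁ t₂ {ps} e ne)))) {ΩΦ} sizeStep (ρΦ γ s t)) (size-ok W γ s t))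
        fourth : ¬ toℕ t₁ ≡ 0 → ¬ toℕ t₂ ≡ 0 → ChildSt γ s t ⟺ ⟪ childStep ⟫ (S₂ W) (ρΦ γ s t)
        fourth e ne = ⟺-sym (⟺-trans {Q = ⟪ childStep ⟫ (I₂ W) (ρΦ γ s t)}
          (Fm-cong {suc n'} {Voc} {sig} {S₂ W} {I₂ W} (S₂-ok W (λ γ' l → ok γ' (<-≤-trans l (rank≡3 t₁ t₂ {ps} e ne)))) {ΩΦ} childStep (ρΦ γ s t)) (child-ok W γ s t))

    -- Lengths of the paths

    module Bounded (cb tb : ℕ) (Cl-list : ∀ x → ∃ λ (L : List (Fin (suc n'))) → length L ≤ cb × (∀ y → Cl x y → y ∈ L))
      (touched : List (Fin (suc n'))) (touched-length : length touched ≤ tb) (D-touched : ∀ {x y} → D x y → x ∈ touched)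
      where

      -- One for vertex 0; the sources are the touched vertices, the tuple together with 0, and two
      -- query vertices.
      torsoBound : ℕ
      torsoBound = suc ((tb + (suc b + 2)) * cb)

      gather : (xs : List V) → ∃ λ (L : List V) → length L ≤ length xs * cb × (∀ {x y} → x ∈ xs → Cl x y → y ∈ L)
      gather [] = [] , z≤n , λ ()
      gather (x ∷ xs) = let L₁ , l₁ , h₁ = Cl-list x ; L₂ , l₂ , h₂ = gather xs in
        L₁ L.++ L₂ , ≤-trans (≤-reflexive (LP.length-++ L₁)) (+-mono-≤ l₁ l₂) , λ where
          (there i) c → ∈-++⁺ʳ L₁ (h₂ i c)
          {y = y} (here refl) c → ∈-++⁺ˡ (h₁ y c)

      opaque
        torso-list : ∀ A u v → ∃ λ (L : List V) → length L ≤ torsoBound × (∀ y → InX A u v y → y ∈ L)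
        torso-list A u v = zero ∷ proj₁ g , s≤s (≤-trans (proj₁ (proj₂ g)) (*-monoˡ-≤ cb src-length)) , λ where
            y (inj₁ e) → here (FP.toℕ-injective e)
            y (inj₂ (x , t , c)) → there (proj₂ (proj₂ g) (src t) c)
          where
          srcs : List V
          srcs = touched L.++ ((zero ∷ toList A) L.++ (u ∷ v ∷ []))
          g : ∃ λ (L : List V) → length L ≤ length srcs * cb × (∀ {x y} → x ∈ srcs → Cl x y → y ∈ L)
          g = gather srcs
          src-length : length srcs ≤ tb + (suc b + 2)
          src-length = ≤-trans (≤-reflexive (LP.length-++ touched)) (+-mono-≤ touched-length
            (≤-reflexive (cong suc (trans (LP.length-++ (toList A)) (cong (_+ 2) (VP.length-toList A))))))
          src : ∀ {x} → Touched A u v x → x ∈ srcs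
          src (inj₁ (y , d)) = ∈-++⁺ˡ (D-touched d)
          src (inj₂ (inj₁ i)) = ∈-++⁺ʳ touched (∈-++⁺ˡ (Tr.In⇒∈ A i))
          src (inj₂ (inj₂ (inj₁ refl))) = ∈-++⁺ʳ touched (∈-++⁺ʳ (zero ∷ toList A) (here refl))
          src (inj₂ (inj₂ (inj₂ refl))) = ∈-++⁺ʳ touched (∈-++⁺ʳ (zero ∷ toList A) (there (here refl)))

        hop-bound : ∀ γ {s t} → Star (HopSt γ) s t → ∃ λ j → j ≤ torsoBound × ReachIn (HopSt γ) j s t
        hop-bound γ@(_ , _ , A , Y , u , v , _) p =
          let j , l , r = Shorten.shorten FP._≟_ (HopSt γ) (λ s c → proj₁ s ≡ c) same L
                            (λ { (_ , _ , (_ , xt) , _) → _ , refl , mem _ xt }) p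
          in j , ≤-trans l len , r
          where
          L : List V
          L = proj₁ (torso-list A u v)
          len : length L ≤ torsoBound
          len = proj₁ (proj₂ (torso-list A u v))
          mem : ∀ y → InX A u v y → y ∈ L
          mem = proj₂ (proj₂ (torso-list A u v))
          fixed : ∀ {s t} → Star (HopSt γ) s t → proj₂ s ≡ proj₂ t
          fixed ε = refl
          fixed ((refl , refl , _) ◅ p) = fixed p
          same : ∀ {s t c} → Star (HopSt γ) s t → proj₁ s ≡ c → proj₁ t ≡ c → s ≡ t
          same p e e' = cong₂ _,_ (trans e (sym e')) (fixed p)

        met-bound : ∀ γ {s t} → Star (MetSt γ) s t → ∃ λ j → j ≤ torsoBound × ReachIn (MetSt γ) j s t
        met-bound γ@(_ , _ , A , Y , u , v , _) p =
          let j , l , r = Mets.Sum.Bound.bounded A u Y FP._≟_ _≡_ (λ { _ _ refl refl → <-irrefl refl }) L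
                            (λ (xw , _) → _ , refl , mem _ xw) p
          in j , ≤-trans l len , r
          where
          L : List V
          L = proj₁ (torso-list A u u)
          len : length L ≤ torsoBound
          len = proj₁ (proj₂ (torso-list A u u))
          mem : ∀ y → InX A u u y → y ∈ L
          mem = proj₂ (proj₂ (torso-list A u u))

        -- Items in the torso are coded by themselves, classes outside by their neighbourhood, a
        -- `b`-tuple over the torso.
        size-bound : ∀ γ {s t} → Star (SizeSt γ) s t → ∃ λ j → j ≤ torsoBound + torsoBound ^ b × ReachIn (SizeSt γ) j s t
        size-bound γ@(_ , _ , A , Y , u , v , _) p =
          let j , l , r = Szs.Sum.Bound.bounded A u (SP.≡-dec FP._≟_ (VP.≡-dec FP._≟_)) K K-inj codes code p
          in j , ≤-trans l codes-length , r
          where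
          L : List V
          L = proj₁ (torso-list A u u)
          len : length L ≤ torsoBound
          len = proj₁ (proj₂ (torso-list A u u))
          mem : ∀ y → InX A u u y → y ∈ L
          mem = proj₂ (proj₂ (torso-list A u u))
          K : V → V ⊎ Vec V b → Set
          K w (inj₁ c) = InX A u u w × w ≡ c
          K w (inj₂ Z) = ¬ InX A u u w × Szs.Exact A u Z w
          K-inj : ∀ {w w' c} → Szs.Item A u w → Szs.Item A u w' → K w c → K w' c → ¬ toℕ w < toℕ w'
          K-inj {c = inj₁ c} _ _ (_ , refl) (_ , refl) = <-irrefl refl
          K-inj {c = inj₂ Z} _ (_ , inj₁ x') (w∉ , _) (w'∉ , _) l = w'∉ x'
          K-inj {w} {c = inj₂ Z} _ (_ , inj₂ (_ , least)) (w∉ , ex₁) (w'∉ , ex₂) l = least w l w∉ λ y (xy , y≢0) →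
            (λ a → [ (λ e → ⊥-elim (y≢0 e)) , proj₂ ]′ (proj₁ (ex₂ y) (proj₂ (ex₁ y) (inj₂ (xy , a)))))
            , (λ a → [ (λ e → ⊥-elim (y≢0 e)) , proj₂ ]′ (proj₁ (ex₁ y) (proj₂ (ex₂ y) (inj₂ (xy , a)))))
          codes : List (V ⊎ Vec V b)
          codes = L.map inj₁ L L.++ L.map inj₂ (tuples L b)
          codes-length : length codes ≤ torsoBound + torsoBound ^ b
          codes-length = ≤-trans (≤-reflexive (trans (LP.length-++ (L.map inj₁ L))
            (cong₂ _+_ (LP.length-map inj₁ L) (trans (LP.length-map inj₂ (tuples L b)) (length-tuples L b)))))
            (+-mono-≤ len (^-monoˡ-≤ b len))
          code : ∀ {w} → Szs.Item A u w → ∃ λ c → K w c × c ∈ codes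
          code {w} (_ , inj₁ xw) = inj₁ w , (xw , refl) , ∈-++⁺ˡ (∈-map⁺ inj₁ (mem w xw))
          code {w} (_ , inj₂ (w∉ , _)) = let Z , e = Szs.exact-exists A u w w∉ in
            inj₂ Z , (w∉ , e) , ∈-++⁺ʳ (L.map inj₁ L) (∈-map⁺ inj₂ (∈-tuples L Z (λ y i → mem y ([ inj₁ , proj₁ ]′ (proj₁ (e y) i)))))

        child-bound : ∀ γ {s t} → Star (ChildSt γ) s t → ∃ λ j → j ≤ ⌈log₂ suc n' ⌉ × ReachIn (ChildSt γ) j s t
        child-bound γ p = let j , r = star→reach p in j , short r , r
          where
          nd : St → Tr.Node
          nd (x , Z , _) = x ∷ Z
          shrink : ∀ {j s t} → ReachIn (ChildSt γ) (suc j) s t → 2 ^ suc j ≤ Tr.∣ nd s ∣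
          shrink {s = s} (up {y = m} (_ , ch) here) = ≤-trans (+-mono-≤ pos≥1 (≤-trans (≤-reflexive (+-identityʳ 1)) pos≥1)) (Tr.child-half {nd s} {nd m} ch)
            where
            pos≥1 : 1 ≤ Tr.∣ nd m ∣
            pos≥1 = Tr.child-pos {nd s} {nd m} ch
          shrink {s = s} (up {y = m} (_ , ch) p@(up _ _)) = ≤-trans (+-mono-≤ (shrink p) (≤-trans (≤-reflexive (+-identityʳ _)) (shrink p))) (Tr.child-half {nd s} {nd m} ch)
          short : ∀ {j s t} → ReachIn (ChildSt γ) j s t → j ≤ ⌈log₂ suc n' ⌉
          short {zero}  p = z≤n
          short {suc j} {s} p = 2^j<n⇒j≤log (suc j) (suc n') (≤-trans (shrink p) (<⇒≤ (Tr.∣C∣<n (proj₁ (proj₂ s)) (proj₁ s))))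

      pathBound : ℕ
      pathBound = torsoBound + torsoBound ^ b + ⌈log₂ suc n' ⌉

      module _ (m : ℕ) (enough : pathBound ≤ 2 ^ m) where

        opaque
          base-bound : ∀ γ s t → Star (Base γ) s t → ∃ λ j → j ≤ 2 ^ m × ReachIn (Base γ) j s t
          base-bound γ@(t₁ , t₂ , _) s t p = cases (toℕ t₁ Data.Nat.≟ 0) (toℕ t₂ Data.Nat.≟ 0)
            where
            Goal : Set
            Goal = ∃ λ j → j ≤ 2 ^ m × ReachIn (Base γ) j s t
            torso≤ : torsoBound ≤ 2 ^ m
            torso≤ = ≤-trans (≤-trans (m≤m+n torsoBound (torsoBound ^ b)) (m≤m+n _ ⌈log₂ suc n' ⌉)) enough
            via : ∀ {R : St → St → Set} {c} → (∀ {x y} → Base γ x y → R x y) → (∀ {x y} → R x y → Base γ x y) → c ≤ 2 ^ m →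
                  (∀ {s t} → Star R s t → ∃ λ j → j ≤ c × ReachIn R j s t) → Goal
            via to from l bd = let j , l' , r = bd (Star-map to p) in j , ≤-trans l' l , reach-map from r
            cases : Dec (toℕ t₁ ≡ 0) → Dec (toℕ t₂ ≡ 0) → Goal
            cases (yes a) (yes c) = via {HopSt γ} (λ { (phase₁ _ _ h) → h ; (phase₂ na _ _) → ⊥-elim (na a)
              ; (phase₃ _ nc _) → ⊥-elim (nc c) ; (phase₄ na _ _) → ⊥-elim (na a) })
              (phase₁ a c) torso≤ (hop-bound γ)
            cases (no na) (yes c) = via {MetSt γ} (λ { (phase₁ a _ _) → ⊥-elim (na a) ; (phase₂ _ _ h) → h
              ; (phase₃ a _ _) → ⊥-elim (na a) ; (phase₄ _ nc _) → ⊥-elim (nc c) })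
              (phase₂ na c) torso≤ (met-bound γ)
            cases (yes a) (no nc) = via {SizeSt γ} (λ { (phase₁ _ c _) → ⊥-elim (nc c) ; (phase₂ na _ _) → ⊥-elim (na a)
              ; (phase₃ _ _ h) → h ; (phase₄ na _ _) → ⊥-elim (na a) })
              (phase₃ a nc) (≤-trans (m≤m+n _ ⌈log₂ suc n' ⌉) enough) (size-bound γ)
            cases (no na) (no nc) = via {ChildSt γ} (λ { (phase₁ a _ _) → ⊥-elim (na a) ; (phase₂ _ c _) → ⊥-elim (nc c)
              ; (phase₃ a _ _) → ⊥-elim (na a) ; (phase₄ _ _ h) → h })
              (phase₄ na nc) (≤-trans (m≤n+m ⌈log₂ suc n' ⌉ _) enough) (child-bound γ)

        Sᵢ : Env-Ω → TStr (suc n') Voc₂ sig₂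
        Sᵢ W work₂    ρ = W ρ
        Sᵢ W baseStep ρ = Φ W ρ

        module _ (W : ℕ → Env-Ω) (W-zero : ∀ ρ → ¬ W 0 ρ) (W-suc : ∀ i ρ → W (suc i) ρ ⟺ ⟪ iterF ⟫ (Sᵢ (W i)) ρ) where

          private
            Bᵢ Rᵢ Φᵢ : ℕ → Params → St → St → Set
            Bᵢ i γ s t = Σ V λ f → ¬ toℕ f ≡ 0 × W i (wenv f γ s t)
            Rᵢ i γ s t = W i (wenv zero γ s t)
            Φᵢ i γ s t = Φ (W i) (ρΦ γ s t)

            Joined : ℕ → Params → St → St → Set
            Joined i γ s@(x , Z , z , _) t@(x' , Z' , z' , _) = Φᵢ i γ s t ⊎ (x ≡ x' × Z ≡ Z' × z ≡ z') ⊎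
              Σ V λ y → Σ (Vec V b) λ U → Σ V λ v → Rᵢ i γ s (y , U , v , tt) × Rᵢ i γ (y , U , v , tt) t

            state-≡ : ∀ {x x' : V} {Z Z' : Vec V b} {z z' : V} → x ≡ x' × Z ≡ Z' × z ≡ z' → _≡_ {A = St} (x , Z , z , tt) (x' , Z' , z' , tt)
            state-≡ (refl , refl , refl) = refl

            copy-suc : ∀ i γ s t → Bᵢ (suc i) γ s t ⟺ Φᵢ i γ s t
            copy-suc i γ s t = to , λ φ → one , one≢0 , proj₂ (W-suc i (wenv one γ s t)) (inj₁ (one≢0 , φ))
              where
              to : Bᵢ (suc i) γ s t → Φᵢ i γ s t
              to (f , f≢0 , w) = [ proj₂ , (λ (z , _) → ⊥-elim (f≢0 z)) ]′ (proj₁ (W-suc i (wenv f γ s t)) w)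

            closure-suc : ∀ i γ s t → Rᵢ (suc i) γ s t ⟺
              ((∀ s' t' → Φᵢ i γ s' t' ⟺ Bᵢ i γ s' t') × (Φᵢ i γ s t ⊎ s ≡ t ⊎ ∃ λ m → Rᵢ i γ s m × Rᵢ i γ m t))
            closure-suc i γ s@(x , Z , z , _) t@(x' , Z' , z' , _) = ⟺-trans (W-suc i (wenv zero γ s t)) (to , from)
              where
              to : ⟪ iterF ⟫ (Sᵢ (W i)) (wenv zero γ s t) →
                (∀ s' t' → Φᵢ i γ s' t' ⟺ Bᵢ i γ s' t') × (Φᵢ i γ s t ⊎ s ≡ t ⊎ ∃ λ m → Rᵢ i γ s m × Rᵢ i γ m t)
              to (inj₁ (ne , _)) = ⊥-elim (ne refl)
              to (inj₂ (_ , g , c)) = (λ (a₁ , a₂ , a₃ , _) (a₄ , a₅ , a₆ , _) → g a₁ a₂ a₃ a₄ a₅ a₆) , cl c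
                where
                cl : Joined i γ s t → Φᵢ i γ s t ⊎ s ≡ t ⊎ ∃ λ m → Rᵢ i γ s m × Rᵢ i γ m t
                cl (inj₁ φ) = inj₁ φ
                cl (inj₂ (inj₁ e)) = inj₂ (inj₁ (state-≡ e))
                cl (inj₂ (inj₂ (a₁ , a₂ , a₃ , p , q))) = inj₂ (inj₂ ((a₁ , a₂ , a₃ , tt) , p , q))
              from : (∀ s' t' → Φᵢ i γ s' t' ⟺ Bᵢ i γ s' t') × (Φᵢ i γ s t ⊎ s ≡ t ⊎ ∃ λ m → Rᵢ i γ s m × Rᵢ i γ m t) →
                ⟪ iterF ⟫ (Sᵢ (W i)) (wenv zero γ s t)
              from (g , c) = inj₂ (refl , (λ a₁ a₂ a₃ a₄ a₅ a₆ → g (a₁ , a₂ , a₃ , tt) (a₄ , a₅ , a₆ , tt)) , cl c)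
                where
                cl : Φᵢ i γ s t ⊎ s ≡ t ⊎ (∃ λ m → Rᵢ i γ s m × Rᵢ i γ m t) → Joined i γ s t
                cl (inj₁ φ) = inj₁ φ
                cl (inj₂ (inj₁ refl)) = inj₂ (inj₁ (refl , refl , refl))
                cl (inj₂ (inj₂ ((a₁ , a₂ , a₃ , _) , p , q))) = inj₂ (inj₂ (a₁ , a₂ , a₃ , p , q))

          opaque
            -- Ranks 0 to 3 make four blocks of `m + 3` rounds.
            converged : ∀ i → 4 * (m + 3) ≤ i → Correct 4 (W i)
            converged i l γ r<4 s t = Iterate.converges Bᵢ Rᵢ Φᵢ (λ (f , _ , w) → W-zero _ w) (W-zero _) copy-suc closure-suc
              Base rank (λ i γ ok → Φ-base (W i) γ ok) m base-bound 3 γ (s≤s⁻¹ r<4) i l s t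

      -- The compiled program computes the intended relations

      module Step (a₀ b₀ : ℕ) {A : Run.AuxState (program a₀ b₀) (suc n')} (A? : ∀ s t → Dec (A s t))
        (conn-inv : ∀ B u v → A #conn (flat (sig conn₀) (B , u , v , tt)) ⟺ conn E B u v)
        (size-inv : ∀ B u z → A #size (flat (sig size₀) (B , u , z , tt)) ⟺ (toℕ z ≡ compSize E? B u))
        (edge-inv : ∀ x y → A #edge (x ∷ y ∷ []) ⟺ E x y)
        (cl-inv : ∀ x y → A #closure (x ∷ y ∷ []) ⟺ Cl x y)
        where

        open Run (program a₀ b₀)

        Work : ℕ → Vec V (size Ω) → Set
        Work i = iterW i stepForm E' D A

        U : ℕ → Structure (suc n') (USym 4) USig
        U i = ustr E' D A (Work i)

        W : ℕ → Env (suc n') Ω → Set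
        W i ρ = Work i (flat Ω ρ)

        opaque
          Work? : ∀ i t → Dec (Work i t)
          Work? zero    t = no λ ()
          Work? (suc i) t = dec⟦⟧ (ustr? (program a₀ b₀) E'? D? A? (Work? i)) stepForm t

          U? : ∀ i {v} (φ : Form (USym 4) USig v) ρ → Dec (⟦ φ ⟧ (U i) ρ)
          U? i φ ρ = dec⟦⟧ (ustr? (program a₀ b₀) E'? D? A? (Work? i)) φ ρ

        atom-ok : ∀ {v} (Γ : Ctx) {R : Vec V (size Γ) → Set} {Q : Env (suc n') Γ → Set} →
                  (∀ ρ → R (flat Γ ρ) ⟺ Q ρ) → (p : Env v Γ) (ρ : Vec V v) →
                  R (V.map (lookup ρ) (flat Γ p)) ⟺ Q (mapE Γ (lookup ρ) p)
        atom-ok Γ {R} {Q} h p ρ = subst (λ t → R t ⟺ Q (mapE Γ (lookup ρ) p)) (sym (map-flat Γ (lookup ρ) p)) (h _)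

        opaque
          compiled : ∀ i (I : Int Voc sig) (S : Str) → Interprets {A = U i} I S → ∀ {Γ v} (p : Env v Γ) (φ : F Γ) (ρ : Vec V v) →
                     ⟦ cmp I p φ ⟧ (U i) ρ ⟺ ⟪ φ ⟫ S (mapE Γ (lookup ρ) p)
          compiled i I S ok {Γ} p φ ρ = cmp-correct {USym 4} {USig} {suc n'} {U i} {Voc} {sig} I S ok (U? i) {Γ} p φ ρ

          int₀-ok : ∀ i → Interprets {A = U i} int₀ (S₀ (W i))
          int₀-ok i edge'    = atom-ok (sig edge') {U i edge} {λ (x , y , _) → E' x y} (λ _ → ⟺-refl)
          int₀-ok i change   = atom-ok (sig change) {U i chg} {λ (x , y , _) → D x y} (λ _ → ⟺-refl)
          int₀-ok i edge₀    = atom-ok (sig edge₀) {A #edge} (λ (x , y , _) → edge-inv x y)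
          int₀-ok i conn₀    = atom-ok (sig conn₀) {A #conn} (λ (B , u , v , _) → conn-inv B u v)
          int₀-ok i size₀    = atom-ok (sig size₀) {A #size} (λ (B , u , z , _) → size-inv B u z)
          int₀-ok i closure₀ = atom-ok (sig closure₀) {A #closure} (λ (x , y , _) → cl-inv x y)
          int₀-ok i work     = atom-ok Ω {Work i} {W i} (λ _ → ⟺-refl)
          int₀-ok i conn' p ρ = falseF-correct {A = U i} ρ , ⊥-elim
          int₀-ok i met   p ρ = falseF-correct {A = U i} ρ , ⊥-elim
          int₀-ok i size' p ρ = falseF-correct {A = U i} ρ , ⊥-elim
          int₀-ok i node' p ρ = falseF-correct {A = U i} ρ , ⊥-elim

          int₁-ok : ∀ i → Interprets {A = U i} int₁ (S₁ (W i))
          int₁-ok i (base R) = int₀-ok i (base R)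
          int₁-ok i conn' p ρ = compiled i int₀ (S₀ (W i)) (int₀-ok i) p connF ρ
          int₁-ok i met   p ρ = compiled i int₀ (S₀ (W i)) (int₀-ok i) p metF ρ
          int₁-ok i size'    = int₀-ok i size'
          int₁-ok i node'    = int₀-ok i node'

          int₂-ok : ∀ i → Interprets {A = U i} int₂ (S₂ (W i))
          int₂-ok i (base R) = int₁-ok i (base R)
          int₂-ok i conn'    = int₁-ok i conn'
          int₂-ok i met      = int₁-ok i met
          int₂-ok i size' p ρ = compiled i int₁ (S₁ (W i)) (int₁-ok i) p sizeF ρ
          int₂-ok i node'    = int₁-ok i node'

          int₃-ok : ∀ i → Interprets {A = U i} int₃ (S₃ (W i))
          int₃-ok i (base R) = int₂-ok i (base R)
          int₃-ok i conn'    = int₂-ok i conn'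
          int₃-ok i met      = int₂-ok i met
          int₃-ok i size'    = int₂-ok i size'
          int₃-ok i node' p ρ = compiled i int₀ (S₀ (W i)) (int₀-ok i) p nodeF ρ

        module _ (m : ℕ) (enough : pathBound ≤ 2 ^ m) (many : 4 * (m + 3) ≤ iterations (suc n')) where

          N : ℕ
          N = iterations (suc n')

          opaque
            baseStep-ok : ∀ i {v} (p : Env v ΩΦ) (ρ : Vec V v) →
              ⟦ phaseForm (proj₁ p) (proj₁ (proj₂ p)) (cmp int₀ p hopStep) (cmp int₀ p metStep) (cmp int₁ p sizeStep) (cmp int₂ p childStep) ⟧ (U i) ρ
              ⟺ Φ (W i) (mapE ΩΦ (lookup ρ) p)
            baseStep-ok i p ρ = ⟺-trans
              {Q = Phase (lookup ρ (proj₁ p)) (lookup ρ (proj₁ (proj₂ p))) (⟦ cmp int₀ p hopStep ⟧ (U i) ρ) (⟦ cmp int₀ p metStep ⟧ (U i) ρ)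
                     (⟦ cmp int₁ p sizeStep ⟧ (U i) ρ) (⟦ cmp int₂ p childStep ⟧ (U i) ρ)}
              (phaseForm-correct {USym 4} {USig} {suc n'} {_} {U i} (proj₁ p) (proj₁ (proj₂ p))
                (cmp int₀ p hopStep) (cmp int₀ p metStep) (cmp int₁ p sizeStep) (cmp int₂ p childStep) ρ)
              (Φ-cong (W i) (mapE ΩΦ (lookup ρ) p) {⟦ cmp int₀ p hopStep ⟧ (U i) ρ} {⟦ cmp int₀ p metStep ⟧ (U i) ρ}
                {⟦ cmp int₁ p sizeStep ⟧ (U i) ρ} {⟦ cmp int₂ p childStep ⟧ (U i) ρ} h₁ h₂ (λ _ _ → h₃) (λ _ _ → h₄))
              where
              h₁ : ⟦ cmp int₀ p hopStep ⟧ (U i) ρ ⟺ ⟪ hopStep ⟫ (S₀ (W i)) (mapE ΩΦ (lookup ρ) p)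
              h₁ = compiled i int₀ (S₀ (W i)) (int₀-ok i) {ΩΦ} p hopStep ρ
              h₂ : ⟦ cmp int₀ p metStep ⟧ (U i) ρ ⟺ ⟪ metStep ⟫ (S₀ (W i)) (mapE ΩΦ (lookup ρ) p)
              h₂ = compiled i int₀ (S₀ (W i)) (int₀-ok i) {ΩΦ} p metStep ρ
              h₃ : ⟦ cmp int₁ p sizeStep ⟧ (U i) ρ ⟺ ⟪ sizeStep ⟫ (S₁ (W i)) (mapE ΩΦ (lookup ρ) p)
              h₃ = compiled i int₁ (S₁ (W i)) (int₁-ok i) {ΩΦ} p sizeStep ρ
              h₄ : ⟦ cmp int₂ p childStep ⟧ (U i) ρ ⟺ ⟪ childStep ⟫ (S₂ (W i)) (mapE ΩΦ (lookup ρ) p)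
              h₄ = compiled i int₂ (S₂ (W i)) (int₂-ok i) {ΩΦ} p childStep ρ

            intᵢ-ok : ∀ i → Interprets {A = U i} intᵢ (Sᵢ m enough (W i))
            intᵢ-ok i work₂    = int₀-ok i work
            intᵢ-ok i baseStep = baseStep-ok i

            W-suc : ∀ i ρ → W (suc i) ρ ⟺ ⟪ iterF ⟫ (Sᵢ m enough (W i)) ρ
            W-suc i ρ = subst (λ ρ' → W (suc i) ρ ⟺ ⟪ iterF ⟫ (Sᵢ m enough (W i)) ρ') (flat-pos Ω ρ)
              (cmp-correct {USym 4} {USig} {suc n'} {U i} {Voc₂} {sig₂} intᵢ (Sᵢ m enough (W i)) (intᵢ-ok i) (U? i) {Ω} (pos Ω) iterF (flat Ω ρ))

            correct : Correct 4 (W N)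
            correct = converged m enough W (λ ρ ()) W-suc N many

            out-ok : ∀ {Γ} (φ : F Γ) ρ → ⟦ cmp int₃ (pos Γ) φ ⟧ (U N) (flat Γ ρ) ⟺ ⟪ φ ⟫ (I₃ (W N)) ρ
            out-ok {Γ} φ ρ = ⟺-trans (compiled N int₃ (S₃ (W N)) (int₃-ok N) {Γ} (pos Γ) φ (flat Γ ρ))
              (subst (λ ρ' → ⟪ φ ⟫ (S₃ (W N)) ρ' ⟺ ⟪ φ ⟫ (I₃ (W N)) ρ) (sym (flat-pos Γ ρ)) (Fm-cong (S₃-ok (W N) correct) φ ρ))

            not-trivial : ∀ {v} (ρ : Vec V v) → ¬ ⟦ trivialF ⟧ (U N) ρ
            not-trivial ρ h = one≢0 (proj₁ (zeroF-correct {A = U N} (one ∷ ρ) zero) (h one))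

          A' : AuxState (suc n')
          A' s = ⟦ outForm s ⟧ (U N)

          node-out : ∀ x → A' node x ⟺ Tr.Active x
          node-out (v ∷ Z) = (λ { (inj₁ h) → proj₁ (out-ok (outF node) (v , Z , tt)) h ; (inj₂ t) → ⊥-elim (not-trivial (v ∷ Z) t) })
                           , (λ a → inj₁ (proj₂ (out-ok (outF node) (v , Z , tt)) a))

          opaque
            unfolding Build.Good

            par-out : ∀ x y → A' par (x ++ y) ⟺ Tr.Par x y
            par-out (v' ∷ Z') (v ∷ Z) = (λ (h , _) → proj₁ (out-ok (outF par) (v' , Z' , v , Z , tt)) h)
                                      , (λ a → proj₂ (out-ok (outF par) (v' , Z' , v , Z , tt)) a , not-trivial ((v' ∷ Z') ++ (v ∷ Z)))

            bag-out : ∀ t x → A' bag (x ∷ t) ⟺ Tr.Bag t x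
            bag-out (v ∷ Z) x = (λ { (inj₁ h) → proj₁ (out-ok (outF bag) (x , v , Z , tt)) h ; (inj₂ t) → ⊥-elim (not-trivial (x ∷ v ∷ Z) t) })
                              , (λ a → inj₁ (proj₂ (out-ok (outF bag) (x , v , Z , tt)) a))

            closure-out : ∀ x y → A' #closure (x ∷ y ∷ []) ⟺ Tr.Closure x y
            closure-out x y = out-ok (outF #closure) (x , y , tt)

          encodes : EncodesTD (E' , A') (ss k) ⌈log₂ suc n' ⌉
          encodes = Tr.root
            , TD-cong (λ x → ⟺-sym (node-out x)) (λ x y → ⟺-sym (par-out x y)) (λ t x → ⟺-sym (bag-out t x)) Tr.isTD
            , (λ t a → let L , l , h = Tr.width-bound t (proj₁ (node-out t) a) in L , l , λ v c → h v (proj₁ (bag-out t v) c))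
            , (λ t a → let j , l , p = Tr.depth-bound (proj₁ (node-out t) a) in j , l , reach-map (λ {x} {y} → proj₂ (par-out x y)) p)

          inv' : cb ≡ suc (⌈log₂ suc n' ⌉ * suc (ss k)) → Inv a₀ b₀ cb E' A'
          inv' cb≡ = record
            { E? = E'? ; E-sym = E'-sym ; E-irr = E'-irr
            ; A? = λ s t → U? N (outForm s) t
            ; conn-inv = λ B u v → out-ok (outF #conn) (B , u , v , tt)
            ; size-inv = λ B u z → out-ok (outF #size) (B , u , z , tt)
            ; edge-inv = λ x y → out-ok (outF #edge) (x , y , tt)
            ; cl-refl = λ x → proj₂ (closure-out x x) (inj₁ refl)
            ; cl-sep = λ M? w w≢0 h →
                let Y , Y⊆ , av = Tr.closure-separates M? w w≢0 (λ m m∈ c → h m m∈ (proj₂ (closure-out m w) c)) in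
                Y , (λ y i → [ inj₁ , (λ (m , m∈ , c) → inj₂ (m , m∈ , proj₂ (closure-out m y) c)) ]′ (Y⊆ y i))
                  , (λ x p m m∈ c → av x p m m∈ (proj₁ (closure-out m x) c))
            ; cl-list = λ x → let L , l , h = Tr.closure-bound x in
                L , subst (length L ≤_) (sym cb≡) l , λ y c → h y (proj₁ (closure-out x y) c) }

          advanced : cb ≡ suc (⌈log₂ suc n' ⌉ * suc (ss k)) → Inv a₀ b₀ cb E' A' × Encodes E' A' (ss k) ⌈log₂ suc n' ⌉
          advanced e = inv' e , encodes

  Encodes-mono : ∀ {n} {E : Graph n} (A : Aux n) {wd wd' dp dp'} → wd ≤ wd' → dp ≤ dp' → Encodes E A wd dp → Encodes E A wd' dp'
  Encodes-mono A w d (root , td , wb , db) = root , td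
    , (λ t a → let L , l , h = wb t a in L , ≤-trans l (s≤s w) , h)
    , (λ x a → let j , l , p = db x a in j , ≤-trans l d , p)

  -- A single vertex offers no nonzero selector, so here the output formulas fall back to constants;
  -- all nodes are equal and one bag covers everything.
  encodes-one : ∀ {E : Graph 1} (A : Aux 1) {wd dp} → (∀ {x} → ¬ E x x) →
                (∀ t → A node t) → (∀ t → ¬ A par t) → (∀ t → A bag t) → Encodes E A wd dp
  encodes-one {E} A irr hn hp hb = zeros
    , record
      { par-node = λ p → ⊥-elim (hp _ p) ; par-fun = λ p → ⊥-elim (hp _ p) ; root-node = hn _
      ; root-noParent = hp _ ; reach-root = λ {x} _ → 0 , subst (λ t → ReachIn _ 0 t zeros) (sym (unique x)) here
      ; bag-node = λ _ → hn _ ; cover-vertex = λ v → zeros , hb _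
      ; cover-edge = λ {u} {v} e → zeros , hb _ , hb _
      ; connected = λ {v} {s} {t} _ _ → subst (Walk _ _ s) (trans (unique s) (sym (unique t))) (stop (hb _)) }
    , (λ t _ → zero ∷ [] , s≤s z≤n , λ { zero _ → here refl })
    , (λ x _ → 0 , z≤n , subst (λ t → ReachIn _ 0 t zeros) (sym (unique x)) here)
    where
    unique : ∀ {q} (x : Vec (Fin 1) q) → x ≡ zeros
    unique x = zeros-unique x (λ { zero _ → refl })

  Zeros : ∀ {n q} → Vec (Fin n) q → Set
  Zeros Z = ∀ x → In x Z → toℕ x ≡ 0

  -- Initial data

  module Init {n' : ℕ} {Sym : Set} {ar : Sym → ℕ} (U : Structure (suc n') Sym ar)
              (U? : ∀ {v} (φ : Form Sym ar v) ρ → Dec (⟦ φ ⟧ U ρ)) where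

    V : Set
    V = Fin (suc n')

    noS : TStr (suc n') ⊥ noSig
    noS ()

    init-ok : ∀ {Γ} (φ : Fm ⊥ noSig Γ) ρ → ⟦ cmp noInt (pos Γ) φ ⟧ U (flat Γ ρ) ⟺ ⟪ φ ⟫ noS ρ
    init-ok {Γ} φ ρ = subst (λ ρ' → ⟦ cmp noInt (pos Γ) φ ⟧ U (flat Γ ρ) ⟺ ⟪ φ ⟫ noS ρ') (flat-pos Γ ρ)
      (cmp-correct noInt noS (λ ()) U? (pos Γ) φ (flat Γ ρ))

    A₀ : Aux (suc n')
    A₀ s = ⟦ initForm s ⟧ U

    Node₀ : Vec V (suc b) → Set
    Node₀ (v ∷ Z) = Zeros Z

    Par₀ : Vec V (suc b) → Vec V (suc b) → Set
    Par₀ (v' ∷ Z') (v ∷ Z) = Zeros Z' × Zeros Z × ¬ toℕ v' ≡ 0 × toℕ v ≡ 0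

    Bag₀ : Vec V (suc b) → V → Set
    Bag₀ (v ∷ Z) x = Zeros Z × x ≡ v

    root₀ : Vec V (suc b)
    root₀ = zero ∷ zeros

    at : ∀ {v : V} {Z : Vec V b} → Zeros Z → _≡_ {A = Vec V (suc b)} (v ∷ Z) (v ∷ zeros)
    at {v} {Z} z = cong (v ∷_) (zeros-unique Z z)

    depth₀ : ∀ x → Node₀ x → ∃ λ j → j ≤ ⌈log₂ suc n' ⌉ × ReachIn Par₀ j x root₀
    depth₀ (zero ∷ Z) z = 0 , z≤n , subst (λ t → ReachIn Par₀ 0 t root₀) (sym (at z)) here
    depth₀ (suc v ∷ Z) z = 1 , 2^j<n⇒j≤log 1 (suc n') (≤-trans (s≤s (s≤s z≤n)) (FP.toℕ<n (suc v)))
                         , up {y = root₀} (z , (λ x i → In-zeros b i) , (λ ()) , refl) here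

    star : ∀ {E : Graph (suc n')} → (∀ {x y} → ¬ E x y) → IsTreeDecomposition E Node₀ Par₀ Bag₀ root₀
    star no-edge = record
      { par-node      = λ { {v' ∷ Z'} {v ∷ Z} (z' , z , _) → z' , z }
      ; par-fun       = λ { {v' ∷ Z'} {v₁ ∷ Z₁} {v₂ ∷ Z₂} (_ , z₁ , _ , e₁) (_ , z₂ , _ , e₂) →
                          trans (at z₁) (trans (cong (_∷ zeros) (trans (is-zero e₁) (sym (is-zero e₂)))) (sym (at z₂))) }
      ; root-node     = λ x i → In-zeros b i
      ; root-noParent = λ { {v ∷ Z} (_ , _ , ne , _) → ne refl }
      ; reach-root    = λ {x} a → let j , _ , p = depth₀ x a in j , p
      ; bag-node      = λ { {v ∷ Z} (z , _) → z }
      ; cover-vertex  = λ v → (v ∷ zeros) , (λ x i → In-zeros b i) , refl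
      ; cover-edge    = λ e → ⊥-elim (no-edge e)
      ; connected     = λ { {x} {v ∷ Z} {u ∷ Y} (z , refl) (y , refl) →
                          subst (Walk Par₀ (λ t → Bag₀ t x) (x ∷ Z)) (trans (at z) (sym (at y))) (stop (z , refl)) }
      }

    node₀ : ∀ x → A₀ node x ⟺ Node₀ x
    node₀ (v ∷ Z) = init-ok (initF node) (v , Z , tt)

    par₀ : ∀ x y → A₀ par (x ++ y) ⟺ Par₀ x y
    par₀ (v' ∷ Z') (v ∷ Z) = init-ok (initF par) (v' , Z' , v , Z , tt)

    bag₀ : ∀ t x → A₀ bag (x ∷ t) ⟺ Bag₀ t x
    bag₀ (v ∷ Z) x = init-ok (initF bag) (x , v , Z , tt)

    encodes₀ : ∀ {E : Graph (suc n')} → (∀ {x y} → ¬ E x y) → Encodes E A₀ 0 ⌈log₂ suc n' ⌉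
    encodes₀ no-edge = root₀
      , TD-cong (λ x → ⟺-sym (node₀ x)) (λ x y → ⟺-sym (par₀ x y)) (λ t x → ⟺-sym (bag₀ t x)) (star no-edge)
      , (λ { (v ∷ Z) a → v ∷ [] , s≤s z≤n , λ x c → here (proj₂ (proj₁ (bag₀ (v ∷ Z) x) c)) })
      , (λ x a → let j , l , p = depth₀ x (proj₁ (node₀ x) a) in j , l , reach-map (λ {x} {y} → proj₂ (par₀ x y)) p)

    empty : Graph (suc n')
    empty _ _ = ⊥

    conn-empty : ∀ {q} {B : Vec V q} {u v} → conn empty B u v ⟺ (¬ In u B × u ≡ v)
    conn-empty = (λ { (start a) → a , refl }) , (λ { (a , refl) → start a })

    empty? : ∀ x y → Dec (empty x y)
    empty? x y = no λ ()

    size-empty : ∀ (B : Vec V b) u z →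
      ((¬ In u B × One z) ⊎ (In u B × ((toℕ u ≡ 0 × Zeros B × (∀ x → toℕ x ≤ toℕ z)) ⊎ (¬ (toℕ u ≡ 0 × Zeros B) × toℕ z ≡ 0))))
      ⟺ (toℕ z ≡ compSize empty? B u)
    size-empty B u z = cases (In? u B) (toℕ u Data.Nat.≟ 0) (FP.all? (λ x → In? x B →-dec (toℕ x Data.Nat.≟ 0)))
      where
      Size = compSize empty? B u
      Goal = ((¬ In u B × One z) ⊎ (In u B × ((toℕ u ≡ 0 × Zeros B × (∀ x → toℕ x ≤ toℕ z)) ⊎ (¬ (toℕ u ≡ 0 × Zeros B) × toℕ z ≡ 0))))
             ⟺ (toℕ z ≡ Size)
      none : In u B → ¬ (toℕ u ≡ 0 × Zeros B) → Size ≡ 0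
      none i h = count-none (comp? empty? B u) λ
        { w (inj₁ c) → proj₁ (proj₁ conn-empty c) i
        ; w (inj₂ (e , _ , full)) → h (e , λ x j → decidable-stable (toℕ x Data.Nat.≟ 0) (λ x≢0 → proj₂ (proj₂ (full x (j , x≢0))))) }
      zero-case : In u B → ¬ (toℕ u ≡ 0 × Zeros B) → Goal
      zero-case i h = (λ { (inj₁ (u∉ , _)) → ⊥-elim (u∉ i) ; (inj₂ (_ , inj₁ (e , zs , _))) → ⊥-elim (h (e , zs))
                         ; (inj₂ (_ , inj₂ (_ , e))) → trans e (sym (none i h)) }) , (λ e → inj₂ (i , inj₂ (h , trans e (none i h))))
      cases : Dec (In u B) → Dec (toℕ u ≡ 0) → Dec (Zeros B) → Goal
      cases (no u∉) _ _ = (λ { (inj₁ (_ , o)) → trans (proj₁ (One-correct z) o) (sym one-size) ; (inj₂ (i , _)) → ⊥-elim (u∉ i) })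
                        , (λ e → inj₁ (u∉ , proj₂ (One-correct z) (trans e one-size)))
        where
        one-size : Size ≡ 1
        one-size = count-one (comp? empty? B u) u λ w →
          (λ { (inj₁ c) → sym (proj₂ (proj₁ conn-empty c)) ; (inj₂ (e , _)) → ⊥-elim (u∉ (In-0 B e)) }) , (λ { refl → inj₁ (start u∉) })
      cases (yes i) (yes e) (yes zs) = (λ { (inj₁ (u∉ , _)) → ⊥-elim (u∉ i) ; (inj₂ (_ , inj₁ (_ , _ , h))) → trans (top h) (sym all-size)
                                          ; (inj₂ (_ , inj₂ (h , _))) → ⊥-elim (h (e , zs)) })
                                     , (λ e' → inj₂ (i , inj₁ (e , zs , λ x → ≤-trans (s≤s⁻¹ (FP.toℕ<n x)) (≤-reflexive (sym (trans e' all-size))))))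
        where
        top : (∀ x → toℕ x ≤ toℕ z) → toℕ z ≡ n'
        top h = ≤-antisym (s≤s⁻¹ (FP.toℕ<n z)) (≤-trans (≤-reflexive (sym (FP.toℕ-fromℕ n'))) (h (Data.Fin.fromℕ n')))
        all-size : Size ≡ n'
        all-size = suc-injective (trans (cong (_+ Size) (sym (count-one (λ x → toℕ x Data.Nat.≟ 0) zero (λ x → is-zero , cong toℕ))))
          (trans (sym (count-⊎ (λ x → toℕ x Data.Nat.≟ 0) (comp? empty? B u) (λ x → yes tt) (λ x e' c → InC-nonzero c e')
            (λ x → (λ _ → split x (toℕ x Data.Nat.≟ 0)) , (λ _ → tt)))) (count-all {P = λ _ → ⊤} (λ x → yes tt) (λ _ → tt))))
          where
          split : ∀ x → Dec (toℕ x ≡ 0) → toℕ x ≡ 0 ⊎ InC (conn empty B) empty B u x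
          split x (yes e') = inj₁ e'
          split x (no x≢0) = inj₂ (inj₂ (e , (λ j → x≢0 (zs x j)) , λ a (j , a≢0) → ⊥-elim (a≢0 (zs a j))))
      cases (yes i) (no u≢0) _ = zero-case i (λ (e , _) → u≢0 e)
      cases (yes i) (yes _) (no nz) = zero-case i (λ (_ , zs) → nz zs)

    inv₀ : ∀ a₀ b₀ cb → 1 ≤ cb → Inv a₀ b₀ cb empty A₀
    inv₀ a₀ b₀ cb 1≤cb = record
      { E? = empty? ; E-sym = λ () ; E-irr = λ () ; A? = λ s t → U? (initForm s) t
      ; conn-inv = λ B u v → ⟺-trans (init-ok (initF #conn) (B , u , v , tt)) (⟺-sym conn-empty)
      ; size-inv = λ B u z → ⟺-trans (init-ok (initF #size) (B , u , z , tt)) (size-empty B u z)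
      ; edge-inv = λ x y → ⟺-trans (init-ok (initF #edge) (x , y , tt)) ((λ h → h refl) , ⊥-elim)
      ; cl-refl = λ x → proj₂ (closure-init x x) refl
      ; cl-sep = λ {M} M? w w≢0 h → zeros , (λ y i → inj₁ (In-zeros b i)) , λ x c m m∈ cl →
          h m m∈ (subst (λ y → closureRel a₀ b₀ A₀ m y) (sym (proj₂ (proj₁ conn-empty c))) cl)
      ; cl-list = λ x → x ∷ [] , 1≤cb , λ y c → here (proj₁ (closure-init x y) c) }
      where
      closure-init : ∀ x y → A₀ #closure (x ∷ y ∷ []) ⟺ (y ≡ x)
      closure-init x y = init-ok (initF #closure) (x , y , tt)

  -- Number of rounds and induction over the changes

  module Program (c' : ℕ) where


    cb tb path : ℕ → ℕ
    cb ℓ = suc (ℓ * suc b)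
    tb ℓ = ℓ ^ c' + ℓ ^ c'
    path ℓ = torso + torso ^ b + ℓ
      where
      torso : ℕ
      torso = suc ((tb ℓ + (suc b + 2)) * cb ℓ)

    path-poly : PolyBounded path
    path-poly = poly-+ (poly-+ torso-poly (poly-^ torso-poly b)) poly-id
      where
      torso-poly : PolyBounded (λ ℓ → suc ((tb ℓ + (suc b + 2)) * cb ℓ))
      torso-poly = poly-+ (poly-const 1) (poly-* (poly-+ (poly-+ (poly-^ poly-id c') (poly-^ poly-id c')) (poly-const (suc b + 2)))
        (poly-+ (poly-const 1) (poly-* poly-id (poly-const (suc b)))))

    -- Paths have length at most `2 ^ m` for `m = (1 + log ℓ) * e`, and the four ranks take
    -- `4 * (m + 3)` rounds, which equals `4 * e * log ℓ + (4 * e + 12)`.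
    e a₀ b₀ : ℕ
    e = proj₁ path-poly
    a₀ = 4 * e
    b₀ = 4 * e + 12

    P : DynProg
    P = program a₀ b₀

    open Run P

    enough-rounds : ∀ n → 4 * ((1 + ⌈log₂ ⌈log₂ n ⌉ ⌉) * e + 3) ≤ iterations n
    enough-rounds n = ≤-reflexive (solve 2 (λ l e → con 4 :* ((con 1 :+ l) :* e :+ con 3) := con 4 :* e :* l :+ (con 4 :* e :+ con 12)) refl ⌈log₂ ⌈log₂ n ⌉ ⌉ e)
      where open +-*-Solver

    edgeless : ∀ {n} → Graph n
    edgeless _ _ = ⊥

    initial : ∀ {n'} → Encodes {suc n'} edgeless (λ s → ⟦ initForm s ⟧ noStr) b ⌈log₂ suc n' ⌉
    initial = Encodes-mono (λ s → ⟦ initForm s ⟧ noStr) z≤n ≤-refl (Init.encodes₀ noStr (dec⟦⟧ λ ()) λ ())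

    changed : ∀ {n} → Change n → Graph n → Graph n
    changed c E = proj₁ (step c (E , λ _ _ → ⊥))

    irr-step : ∀ {n B} {E : Graph n} (c : Change n) → ValidChange B c → (∀ {x} → ¬ E x x) → ∀ {x} → ¬ changed c E x x
    irr-step (ins L) (_ , ne) irr = [ irr , InΔ-irr ne ]′
    irr-step (del L) (_ , ne) irr (h , _) = irr h

    one-vertex : ∀ cs {S : State 1} {B wd dp} → All (ValidChange B) cs → (∀ {x} → ¬ proj₁ S x x) → Encodes (proj₁ S) (proj₂ S) wd dp →
                 Encodes (proj₁ (runFrom S cs)) (proj₂ (runFrom S cs)) wd dp
    one-vertex [] _ irr enc = enc
    one-vertex (c@(ins L) ∷ cs) {S} (v All.∷ valid) irr enc = one-vertex cs valid (irr-step {E = proj₁ S} c v irr)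
      (encodes-one (proj₂ (step c S)) (irr-step {E = proj₁ S} c v irr)
      (λ t → inj₂ λ { zero _ → z≤n }) (λ t (_ , h) → h λ { zero _ → z≤n }) (λ t → inj₂ λ { zero _ → z≤n }))
    one-vertex (c@(del L) ∷ cs) {S} (v All.∷ valid) irr enc = one-vertex cs valid (irr-step {E = proj₁ S} c v irr)
      (encodes-one (proj₂ (step c S)) (irr-step {E = proj₁ S} c v irr)
      (λ t → inj₂ λ { zero _ → z≤n }) (λ t (_ , h) → h λ { zero _ → z≤n }) (λ t → inj₂ λ { zero _ → z≤n }))

    module _ {n'' : ℕ} where

      private
        n ℓ : ℕ
        n = suc (suc n'')
        ℓ = ⌈log₂ n ⌉

      1≤ℓ : 1 ≤ ℓ
      1≤ℓ = 2^j<n⇒j≤log 1 n (s≤s (s≤s z≤n))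

      -- Insertions and deletions are treated alike: it matters only that both graphs agree outside
      -- the changed pairs `D`.
      advance : ∀ {E E' D : Graph n} {A : AuxState n} → Inv a₀ b₀ (cb ℓ) E A →
        (∀ x y → Dec (E' x y)) → (∀ x y → Dec (D x y)) → (∀ {x y} → E' x y → E' y x) →
        (∀ {x y} → ¬ D x y → E x y ⟺ E' x y) → (∀ {x} → ¬ E' x x) → TreewidthAtMost k E' →
        ∀ touched → length touched ≤ tb ℓ → (∀ {x y} → D x y → x ∈ touched) →
        let A' = λ s → ⟦ outForm s ⟧ (ustr E' D A (iterW (iterations n) stepForm E' D A)) in
        Inv a₀ b₀ (cb ℓ) E' A' × Encodes E' A' b ℓ
      advance {E} {E'} {D} {A} inv E'? D? E'-sym unchanged E'-irr tw touched len D-touched =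
        Update.Bounded.Step.advanced {suc n''} {E} {E'} {D} E? E'? D? E-sym E'-sym unchanged {closureRel a₀ b₀ A}
          (λ x y → A? #closure (x ∷ y ∷ [])) cl-refl cl-sep E'-irr tw (suc zero) (λ ()) (cb ℓ) (tb ℓ) cl-list touched len D-touched
          a₀ b₀ {A} A? conn-inv size-inv edge-inv (λ _ _ → ⟺-refl)
          ((1 + ⌈log₂ ℓ ⌉) * e) (poly-log path-poly ℓ 1≤ℓ) (enough-rounds n) refl
        where open Inv inv

      run-correct : ∀ cs {S : State n} → All (ValidChange (ℓ ^ c')) cs → (∀ i → i ≤ length cs → TreewidthAtMost k (proj₁ (runFrom S (take i cs)))) →
                    Inv a₀ b₀ (cb ℓ) (proj₁ S) (proj₂ S) → Encodes (proj₁ S) (proj₂ S) b ℓ →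
                    Encodes (proj₁ (runFrom S cs)) (proj₂ (runFrom S cs)) b ℓ
      run-correct [] _ _ inv enc = enc
      run-correct (ins L ∷ cs) {E , A} ((short , ne) All.∷ valid) tw inv enc = run-correct cs valid (λ i i≤ → tw (suc i) (s≤s i≤)) (proj₁ next) (proj₂ next)
        where
        open Inv inv
        next = advance inv (λ u v → E? u v ⊎-dec InΔ? L u v) (InΔ? L) [ inj₁ ∘ E-sym , inj₂ ∘ InΔ-sym ]′
          (λ nd → inj₁ , [ id , ⊥-elim ∘ nd ]′) [ E-irr , InΔ-irr ne ]′ (tw 1 (s≤s z≤n)) (endpoints L) (endpoints-length L short) InΔ-endpoints
      run-correct (del L ∷ cs) {E , A} ((short , ne) All.∷ valid) tw inv enc = run-correct cs valid (λ i i≤ → tw (suc i) (s≤s i≤)) (proj₁ next) (proj₂ next)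
        where
        open Inv inv
        next = advance inv (λ u v → E? u v ×-dec ¬? (InΔ? L u v)) (InΔ? L) (λ (h , nd) → E-sym h , nd ∘ InΔ-sym)
          (λ nd → (λ h → h , nd) , proj₁) (λ (h , _) → E-irr h) (tw 1 (s≤s z≤n)) (endpoints L) (endpoints-length L short) InΔ-endpoints

    correct : ∀ n → 1 ≤ n → ∀ cs → All (ValidChange (⌈log₂ n ⌉ ^ c')) cs → (∀ i → i ≤ length cs → TreewidthAtMost k (proj₁ (run (take i cs)))) →
              Encodes (proj₁ (run {n} cs)) (proj₂ (run cs)) b ⌈log₂ n ⌉
    correct 1 _ cs valid tw = one-vertex cs valid (λ ()) initial
    correct (suc (suc n'')) _ cs valid tw = run-correct cs valid tw
      (Init.inv₀ noStr (dec⟦⟧ λ ()) a₀ b₀ (cb ⌈log₂ suc (suc n'') ⌉) (s≤s z≤n)) initial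

  -- Treewidth 0 means that there are no edges, and the initial star stays valid.
  module Edgeless where


    P : DynProg
    P = record { r = suc b ; m = 4 ; w = 0 ; ars = arities ; a = 0 ; b = 0
               ; init = initForm ; stepIns = falseF ; stepDel = falseF ; outIns = initForm ; outDel = initForm }

    open Run P

    Good : ∀ {n'} → State (suc n') → Set
    Good {n'} (E , A) = (∀ x y → Dec (E x y)) × (∀ {x} → ¬ E x x) × (∀ s t → Dec (A s t)) ×
      ((∀ {x y} → ¬ E x y) → Encodes E A 0 ⌈log₂ suc n' ⌉)

    good-run : ∀ {n' B} (cs : List (Change (suc n'))) {S : State (suc n')} → All (ValidChange B) cs → Good S → Good (runFrom S cs)
    good-run [] _ g = g
    good-run (ins L ∷ cs) {S = E , A} ((_ , ne) All.∷ valid) (E? , irr , A? , _) = good-run cs valid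
      (E'? , [ irr , InΔ-irr ne ]′ , (λ s t → U? (initForm s) t) , Init.encodes₀ _ U?)
      where
      E'? : ∀ x y → Dec (E x y ⊎ InΔ L x y)
      E'? x y = E? x y ⊎-dec InΔ? L x y
      U? : ∀ {v} φ ρ → Dec (⟦_⟧ {v = v} φ (ustr (λ u v → E u v ⊎ InΔ L u v) (InΔ L) A (λ _ → ⊥)) ρ)
      U? = dec⟦⟧ (ustr? P E'? (InΔ? L) A? (λ _ → no λ ()))
    good-run (del L ∷ cs) {S = E , A} ((_ , ne) All.∷ valid) (E? , irr , A? , _) = good-run cs valid
      (E'? , (λ (h , _) → irr h) , (λ s t → U? (initForm s) t) , Init.encodes₀ _ U?)
      where
      E'? : ∀ x y → Dec (E x y × ¬ InΔ L x y)
      E'? x y = E? x y ×-dec ¬? (InΔ? L x y)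
      U? : ∀ {v} φ ρ → Dec (⟦_⟧ {v = v} φ (ustr (λ u v → E u v × ¬ InΔ L u v) (InΔ L) A (λ _ → ⊥)) ρ)
      U? = dec⟦⟧ (ustr? P E'? (InΔ? L) A? (λ _ → no λ ()))

    no-edges : ∀ {n} {E : Graph n} → (∀ {x} → ¬ E x x) → TreewidthAtMost 0 E → ∀ {x y} → ¬ E x y
    no-edges {E = E} irr (_ , _ , _ , _ , td , wd) {x} {y} h with IsTreeDecomposition.cover-edge td h
    ... | t , bx , by with wd t tt
    ...   | L , l , f = irr (subst (E x) (sym (equal l (f x bx) (f y by))) h)
      where
      equal : ∀ {L : List (Fin _)} {x y} → length L ≤ 1 → x ∈ L → y ∈ L → x ≡ y
      equal {_ ∷ []} _ (here p) (here q) = trans p (sym q)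
      equal {_ ∷ _ ∷ _} (s≤s ())

    correct : ∀ n → 1 ≤ n → ∀ {B} cs → All (ValidChange B) cs → (∀ i → i ≤ length cs → TreewidthAtMost 0 (proj₁ (run (take i cs)))) →
              Encodes (proj₁ (run {n} cs)) (proj₂ (run cs)) 0 ⌈log₂ n ⌉
    correct (suc n') _ cs valid tw = let _ , irr , _ , enc = good-run cs valid start₀ in
      enc (no-edges irr (subst (λ cs' → TreewidthAtMost 0 (proj₁ (run cs'))) (LP.take-all (length cs) cs ≤-refl) (tw (length cs) ≤-refl)))
      where
      start₀ : Good {n'} initState
      start₀ = (λ x y → no λ ()) , (λ ()) , (λ s t → dec⟦⟧ (λ ()) (initForm s) t) , Init.encodes₀ noStr (dec⟦⟧ λ ())

theorem15 : ∀ (k : ℕ) → ∃ λ (c : ℕ) → ∃ λ (d : ℕ) → ∀ (c' : ℕ) →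
    ∃ λ (P : DynProg) →
    Maintains P k (λ n → ⌈log₂ n ⌉ ^ c') (λ n → c * k) (λ n → d * ⌈log₂ n ⌉)
-- Width `c * 0` allows a single vertex per bag, while the general construction puts vertex 0 into
-- every bag.
theorem15 zero = 0 , 1 , λ c' → P , λ n 1≤n cs valid tw →
  Encodes-mono (proj₂ (Run.run P cs)) z≤n (≤-reflexive (sym (+-identityʳ _))) (correct n 1≤n cs valid tw)
  where
  open Width 0 using (Encodes-mono)
  open Width.Edgeless 0 using (P; correct)
-- As `c` may depend on the treewidth, `ss (suc k)` itself serves as the factor; `d = 1` because
-- sizes halve at every step down.
theorem15 (suc k) = ss (suc k) , 1 , λ c' → P c' , λ n 1≤n cs valid tw →
  Encodes-mono (proj₂ (Run.run (P c') cs)) (m≤m*n (ss (suc k)) (suc k)) (≤-reflexive (sym (+-identityʳ _)))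
    (correct c' n 1≤n cs valid tw)
  where
  open Width (suc k) using (Encodes-mono)
  open Width.Program (suc k) using (P; correct)
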